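{- Let $c,k$ be fixed positive integers with $c\le k$, let $t>0$ be a real constant, and let $s=s(n)$ be an integer-valued function with $s(n)\ge c$ for all $n$. If $s(n)\sim t\,n^{1/c^2}$ as $n\to\infty$, then $$\lim_{n\to\infty}p(n,c,k,s(n))=e^{ -\binom{k}{c}t^{ -c^2}(c!)^c}.$$
   Context: $C_n^k$ denotes the $k$-th power of the cycle on $n$ vertices: its vertex set is $\{0,\ldots,n-1\}$, and distinct vertices $i,j$ are adjacent iff $(i-j) \bmod n\in\{ -k,\ldots,-1,1,\ldots,k\}$ (residues modulo $n$), i.e. iff their distance along the cycle is at most $k$. Given a set $L(x)$ of colours for each vertex $x$ of a graph $G$, an $L$-colouring of $G$ is a map $f$ from $V(G)$ to the colours with $f(x)\in L(x)$ for all $x\in V(G)$ and $f(x)\ne f(y)$ for every edge $(x,y)\in E(G)$; $G$ is $L$-colourable if it has an $L$-colouring. Let $\mathcal{S}$ be a set of colours of size $s(n)$. For each vertex of $C_n^k$, independently, draw a subset of $\mathcal{S}$ of size $c$ uniformly at random among all $c$-element subsets of $\mathcal{S}$; this gives a random list assignment $L$. Then $p(n,c,k,s(n))$ is the probability that $C_n^k$ is $L$-colourable. The parameters $c,k,t$ are fixed and all asymptotics are as $n\to\infty$; $f\sim g$ means $\lim_{n\to\infty} f/g=1$. -}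

module Defs where

open import Level using (0ℓ)
open import Data.Nat.Base as ℕ using (ℕ; zero; suc; z≤n; s≤s; _!)
import Data.Nat.Properties as ℕ
import Data.Nat.Divisibility as ℕ
open import Data.Integer.Base as ℤ using (ℤ; +_; -[1+_])
import Data.Integer.Properties as ℤ
import Data.Integer.Divisibility as ℤ
open import Data.Rational.Base as ℚ using (ℚ; 0ℚ; 1ℚ; ½) hiding (module ℚ)
import Data.Rational.Properties as ℚ
open import Data.Rational.Solver using (module +-*-Solver)
import Data.Rational.Unnormalised.Base as ℚᵘ
import Data.Rational.Unnormalised.Properties as ℚᵘ
import Algebra.Definitions.RawSemiring as RawSemiringDefs
open import Data.Fin.Base as Fin using (Fin; toℕ)
import Data.Fin.Properties as Fin
open import Data.Fin.Subset using (Subset; _∈_; ∣_∣; inside; outside)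
open import Data.Fin.Subset.Properties using (_∈?_)
open import Data.List.Base using (List; []; _∷_; length; filter; cartesianProductWith)
open import Data.Vec.Base as Vec using (Vec; []; _∷_; lookup)
open import Data.Product.Base using (∃; _×_; _,_; proj₁; proj₂)
open import Data.Sum.Base using (_⊎_; inj₁; inj₂)
open import Data.Empty using (⊥-elim)
open import Function.Base using (_∘_)
open import Relation.Nullary.Decidable using (Dec; yes; no; map′; _×-dec_; _⊎-dec_; _→-dec_; ¬?)
open import Relation.Unary using (Pred) renaming (Decidable to Decidable₁)
open import Relation.Binary.Core using (Rel)
open import Relation.Binary.Definitions using (Decidable)
open import Relation.Binary.PropositionalEquality
  using (_≡_; _≢_; refl; sym; trans; cong; cong₂; subst; subst₂; module ≡-Reasoning)

private
  variable
    n s : ℕ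
    A : Set

open RawSemiringDefs ℚ.+-*-rawSemiring using () renaming (_^_ to _^ℚ_)

module ℚLemmas where
  open import Data.Rational.Base using (_+_; _-_; _*_; -_; _≤_; _<_)
  open +-*-Solver using (solve; _:+_; _:*_; _:-_; :-_; _:=_; con)

  fromℕ : ℕ → ℚ
  fromℕ m = + m ℚ./ 1

  -- Both sides are compared through ℚᵘ, where they compute.
  private
    ⟦_⟧ : ∀ a b .{{_ : ℕ.NonZero b}} → ℚ.toℚᵘ (a ℚ./ b) ℚᵘ.≃ (a ℚᵘ./ b)
    ⟦ a ⟧ (suc b) = ℚ.toℚᵘ-fromℚᵘ (ℚᵘ.mkℚᵘ a b)

  /-≤ : ∀ a b c d .{{_ : ℕ.NonZero b}} .{{_ : ℕ.NonZero d}} →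
        a ℕ.* d ℕ.≤ c ℕ.* b → + a ℚ./ b ≤ + c ℚ./ d
  /-≤ a b@(suc _) c d@(suc _) h = ℚ.toℚᵘ-cancel-≤
    (ℚᵘ.≤-respˡ-≃ (ℚᵘ.≃-sym (⟦ + a ⟧ b)) (ℚᵘ.≤-respʳ-≃ (ℚᵘ.≃-sym (⟦ + c ⟧ d))
      (ℚᵘ.*≤* (subst₂ ℤ._≤_ (ℤ.pos-* a d) (ℤ.pos-* c b) (ℤ.+≤+ h)))))

  /-* : ∀ a b c d .{{_ : ℕ.NonZero b}} .{{_ : ℕ.NonZero d}} .{{_ : ℕ.NonZero (b ℕ.* d)}} →
        (+ a ℚ./ b) * (+ c ℚ./ d) ≡ + (a ℕ.* c) ℚ./ (b ℕ.* d)
  /-* a b@(suc _) c d@(suc _) = ℚ.toℚᵘ-injective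
    (ℚᵘ.≃-trans (ℚ.toℚᵘ-homo-* (+ a ℚ./ b) (+ c ℚ./ d))
    (ℚᵘ.≃-trans (ℚᵘ.*-cong (⟦ + a ⟧ b) (⟦ + c ⟧ d))
    (ℚᵘ.≃-trans (ℚᵘ.≃-reflexive (cong (ℚᵘ._/ (b ℕ.* d)) (sym (ℤ.pos-* a c))))
      (ℚᵘ.≃-sym (⟦ + (a ℕ.* c) ⟧ (b ℕ.* d))))))

  /-+ : ∀ a c d .{{_ : ℕ.NonZero d}} →
        (+ a ℚ./ d) + (+ c ℚ./ d) ≡ + (a ℕ.+ c) ℚ./ d
  /-+ a c d@(suc _) = ℚ.toℚᵘ-injective
    (ℚᵘ.≃-trans (ℚ.toℚᵘ-homo-+ (+ a ℚ./ d) (+ c ℚ./ d))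
    (ℚᵘ.≃-trans (ℚᵘ.+-cong (⟦ + a ⟧ d) (⟦ + c ⟧ d))
    (ℚᵘ.≃-trans (ℚᵘ.*≡* eq)
      (ℚᵘ.≃-sym (⟦ + (a ℕ.+ c) ⟧ d)))))
    where
    eq : (+ a ℤ.* + d ℤ.+ + c ℤ.* + d) ℤ.* + d ≡ + (a ℕ.+ c) ℤ.* + (d ℕ.* d)
    eq = trans (cong (ℤ._* + d) (sym (ℤ.*-distribʳ-+ (+ d) (+ a) (+ c))))
         (trans (ℤ.*-assoc (+ (a ℕ.+ c)) (+ d) (+ d))
                (cong (+ (a ℕ.+ c) ℤ.*_) (sym (ℤ.pos-* d d))))

  fromℕ-suc : ∀ m → fromℕ (suc m) ≡ 1ℚ + fromℕ m
  fromℕ-suc m = sym (/-+ 1 m 1)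

  fromℕ-mono : ∀ {m o} → m ℕ.≤ o → fromℕ m ≤ fromℕ o
  fromℕ-mono {m} {o} h = /-≤ m 1 o 1 (ℕ.*-monoˡ-≤ 1 h)

  0≤fromℕ : ∀ m → 0ℚ ≤ fromℕ m
  0≤fromℕ m = fromℕ-mono {0} {m} z≤n

  0<1 : 0ℚ < 1ℚ
  0<1 = ℚ.positive⁻¹ 1ℚ

  0<fromℕ-suc : ∀ m → 0ℚ < fromℕ (suc m)
  0<fromℕ-suc m = ℚ.<-≤-trans 0<1 (fromℕ-mono {1} {suc m} (s≤s z≤n))

  archimedean : ∀ p → ∃ λ N → p ≤ fromℕ N
  archimedean p = N ,
    subst (_≤ fromℕ N) (ℚ.↥p/↧p≡p p) (bound (ℚ.↥ p) (ℚ.ℚ.denominator-1 p))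
    where
    N = ℤ.∣ ℚ.↥ p ∣
    bound : ∀ z d → z ℚ./ suc d ≤ fromℕ ℤ.∣ z ∣
    bound (+ a) d = /-≤ a (suc d) a 1 (ℕ.*-monoʳ-≤ a (s≤s z≤n))
    bound -[1+ a ] d = ℚ.≤-trans
      (ℚ.<⇒≤ (ℚ.negative⁻¹ (-[1+ a ] ℚ./ suc d)
        {{ℚ.neg-pos {+ suc a ℚ./ suc d} (ℚ.normalize-pos (suc a) (suc d))}}))
      (0≤fromℕ (suc a))

  *-monoˡ : ∀ {r p q} → 0ℚ ≤ r → p ≤ q → r * p ≤ r * q
  *-monoˡ {r} h = ℚ.*-monoˡ-≤-nonNeg r {{ℚ.nonNegative h}}

  *-monoʳ : ∀ {r p q} → 0ℚ ≤ r → p ≤ q → p * r ≤ q * r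
  *-monoʳ {r} h = ℚ.*-monoʳ-≤-nonNeg r {{ℚ.nonNegative h}}

  *-nonNeg : ∀ {p q} → 0ℚ ≤ p → 0ℚ ≤ q → 0ℚ ≤ p * q
  *-nonNeg {p} {q} h k = subst (_≤ p * q) (ℚ.*-zeroʳ p) (*-monoˡ h k)

  *-pos : ∀ {p q} → 0ℚ < p → 0ℚ < q → 0ℚ < p * q
  *-pos {p} {q} h k = ℚ.positive⁻¹ (p * q)
    {{ℚ.pos*pos⇒pos p {{ℚ.positive h}} q {{ℚ.positive k}}}}

  *-mono : ∀ {p q r t} → 0ℚ ≤ p → 0ℚ ≤ t → p ≤ q → r ≤ t → p * r ≤ q * t
  *-mono hp ht pq rt = ℚ.≤-trans (*-monoˡ hp rt) (*-monoʳ ht pq)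

  +-nonNeg : ∀ {p q} → 0ℚ ≤ p → 0ℚ ≤ q → 0ℚ ≤ p + q
  +-nonNeg {p} {q} h k = subst (_≤ p + q) (ℚ.+-identityˡ 0ℚ) (ℚ.+-mono-≤ h k)

  ≤-+ʳ : ∀ {p q} → 0ℚ ≤ q → p ≤ p + q
  ≤-+ʳ {p} {q} h = subst (_≤ p + q) (ℚ.+-identityʳ p) (ℚ.+-monoʳ-≤ p h)

  ∣-∣-swap : ∀ p q → ℚ.∣ p - q ∣ ≡ ℚ.∣ q - p ∣
  ∣-∣-swap p q = trans
    (cong ℚ.∣_∣ (solve 2 (λ p q → p :- q := :- (q :- p)) refl p q))
    (ℚ.∣-p∣≡∣p∣ (q - p))

  ∣*∣-≤ : ∀ {p q P Q} → ℚ.∣ p ∣ ≤ P → ℚ.∣ q ∣ ≤ Q → ℚ.∣ p * q ∣ ≤ P * Q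
  ∣*∣-≤ {p} {q} {P} {Q} hp hq = subst (_≤ P * Q) (sym (ℚ.∣p*q∣≡∣p∣*∣q∣ p q))
    (*-mono (ℚ.0≤∣p∣ p) (ℚ.≤-trans (ℚ.0≤∣p∣ q) hq) hp hq)

  ∣+∣-≤ : ∀ {p q P Q} → ℚ.∣ p ∣ ≤ P → ℚ.∣ q ∣ ≤ Q → ℚ.∣ p + q ∣ ≤ P + Q
  ∣+∣-≤ {p} {q} hp hq = ℚ.≤-trans (ℚ.∣p+q∣≤∣p∣+∣q∣ p q) (ℚ.+-mono-≤ hp hq)

  ∣∣-≤ : ∀ {p q} → p ≤ q → - p ≤ q → ℚ.∣ p ∣ ≤ q
  ∣∣-≤ {p} {q} h k with ℚ.∣p∣≡p∨∣p∣≡-p p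
  ... | inj₁ e = subst (_≤ q) (sym e) h
  ... | inj₂ e = subst (_≤ q) (sym e) k

  -- Total reciprocal, with junk value 0 at 0.
  recip : ℚ → ℚ
  recip q with q ℚ.≟ 0ℚ
  ... | yes _  = 0ℚ
  ... | no q≢0 = ℚ.1/_ q {{ℚ.≢-nonZero q≢0}}

  *-recip : ∀ {q} → 0ℚ < q → q * recip q ≡ 1ℚ
  *-recip {q} h with q ℚ.≟ 0ℚ
  ... | yes refl = ⊥-elim (ℚ.<-irrefl refl h)
  ... | no q≢0   = ℚ.*-inverseʳ q {{ℚ.≢-nonZero q≢0}}

  0<recip : ∀ {q} → 0ℚ < q → 0ℚ < recip q
  0<recip {q} h with q ℚ.≟ 0ℚ
  ... | yes refl = ⊥-elim (ℚ.<-irrefl refl h)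
  ... | no q≢0   = ℚ.positive⁻¹ _ {{ℚ.1/pos⇒pos q {{ℚ.positive h}}}}

  recip-anti : ∀ {p q} → 0ℚ < p → p ≤ q → recip q ≤ recip p
  recip-anti {p} {q} hp pq = subst₂ _≤_ e₁ e₂
    (*-monoʳ (ℚ.<⇒≤ (*-pos (0<recip hp) (0<recip hq))) pq)
    where
    hq = ℚ.<-≤-trans hp pq
    e₁ : p * (recip p * recip q) ≡ recip q
    e₁ = trans (sym (ℚ.*-assoc p (recip p) (recip q)))
         (trans (cong (_* recip q) (*-recip hp)) (ℚ.*-identityˡ (recip q)))
    e₂ : q * (recip p * recip q) ≡ recip p
    e₂ = trans (solve 3 (λ q a b → q :* (a :* b) := (q :* b) :* a) refl q (recip p) (recip q))
         (trans (cong (_* recip p) (*-recip hq)) (ℚ.*-identityˡ (recip p)))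

  recip-diff : ∀ {p q} → 0ℚ < p → 0ℚ < q → recip p - recip q ≡ (recip p * recip q) * (q - p)
  recip-diff {p} {q} hp hq = sym (begin
    (a * b) * (q - p)        ≡⟨ solve 4 (λ a b p q → (a :* b) :* (q :- p) := a :* (q :* b) :- b :* (p :* a)) refl a b p q ⟩
    a * (q * b) - b * (p * a) ≡⟨ cong₂ (λ x y → a * x - b * y) (*-recip hq) (*-recip hp) ⟩
    a * 1ℚ - b * 1ℚ          ≡⟨ cong₂ _-_ (ℚ.*-identityʳ a) (ℚ.*-identityʳ b) ⟩
    a - b ∎)
    where
    open ≡-Reasoning
    a = recip p
    b = recip q

open ℚLemmas

IsCauchy : (ℕ → ℚ) → Set
IsCauchy a = ∀ ε → 0ℚ ℚ.< ε → ∃ λ N → ∀ i j → N ℕ.≤ i → N ℕ.≤ j →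
  ℚ.∣ a i ℚ.- a j ∣ ℚ.< ε

-- A real number is represented by a Cauchy sequence of rationals; different
-- sequences may represent the same number, so _≡_ is not equality of reals.
record ℝ : Set where
  constructor mkℝ
  field
    approx : ℕ → ℚ
    cauchy : IsCauchy approx

open ℝ public

module CauchyLemmas where
  open import Data.Rational.Base using (_+_; _-_; _*_; -_; _≤_; _<_)
  open +-*-Solver using (solve; _:+_; _:*_; _:-_; :-_; _:=_; con)

  -- It suffices to bound |aᵢ − aⱼ| by K·δ for i ≤ j, with K independent of δ.
  mkCauchy : ∀ a K → 0ℚ ≤ K →
    (∀ δ → 0ℚ < δ → ∃ λ N → ∀ i j → N ℕ.≤ i → i ℕ.≤ j → ℚ.∣ a i - a j ∣ ≤ K * δ) →
    IsCauchy a
  mkCauchy a K 0≤K h ε 0<ε = proj₁ (h δ 0<δ) , bound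
    where
    L = K + 1ℚ
    K<L : K < L
    K<L = subst (_< L) (ℚ.+-identityʳ K) (ℚ.+-monoʳ-< K 0<1)
    0<L : 0ℚ < L
    0<L = ℚ.≤-<-trans 0≤K K<L
    δ = recip L * ε
    0<δ : 0ℚ < δ
    0<δ = *-pos (0<recip 0<L) 0<ε
    Kδ<ε : K * δ < ε
    Kδ<ε = subst (K * δ <_)
      (trans (sym (ℚ.*-assoc L (recip L) ε)) (trans (cong (_* ε) (*-recip 0<L)) (ℚ.*-identityˡ ε)))
      (ℚ.*-monoˡ-<-pos δ {{ℚ.positive 0<δ}} K<L)
    bound : ∀ i j → proj₁ (h δ 0<δ) ℕ.≤ i → proj₁ (h δ 0<δ) ℕ.≤ j → ℚ.∣ a i - a j ∣ < ε
    bound i j hi hj with ℕ.≤-total i j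
    ... | inj₁ i≤j = ℚ.≤-<-trans (proj₂ (h δ 0<δ) i j hi i≤j) Kδ<ε
    ... | inj₂ j≤i = subst (_< ε) (∣-∣-swap (a j) (a i))
                       (ℚ.≤-<-trans (proj₂ (h δ 0<δ) j i hj j≤i) Kδ<ε)

  eventuallyBounded : (x : ℝ) → ∃ λ B → 0ℚ ≤ B ×
    ∃ λ N → ∀ i → N ℕ.≤ i → ℚ.∣ approx x i ∣ ≤ B
  eventuallyBounded x with cauchy x 1ℚ 0<1
  ... | N , h = 1ℚ + ℚ.∣ a N ∣ , +-nonNeg (ℚ.<⇒≤ 0<1) (ℚ.0≤∣p∣ (a N)) , N , λ i hi →
    subst (λ z → ℚ.∣ z ∣ ≤ 1ℚ + ℚ.∣ a N ∣)
      (solve 2 (λ p q → (p :- q) :+ q := p) refl (a i) (a N))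
      (∣+∣-≤ (ℚ.<⇒≤ (h i N hi ℕ.≤-refl)) ℚ.≤-refl)
    where a = approx x

  cauchy₂ : (x y : ℝ) → ∀ δ → 0ℚ < δ → ∃ λ N → ∀ i j → N ℕ.≤ i → N ℕ.≤ j →
    ℚ.∣ approx x i - approx x j ∣ ≤ δ × ℚ.∣ approx y i - approx y j ∣ ≤ δ
  cauchy₂ x y δ 0<δ with cauchy x δ 0<δ | cauchy y δ 0<δ
  ... | M , f | N , g = M ℕ.⊔ N , λ i j hi hj →
      ℚ.<⇒≤ (f i j (ℕ.≤-trans (ℕ.m≤m⊔n M N) hi) (ℕ.≤-trans (ℕ.m≤m⊔n M N) hj))
    , ℚ.<⇒≤ (g i j (ℕ.≤-trans (ℕ.m≤n⊔m M N) hi) (ℕ.≤-trans (ℕ.m≤n⊔m M N) hj))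

open CauchyLemmas

infix  4 _<ℝ_
infixl 6 _+ℝ_ _-ℝ_
infixl 7 _*ℝ_
infix  8 -ℝ_
infixr 8 _^ℝ_

-- Strict order: eventually the approximants are separated by a fixed gap.
_<ℝ_ : Rel ℝ 0ℓ
x <ℝ y = ∃ λ ε → 0ℚ ℚ.< ε × ∃ λ N → ∀ i → N ℕ.≤ i → approx x i ℚ.+ ε ℚ.≤ approx y i

fromℚ : ℚ → ℝ
fromℚ q = mkℝ (λ _ → q) λ ε 0<ε → 0 , λ _ _ _ _ →
  subst (ℚ._< ε) (sym (cong ℚ.∣_∣ (ℚ.+-inverseʳ q))) 0<ε

0ℝ 1ℝ : ℝ
0ℝ = fromℚ 0ℚ
1ℝ = fromℚ 1ℚ

fromℕℝ : ℕ → ℝ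
fromℕℝ m = fromℚ (+ m ℚ./ 1)

_+ℝ_ : ℝ → ℝ → ℝ
x +ℝ y = mkℝ (λ i → approx x i ℚ.+ approx y i)
  (mkCauchy (λ i → approx x i ℚ.+ approx y i) (fromℕ 2) (0≤fromℕ 2) λ δ 0<δ → let N , h = cauchy₂ x y δ 0<δ in
    N , λ i j hi i≤j → let hx , hy = h i j hi (ℕ.≤-trans hi i≤j) in
      subst₂ (λ u v → ℚ.∣ u ∣ ℚ.≤ v)
        (solve 4 (λ p q r t → (p :- q) :+ (r :- t) := (p :+ r) :- (q :+ t)) refl
          (approx x i) (approx x j) (approx y i) (approx y j))
        (solve 1 (λ d → d :+ d := con (fromℕ 2) :* d) refl δ)
        (∣+∣-≤ hx hy))
  where open +-*-Solver using (solve; _:+_; _:*_; _:-_; _:=_; con)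

-ℝ_ : ℝ → ℝ
-ℝ x = mkℝ (λ i → ℚ.- approx x i) λ ε 0<ε → let N , h = cauchy x ε 0<ε in
  N , λ i j hi hj → subst (ℚ._< ε)
    (trans (sym (ℚ.∣-p∣≡∣p∣ (approx x i ℚ.- approx x j)))
           (cong ℚ.∣_∣ (ℚ.neg-distrib-+ (approx x i) (ℚ.- approx x j))))
    (h i j hi hj)

_-ℝ_ : ℝ → ℝ → ℝ
x -ℝ y = x +ℝ (-ℝ y)

_*ℝ_ : ℝ → ℝ → ℝ
x *ℝ y = mkℝ (λ i → a i ℚ.* b i) (mkCauchy (λ i → a i ℚ.* b i) (X ℚ.+ Y) (+-nonNeg 0≤X 0≤Y) bound)
  where
  open +-*-Solver using (solve; _:+_; _:*_; _:-_; _:=_)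
  a = approx x
  b = approx y
  bx = eventuallyBounded x
  by = eventuallyBounded y
  X = proj₁ bx
  Y = proj₁ by
  0≤X = proj₁ (proj₂ bx)
  0≤Y = proj₁ (proj₂ by)
  Nx = proj₁ (proj₂ (proj₂ bx))
  Ny = proj₁ (proj₂ (proj₂ by))
  bound : ∀ δ → 0ℚ ℚ.< δ → ∃ λ N → ∀ i j → N ℕ.≤ i → i ℕ.≤ j →
    ℚ.∣ a i ℚ.* b i ℚ.- a j ℚ.* b j ∣ ℚ.≤ (X ℚ.+ Y) ℚ.* δ
  bound δ 0<δ = let N , h = cauchy₂ x y δ 0<δ in
    N ℕ.⊔ (Nx ℕ.⊔ Ny) , λ i j hi i≤j →
      let hN  = ℕ.≤-trans (ℕ.m≤m⊔n N (Nx ℕ.⊔ Ny)) hi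
          hxy = ℕ.≤-trans (ℕ.m≤n⊔m N (Nx ℕ.⊔ Ny)) hi
          hNx = ℕ.≤-trans (ℕ.m≤m⊔n Nx Ny) hxy
          hNy = ℕ.≤-trans (ℕ.m≤n⊔m Nx Ny) (ℕ.≤-trans hxy i≤j)
          hx , hy = h i j hN (ℕ.≤-trans hN i≤j)
      in subst₂ (λ u v → ℚ.∣ u ∣ ℚ.≤ v)
           (solve 4 (λ p q r t → p :* (q :- t) :+ (p :- r) :* t := p :* q :- r :* t) refl
             (a i) (b i) (a j) (b j))
           (solve 3 (λ X Y d → X :* d :+ d :* Y := (X :+ Y) :* d) refl X Y δ)
           (∣+∣-≤ (∣*∣-≤ (proj₂ (proj₂ (proj₂ bx)) i hNx) hy)
                  (∣*∣-≤ hx (proj₂ (proj₂ (proj₂ by)) j hNy)))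

_^ℝ_ : ℝ → ℕ → ℝ
x ^ℝ zero  = 1ℝ
x ^ℝ suc m = x *ℝ (x ^ℝ m)

∣_∣ℝ : ℝ → ℝ
∣ x ∣ℝ = mkℝ (λ i → ℚ.∣ approx x i ∣) λ ε 0<ε → let N , h = cauchy x ε 0<ε in
  N , λ i j hi hj → ℚ.≤-<-trans (reverse-triangle (approx x i) (approx x j)) (h i j hi hj)
  where
  open import Data.Rational.Base using (_-_; -_; _≤_)
  open +-*-Solver using (solve; _:+_; _:-_; :-_; _:=_)
  half : ∀ p q → ℚ.∣ p ∣ - ℚ.∣ q ∣ ≤ ℚ.∣ p - q ∣
  half p q = subst₂ _≤_ (cong (λ z → ℚ.∣ z ∣ - ℚ.∣ q ∣)
      (solve 2 (λ p q → (p :- q) :+ q := p) refl p q))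
    (solve 2 (λ d q → (d :+ q) :- q := d) refl ℚ.∣ p - q ∣ ℚ.∣ q ∣)
    (ℚ.+-monoˡ-≤ (- ℚ.∣ q ∣) (ℚ.∣p+q∣≤∣p∣+∣q∣ (p - q) q))
  reverse-triangle : ∀ p q → ℚ.∣ ℚ.∣ p ∣ - ℚ.∣ q ∣ ∣ ≤ ℚ.∣ p - q ∣
  reverse-triangle p q = ∣∣-≤ (half p q)
    (subst₂ _≤_ (solve 2 (λ a b → b :- a := :- (a :- b)) refl ℚ.∣ p ∣ ℚ.∣ q ∣)
      (∣-∣-swap q p) (half q p))

-- Approximants that vanish, of which there are only finitely many, are sent
-- to 0; positivity enters only through the Cauchy property.
inv : (x : ℝ) → 0ℝ <ℝ x → ℝ
inv x (d , 0<d , M , d≤x) = mkℝ (recip ∘ a) (mkCauchy (recip ∘ a) (r ℚ.* r) (*-nonNeg 0≤r 0≤r) bound)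
  where
  open import Data.Rational.Base using (_≤_; _<_; _-_; _*_)
  a = approx x
  r = recip d
  0≤r : 0ℚ ≤ r
  0≤r = ℚ.<⇒≤ (0<recip 0<d)
  lower : ∀ i → M ℕ.≤ i → d ≤ a i
  lower i hi = subst (_≤ a i) (ℚ.+-identityˡ d) (d≤x i hi)
  small : ∀ i → M ℕ.≤ i → ℚ.∣ recip (a i) ∣ ≤ r
  small i hi = subst (_≤ r)
    (sym (ℚ.0≤p⇒∣p∣≡p (ℚ.<⇒≤ (0<recip (ℚ.<-≤-trans 0<d (lower i hi))))))
    (recip-anti 0<d (lower i hi))
  bound : ∀ δ → 0ℚ < δ → ∃ λ N → ∀ i j → N ℕ.≤ i → i ℕ.≤ j →
    ℚ.∣ recip (a i) - recip (a j) ∣ ≤ (r * r) * δ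
  bound δ 0<δ = let N , h = cauchy x δ 0<δ in
    N ℕ.⊔ M , λ i j hi i≤j →
      let hN = ℕ.≤-trans (ℕ.m≤m⊔n N M) hi
          hM = ℕ.≤-trans (ℕ.m≤n⊔m N M) hi
          hM′ = ℕ.≤-trans hM i≤j
      in subst (λ u → ℚ.∣ u ∣ ≤ (r * r) * δ)
           (sym (recip-diff (ℚ.<-≤-trans 0<d (lower i hM)) (ℚ.<-≤-trans 0<d (lower j hM′))))
           (∣*∣-≤ (∣*∣-≤ (small i hM) (small j hM′))
                  (ℚ.<⇒≤ (h j i (ℕ.≤-trans hN i≤j) hN)))

*ℝ-pos : ∀ {x y} → 0ℝ <ℝ x → 0ℝ <ℝ y → 0ℝ <ℝ x *ℝ y
*ℝ-pos {x} {y} (d , 0<d , M , f) (e , 0<e , N , g) =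
  d ℚ.* e , *-pos 0<d 0<e , M ℕ.⊔ N , λ i hi →
    let d≤x = subst (ℚ._≤ approx x i) (ℚ.+-identityˡ d) (f i (ℕ.≤-trans (ℕ.m≤m⊔n M N) hi))
        e≤y = subst (ℚ._≤ approx y i) (ℚ.+-identityˡ e) (g i (ℕ.≤-trans (ℕ.m≤n⊔m M N) hi))
        0≤d = ℚ.<⇒≤ 0<d
    in subst (ℚ._≤ approx x i ℚ.* approx y i) (sym (ℚ.+-identityˡ (d ℚ.* e)))
         (*-mono 0≤d (ℚ.≤-trans (ℚ.<⇒≤ 0<e) e≤y) d≤x e≤y)


-- The largest j ≤ x with j ^ d ≤ x; for d ≥ 1 this is ⌊x^{1/d}⌋.
floorRoot : ℕ → ℕ → ℕ
floorRoot d x = search x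
  module FloorRoot where
  search : ℕ → ℕ
  search zero    = zero
  search (suc j) with suc j ℕ.^ d ℕ.≤? x
  ... | yes _ = suc j
  ... | no _  = search j

module RootLemmas where
  open import Data.Nat.Base using (_≤_; _<_; _^_; _*_)

  0^ : ∀ d .{{_ : ℕ.NonZero d}} → 0 ^ d ≡ 0
  0^ (suc _) = refl

  ≤-^ : ∀ j d .{{_ : ℕ.NonZero d}} → j ≤ j ^ d
  ≤-^ zero    d       = z≤n
  ≤-^ (suc j) (suc d) =
    subst (_≤ suc j ^ suc d) (ℕ.*-identityʳ (suc j)) (ℕ.*-monoʳ-≤ (suc j) (ℕ.m^n>0 (suc j) d))

  search-^ : ∀ d .{{_ : ℕ.NonZero d}} x m → FloorRoot.search d x m ^ d ≤ x
  search-^ d x zero    = subst (_≤ x) (sym (0^ d)) z≤n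
  search-^ d x (suc m) with suc m ^ d ℕ.≤? x
  ... | yes h = h
  ... | no _  = search-^ d x m

  search-max : ∀ d x m j → j ≤ m → j ^ d ≤ x → j ≤ FloorRoot.search d x m
  search-max d x zero    j j≤m h = j≤m
  search-max d x (suc m) j j≤m h with suc m ^ d ℕ.≤? x
  ... | yes _ = j≤m
  ... | no ¬p with ℕ.m≤n⇒m<n∨m≡n j≤m
  ...   | inj₁ (s≤s j≤m′) = search-max d x m j j≤m′ h
  ...   | inj₂ refl       = ⊥-elim (¬p h)

  floorRoot-^ : ∀ d .{{_ : ℕ.NonZero d}} x → floorRoot d x ^ d ≤ x
  floorRoot-^ d x = search-^ d x x

  floorRoot-max : ∀ d .{{_ : ℕ.NonZero d}} x j → j ^ d ≤ x → j ≤ floorRoot d x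
  floorRoot-max d x j h = search-max d x x j (ℕ.≤-trans (≤-^ j d) h) h

  ^-distrib-* : ∀ a b d → (a * b) ^ d ≡ a ^ d * b ^ d
  ^-distrib-* a b zero    = refl
  ^-distrib-* a b (suc d) = trans (cong (a * b *_) (^-distrib-* a b d))
    (ℕ.[m*n]*[o*p]≡[m*o]*[n*p] a b (a ^ d) (b ^ d))

open RootLemmas

-- The real number n^{1/d}: its i-th approximant ⌊(n (i+1)^d)^{1/d}⌋ / (i+1)
-- is n^{1/d} rounded down to a multiple of 1/(i+1).
root : (d : ℕ) .{{_ : ℕ.NonZero d}} → ℕ → ℝ
root d n = mkℝ a (mkCauchy a 1ℚ (ℚ.<⇒≤ 0<1) bound)
  where
  open import Data.Rational.Base using (_+_; _-_; _*_; -_; _≤_; _<_)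
  open +-*-Solver using (solve; _:+_; _:*_; _:-_; :-_; _:=_; con)
  r : ℕ → ℕ
  r i = floorRoot d (n ℕ.* suc i ℕ.^ d)
  a : ℕ → ℚ
  a i = + r i ℚ./ suc i

  cross : ∀ i j → r i ℕ.* suc j ℕ.≤ suc (r j) ℕ.* suc i
  cross i j with r i ℕ.* suc j ℕ.≤? suc (r j) ℕ.* suc i
  ... | yes h = h
  ... | no ¬h = ⊥-elim (ℕ.<-irrefl refl (floorRoot-max d (n ℕ.* suc j ℕ.^ d) (suc (r j)) below))
    where
    open ℕ.≤-Reasoning
    below : suc (r j) ℕ.^ d ℕ.≤ n ℕ.* suc j ℕ.^ d
    below = ℕ.*-cancelʳ-≤ _ _ (suc i ℕ.^ d) {{ℕ.m^n≢0 (suc i) d}} (begin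
      suc (r j) ℕ.^ d ℕ.* suc i ℕ.^ d     ≡⟨ ^-distrib-* (suc (r j)) (suc i) d ⟨
      (suc (r j) ℕ.* suc i) ℕ.^ d         ≤⟨ ℕ.^-monoˡ-≤ d (ℕ.<⇒≤ (ℕ.≰⇒> ¬h)) ⟩
      (r i ℕ.* suc j) ℕ.^ d               ≡⟨ ^-distrib-* (r i) (suc j) d ⟩
      r i ℕ.^ d ℕ.* suc j ℕ.^ d           ≤⟨ ℕ.*-monoˡ-≤ (suc j ℕ.^ d) (floorRoot-^ d (n ℕ.* suc i ℕ.^ d)) ⟩
      n ℕ.* suc i ℕ.^ d ℕ.* suc j ℕ.^ d   ≡⟨ ℕ.*-assoc n (suc i ℕ.^ d) (suc j ℕ.^ d) ⟩
      n ℕ.* (suc i ℕ.^ d ℕ.* suc j ℕ.^ d) ≡⟨ cong (n ℕ.*_) (ℕ.*-comm (suc i ℕ.^ d) (suc j ℕ.^ d)) ⟩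
      n ℕ.* (suc j ℕ.^ d ℕ.* suc i ℕ.^ d) ≡⟨ ℕ.*-assoc n (suc j ℕ.^ d) (suc i ℕ.^ d) ⟨
      n ℕ.* suc j ℕ.^ d ℕ.* suc i ℕ.^ d   ∎)

  above : ∀ i j → a i ≤ + 1 ℚ./ suc j + a j
  above i j = subst (a i ≤_) (sym (/-+ 1 (r j) (suc j)))
    (/-≤ (r i) (suc i) (suc (r j)) (suc j) (cross i j))

  close : ∀ i j → a i - a j ≤ + 1 ℚ./ suc j
  close i j = subst (a i - a j ≤_)
    (solve 2 (λ u v → (u :+ v) :- v := u) refl (+ 1 ℚ./ suc j) (a j))
    (ℚ.+-monoˡ-≤ (- a j) (above i j))

  bound : ∀ δ → 0ℚ < δ → ∃ λ N → ∀ i j → N ℕ.≤ i → i ℕ.≤ j → ℚ.∣ a i - a j ∣ ≤ 1ℚ * δ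
  bound δ 0<δ = N , λ i j hi i≤j → subst (ℚ.∣ a i - a j ∣ ≤_) (sym (ℚ.*-identityˡ δ))
    (∣∣-≤ (ℚ.≤-trans (close i j) (small j (ℕ.≤-trans hi i≤j)))
      (ℚ.≤-trans (subst (_≤ + 1 ℚ./ suc i)
          (solve 2 (λ u v → v :- u := :- (u :- v)) refl (a i) (a j)) (close j i))
        (small i hi)))
    where
    N = proj₁ (archimedean (recip δ))
    small : ∀ i → N ℕ.≤ i → + 1 ℚ./ suc i ≤ δ
    small i hi = subst₂ _≤_
      (trans (cong (_* u) (*-recip 0<δ)) (ℚ.*-identityˡ u))
      (trans (ℚ.*-assoc δ _ u)
        (trans (cong (δ *_) (trans (/-* (suc i) 1 1 (suc i)) one)) (ℚ.*-identityʳ δ)))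
      (*-monoʳ 0≤u (*-monoˡ (ℚ.<⇒≤ 0<δ)
        (ℚ.≤-trans (proj₂ (archimedean (recip δ)))
          (fromℕ-mono {N} {suc i} (ℕ.m≤n⇒m≤1+n hi)))))
      where
      u = + 1 ℚ./ suc i
      0≤u : 0ℚ ≤ u
      0≤u = /-≤ 0 1 1 (suc i) z≤n
      one : + (suc i ℕ.* 1) ℚ./ (1 ℕ.* suc i) ≡ 1ℚ
      one = ℚ.≤-antisym
        (/-≤ (suc i ℕ.* 1) (1 ℕ.* suc i) 1 1 (ℕ.≤-reflexive e))
        (/-≤ 1 1 (suc i ℕ.* 1) (1 ℕ.* suc i) (ℕ.≤-reflexive (sym e)))
        where
        e : suc i ℕ.* 1 ℕ.* 1 ≡ 1 ℕ.* (1 ℕ.* suc i)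
        e = trans (ℕ.*-identityʳ (suc i ℕ.* 1)) (trans (ℕ.*-identityʳ (suc i))
              (sym (trans (ℕ.*-identityˡ (1 ℕ.* suc i)) (ℕ.*-identityˡ (suc i)))))

root-pos : ∀ d .{{_ : ℕ.NonZero d}} n .{{_ : ℕ.NonZero n}} → 0ℝ <ℝ root d n
root-pos d n = 1ℚ , 0<1 , 0 , λ i _ →
  subst (ℚ._≤ approx (root d n) i) (sym (ℚ.+-identityˡ 1ℚ))
    (/-≤ 1 1 (floorRoot d (n ℕ.* suc i ℕ.^ d)) (suc i)
      (subst₂ ℕ._≤_ (sym (ℕ.*-identityˡ (suc i))) (sym (ℕ.*-identityʳ _))
        (floorRoot-max d (n ℕ.* suc i ℕ.^ d) (suc i) (ℕ.m≤n*m (suc i ℕ.^ d) n))))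

-- Σ_{j<m} q^j / j!
expSum : ℚ → ℕ → ℚ
expSum q zero    = 0ℚ
expSum q (suc m) = expSum q m ℚ.+ (q ^ℚ m) ℚ.* ((+ 1 ℚ./ (m !)) {{m ℕ.!≢0}})

module ExpLemmas where
  open import Data.Rational.Base using (_+_; _-_; _*_; -_; _≤_; _<_)
  open +-*-Solver using (solve; _:+_; _:*_; _:-_; :-_; _:=_; con)

  inv! : ℕ → ℚ
  inv! m = (+ 1 ℚ./ (m !)) {{m ℕ.!≢0}}

  term : ℚ → ℕ → ℚ
  term q m = (q ^ℚ m) * inv! m

  0≤inv! : ∀ m → 0ℚ ≤ inv! m
  0≤inv! m = /-≤ 0 1 1 (m !) {{_}} {{m ℕ.!≢0}} z≤n

  inv!-suc : ∀ m → inv! (suc m) ≡ (+ 1 ℚ./ suc m) * inv! m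
  inv!-suc m = sym (/-* 1 (suc m) 1 (m !) {{_}} {{m ℕ.!≢0}} {{suc m ℕ.!≢0}})

  fromℕ-* : ∀ m → fromℕ (suc m) * (+ 1 ℚ./ suc m) ≡ 1ℚ
  fromℕ-* m = ℚ.≤-antisym
    (subst (_≤ 1ℚ) (sym eq) (/-≤ (suc m ℕ.* 1) (1 ℕ.* suc m) 1 1 (ℕ.≤-reflexive e)))
    (subst (1ℚ ≤_) (sym eq) (/-≤ 1 1 (suc m ℕ.* 1) (1 ℕ.* suc m) (ℕ.≤-reflexive (sym e))))
    where
    eq = /-* (suc m) 1 1 (suc m)
    e : suc m ℕ.* 1 ℕ.* 1 ≡ 1 ℕ.* (1 ℕ.* suc m)
    e = trans (ℕ.*-identityʳ (suc m ℕ.* 1)) (trans (ℕ.*-identityʳ (suc m))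
          (sym (trans (ℕ.*-identityˡ (1 ℕ.* suc m)) (ℕ.*-identityˡ (suc m)))))

  fromℕ-*-inv! : ∀ m → fromℕ (suc m) * inv! (suc m) ≡ inv! m
  fromℕ-*-inv! m = trans (cong (fromℕ (suc m) *_) (inv!-suc m))
    (trans (sym (ℚ.*-assoc (fromℕ (suc m)) _ (inv! m)))
      (trans (cong (_* inv! m) (fromℕ-* m)) (ℚ.*-identityˡ (inv! m))))

  module _ {B : ℚ} (0≤B : 0ℚ ≤ B) where

    0≤^ : ∀ m → 0ℚ ≤ B ^ℚ m
    0≤^ zero    = ℚ.<⇒≤ 0<1
    0≤^ (suc m) = *-nonNeg 0≤B (0≤^ m)

    0≤term : ∀ m → 0ℚ ≤ term B m
    0≤term m = *-nonNeg (0≤^ m) (0≤inv! m)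

    ∣^∣ : ∀ {q} → ℚ.∣ q ∣ ≤ B → ∀ m → ℚ.∣ q ^ℚ m ∣ ≤ B ^ℚ m
    ∣^∣ h zero    = ℚ.≤-refl
    ∣^∣ h (suc m) = ∣*∣-≤ h (∣^∣ h m)

    ∣inv!∣ : ∀ m → ℚ.∣ inv! m ∣ ≤ inv! m
    ∣inv!∣ m = ℚ.≤-reflexive (ℚ.0≤p⇒∣p∣≡p (0≤inv! m))

    pow-diff : ∀ {p q} → ℚ.∣ p ∣ ≤ B → ℚ.∣ q ∣ ≤ B → ∀ m →
      ℚ.∣ (p ^ℚ suc m) - (q ^ℚ suc m) ∣ ≤ ℚ.∣ p - q ∣ * (fromℕ (suc m) * (B ^ℚ m))
    pow-diff {p} {q} hp hq zero = ℚ.≤-reflexive (trans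
      (cong ℚ.∣_∣ (cong₂ _-_ (ℚ.*-identityʳ p) (ℚ.*-identityʳ q)))
      (sym (ℚ.*-identityʳ ℚ.∣ p - q ∣)))
    pow-diff {p} {q} hp hq (suc m) = subst₂ (λ u v → ℚ.∣ u ∣ ≤ v)
      (solve 4 (λ p q x y → p :* (x :- y) :+ (p :- q) :* y := p :* x :- q :* y) refl
        p q (p ^ℚ suc m) (q ^ℚ suc m))
      (trans (solve 4 (λ b d f x → b :* (d :* (f :* x)) :+ d :* (b :* x)
                     := d :* ((con 1ℚ :+ f) :* (b :* x))) refl
               B ℚ.∣ p - q ∣ (fromℕ (suc m)) (B ^ℚ m))
        (cong (λ f → ℚ.∣ p - q ∣ * (f * (B ^ℚ suc m))) (sym (fromℕ-suc (suc m)))))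
      (∣+∣-≤ (∣*∣-≤ hp (pow-diff hp hq m)) (∣*∣-≤ {p - q} ℚ.≤-refl (∣^∣ hq (suc m))))

    term-diff : ∀ {p q} → ℚ.∣ p ∣ ≤ B → ℚ.∣ q ∣ ≤ B → ∀ m →
      ℚ.∣ term p (suc m) - term q (suc m) ∣ ≤ ℚ.∣ p - q ∣ * term B m
    term-diff {p} {q} hp hq m = subst₂ (λ u v → ℚ.∣ u ∣ ≤ v)
      (solve 3 (λ x y i → (x :- y) :* i := x :* i :- y :* i) refl
        (p ^ℚ suc m) (q ^ℚ suc m) (inv! (suc m)))
      (trans (solve 4 (λ d f x i → (d :* (f :* x)) :* i := d :* (x :* (f :* i))) refl
               ℚ.∣ p - q ∣ (fromℕ (suc m)) (B ^ℚ m) (inv! (suc m)))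
        (cong (λ z → ℚ.∣ p - q ∣ * ((B ^ℚ m) * z)) (fromℕ-*-inv! m)))
      (∣*∣-≤ (pow-diff hp hq m) (∣inv!∣ (suc m)))

    0≤expSum : ∀ m → 0ℚ ≤ expSum B m
    0≤expSum zero    = ℚ.≤-refl
    0≤expSum (suc m) = +-nonNeg (0≤expSum m) (0≤term m)

    expSum-diff : ∀ {p q} → ℚ.∣ p ∣ ≤ B → ℚ.∣ q ∣ ≤ B → ∀ m →
      ℚ.∣ expSum p m - expSum q m ∣ ≤ ℚ.∣ p - q ∣ * expSum B m
    expSum-diff {p} {q} hp hq zero = ℚ.≤-reflexive (sym (ℚ.*-zeroʳ ℚ.∣ p - q ∣))
    expSum-diff {p} {q} hp hq (suc m) = ℚ.≤-trans (step m)
      (*-monoˡ (ℚ.0≤∣p∣ (p - q)) (≤-+ʳ (0≤term m)))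
      where
      step : ∀ m → ℚ.∣ expSum p (suc m) - expSum q (suc m) ∣ ≤ ℚ.∣ p - q ∣ * expSum B m
      step zero = ℚ.≤-reflexive (sym (ℚ.*-zeroʳ ℚ.∣ p - q ∣))
      step (suc m) = subst₂ (λ u v → ℚ.∣ u ∣ ≤ v)
        (solve 4 (λ a b s t → (a :- b) :+ (s :- t) := (a :+ s) :- (b :+ t)) refl
          (expSum p (suc m)) (expSum q (suc m)) (term p (suc m)) (term q (suc m)))
        (sym (ℚ.*-distribˡ-+ ℚ.∣ p - q ∣ (expSum B m) (term B m)))
        (∣+∣-≤ (step m) (term-diff hp hq m))

    tail : ∀ {q} → ℚ.∣ q ∣ ≤ B → ∀ m i →
      ℚ.∣ expSum q (i ℕ.+ m) - expSum q m ∣ ≤ expSum B (i ℕ.+ m) - expSum B m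
    tail {q} h m zero = ℚ.≤-reflexive (trans
      (cong ℚ.∣_∣ (ℚ.+-inverseʳ (expSum q m))) (sym (ℚ.+-inverseʳ (expSum B m))))
    tail {q} h m (suc i) = subst₂ (λ u v → ℚ.∣ u ∣ ≤ v)
      (shuffle (expSum q (i ℕ.+ m)) (expSum q m) (term q (i ℕ.+ m)))
      (shuffle (expSum B (i ℕ.+ m)) (expSum B m) (term B (i ℕ.+ m)))
      (∣+∣-≤ (tail h m i) (∣*∣-≤ (∣^∣ h (i ℕ.+ m)) (∣inv!∣ (i ℕ.+ m))))
      where
      shuffle : ∀ a b t → (a - b) + t ≡ (a + t) - b
      shuffle = solve 3 (λ a b t → (a :- b) :+ t := (a :+ t) :- b) refl

    -- From M on, consecutive terms of Σ Bʲ/j! at least halve.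
    M : ℕ
    M = proj₁ (archimedean (fromℕ 2 * B))

    halve : ∀ m → M ℕ.≤ m → fromℕ 2 * term B (suc m) ≤ term B m
    halve m hm = subst₂ _≤_
      (trans (solve 4 (λ b x f i → ((con (fromℕ 2) :* b) :* f) :* (x :* i)
                 := con (fromℕ 2) :* ((b :* x) :* (f :* i))) refl
               B (B ^ℚ m) (+ 1 ℚ./ suc m) (inv! m))
        (cong (λ z → fromℕ 2 * ((B ^ℚ suc m) * z)) (sym (inv!-suc m))))
      (ℚ.*-identityˡ (term B m))
      (*-monoʳ (0≤term m) (subst (fromℕ 2 * B * (+ 1 ℚ./ suc m) ≤_) (fromℕ-* m)
        (*-monoʳ (/-≤ 0 1 1 (suc m) z≤n)
          (ℚ.≤-trans (proj₂ (archimedean (fromℕ 2 * B)))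
            (fromℕ-mono {M} {suc m} (ℕ.m≤n⇒m≤1+n hm))))))

    U : ℕ → ℚ
    U m = expSum B m + fromℕ 2 * term B m

    U-anti : ∀ m i → M ℕ.≤ m → U (i ℕ.+ m) ≤ U m
    U-anti m zero    hm = ℚ.≤-refl
    U-anti m (suc i) hm = ℚ.≤-trans
      (subst (U (suc i ℕ.+ m) ≤_)
        (solve 2 (λ e t → (e :+ t) :+ t := e :+ con (fromℕ 2) :* t) refl
          (expSum B (i ℕ.+ m)) (term B (i ℕ.+ m)))
        (ℚ.+-monoʳ-≤ (expSum B (suc i ℕ.+ m)) (halve (i ℕ.+ m) (ℕ.≤-trans hm (ℕ.m≤n+m m i)))))
      (U-anti m i hm)

    expSum≤U : ∀ m i → M ℕ.≤ m → expSum B (i ℕ.+ m) ≤ U m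
    expSum≤U m i hm = ℚ.≤-trans
      (≤-+ʳ (*-nonNeg (0≤fromℕ 2) (0≤term (i ℕ.+ m)))) (U-anti m i hm)

    decay : ∀ i → term B (i ℕ.+ M) * fromℕ (suc i) ≤ term B M
    decay zero = ℚ.≤-reflexive (ℚ.*-identityʳ (term B M))
    decay (suc i) = ℚ.≤-trans
      (ℚ.≤-trans
        (*-monoˡ (0≤term (suc i ℕ.+ M)) grow)
        (subst (_≤ term B (i ℕ.+ M) * fromℕ (suc i))
          (solve 3 (λ c t f → (c :* t) :* f := t :* (c :* f)) refl
            (fromℕ 2) (term B (suc i ℕ.+ M)) (fromℕ (suc i)))
          (*-monoʳ (0≤fromℕ (suc i)) (halve (i ℕ.+ M) (ℕ.m≤n+m M i)))))
      (decay i)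
      where
      grow : fromℕ (suc (suc i)) ≤ fromℕ 2 * fromℕ (suc i)
      grow = subst₂ _≤_ (sym (fromℕ-suc (suc i)))
        (solve 1 (λ f → f :+ f := con (fromℕ 2) :* f) refl (fromℕ (suc i)))
        (ℚ.+-monoˡ-≤ (fromℕ (suc i)) (fromℕ-mono {1} {suc i} (s≤s z≤n)))

    tail-small : ∀ δ → 0ℚ < δ → ∃ λ N → M ℕ.≤ N ×
      (∀ m → N ℕ.≤ m → fromℕ 2 * term B m ≤ δ)
    tail-small δ 0<δ = I ℕ.+ M , ℕ.m≤n+m M I , λ m hm →
      let i  = m ℕ.∸ M
          I≤i = subst (ℕ._≤ i) (ℕ.m+n∸n≡m I M) (ℕ.∸-monoˡ-≤ M hm)
          eq = ℕ.m∸n+n≡m (ℕ.≤-trans (ℕ.m≤n+m M I) hm)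
      in subst (λ z → fromℕ 2 * term B z ≤ δ) eq
        (ℚ.*-cancelʳ-≤-pos (fromℕ (suc i)) {{ℚ.positive (0<fromℕ-suc i)}}
          (ℚ.≤-trans
            (subst (_≤ T) (sym (ℚ.*-assoc (fromℕ 2) (term B (i ℕ.+ M)) (fromℕ (suc i))))
              (*-monoˡ (0≤fromℕ 2) (decay i)))
            (ℚ.≤-trans T≤δI (*-monoˡ (ℚ.<⇒≤ 0<δ) (fromℕ-mono {I} {suc i} (ℕ.m≤n⇒m≤1+n I≤i))))))
      where
      T = fromℕ 2 * term B M
      I = proj₁ (archimedean (recip δ * T))
      T≤δI : T ≤ δ * fromℕ I
      T≤δI = subst (_≤ δ * fromℕ I)
        (trans (sym (ℚ.*-assoc δ (recip δ) T))
          (trans (cong (_* T) (*-recip 0<δ)) (ℚ.*-identityˡ T)))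
        (*-monoˡ (ℚ.<⇒≤ 0<δ) (proj₂ (archimedean (recip δ * T))))

open ExpLemmas

-- Σ xʲ/j!, with the diagonal approximants Σ_{j<i} xᵢ^j / j!.
exp : ℝ → ℝ
exp x = mkℝ e (mkCauchy e (V ℚ.+ 1ℚ) (+-nonNeg 0≤V (ℚ.<⇒≤ 0<1)) bound)
  where
  open import Data.Rational.Base using (_+_; _-_; _*_; -_; _≤_; _<_)
  open +-*-Solver using (solve; _:+_; _:*_; _:-_; :-_; _:=_; con)
  a = approx x
  e : ℕ → ℚ
  e i = expSum (a i) i
  bx = eventuallyBounded x
  B = proj₁ bx
  0≤B = proj₁ (proj₂ bx)
  Nx = proj₁ (proj₂ (proj₂ bx))
  ∣a∣≤B = proj₂ (proj₂ (proj₂ bx))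
  V = U 0≤B (M 0≤B)
  0≤V : 0ℚ ≤ V
  0≤V = ℚ.≤-trans (0≤expSum 0≤B (M 0≤B)) (expSum≤U 0≤B (M 0≤B) 0 ℕ.≤-refl)
  expSum≤V : ∀ i → M 0≤B ℕ.≤ i → expSum B i ≤ V
  expSum≤V i hi = subst (λ z → expSum B z ≤ V) (ℕ.m∸n+n≡m hi)
    (expSum≤U 0≤B (M 0≤B) (i ℕ.∸ M 0≤B) ℕ.≤-refl)
  bound : ∀ δ → 0ℚ < δ → ∃ λ N → ∀ i j → N ℕ.≤ i → i ℕ.≤ j → ℚ.∣ e i - e j ∣ ≤ (V + 1ℚ) * δ
  bound δ 0<δ = N , close
    where
    c = cauchy x δ 0<δ
    t = tail-small 0≤B δ 0<δ
    N = Nx ℕ.⊔ (proj₁ c ℕ.⊔ proj₁ t)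
    close : ∀ i j → N ℕ.≤ i → i ℕ.≤ j → ℚ.∣ e i - e j ∣ ≤ (V + 1ℚ) * δ
    close i j hi i≤j = subst₂ (λ u v → ℚ.∣ u ∣ ≤ v)
      (solve 3 (λ p q r → (p :- q) :+ (q :- r) := p :- r) refl
        (e i) (expSum (a j) i) (e j))
      (solve 2 (λ d v → d :* v :+ d := (v :+ con 1ℚ) :* d) refl δ V)
      (∣+∣-≤ lipschitz truncation)
      where
      hx  = ℕ.≤-trans (ℕ.m≤m⊔n Nx _) hi
      hct = ℕ.≤-trans (ℕ.m≤n⊔m Nx (proj₁ c ℕ.⊔ proj₁ t)) hi
      hc  = ℕ.≤-trans (ℕ.m≤m⊔n (proj₁ c) (proj₁ t)) hct
      ht  = ℕ.≤-trans (ℕ.m≤n⊔m (proj₁ c) (proj₁ t)) hct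
      hM  = ℕ.≤-trans (proj₁ (proj₂ t)) ht
      ∣ai∣ = ∣a∣≤B i hx
      ∣aj∣ = ∣a∣≤B j (ℕ.≤-trans hx i≤j)
      lipschitz : ℚ.∣ e i - expSum (a j) i ∣ ≤ δ * V
      lipschitz = ℚ.≤-trans (expSum-diff 0≤B ∣ai∣ ∣aj∣ i)
        (*-mono (ℚ.0≤∣p∣ (a i - a j)) 0≤V
          (ℚ.<⇒≤ (proj₂ c i j hc (ℕ.≤-trans hc i≤j))) (expSum≤V i hM))
      l = j ℕ.∸ i
      tail≤ : expSum B (l ℕ.+ i) - expSum B i ≤ fromℕ 2 * term B i
      tail≤ = subst (expSum B (l ℕ.+ i) - expSum B i ≤_)
        (solve 2 (λ p q → (p :+ q) :- p := q) refl (expSum B i) (fromℕ 2 * term B i))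
        (ℚ.+-monoˡ-≤ (- expSum B i) (expSum≤U 0≤B i l hM))
      truncation : ℚ.∣ expSum (a j) i - e j ∣ ≤ δ
      truncation = subst (_≤ δ) (∣-∣-swap (e j) (expSum (a j) i))
        (ℚ.≤-trans
          (subst (λ z → ℚ.∣ expSum (a j) z - expSum (a j) i ∣ ≤ expSum B (l ℕ.+ i) - expSum B i)
            (ℕ.m∸n+n≡m i≤j) (tail 0≤B ∣aj∣ i l))
          (ℚ.≤-trans tail≤ (proj₂ (proj₂ t) i ht)))

Tendsto : ((n : ℕ) .{{_ : ℕ.NonZero n}} → ℝ) → ℝ → Set
Tendsto a ℓ = ∀ ε → 0ℝ <ℝ ε → ∃ λ N → ∀ n .{{_ : ℕ.NonZero n}} → N ℕ.≤ n →
  ∣ a n -ℝ ℓ ∣ℝ <ℝ ε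

-- f ∼ g, i.e. f(n)/g(n) → 1, for g positive.
Asymptotic : (f g : (n : ℕ) .{{_ : ℕ.NonZero n}} → ℝ) →
  ((n : ℕ) .{{_ : ℕ.NonZero n}} → 0ℝ <ℝ g n) → Set
Asymptotic f g g>0 = Tendsto (λ n → f n *ℝ inv (g n) (g>0 n)) 1ℝ

-- i − j is congruent modulo n to some e in {−k, …, −1, 1, …, k}.
CyclePower : (n k : ℕ) → Rel (Fin n) 0ℓ
CyclePower n k i j = i ≢ j × ∃ λ e → 1 ℕ.≤ ℤ.∣ e ∣ × ℤ.∣ e ∣ ℕ.≤ k ×
  + n ℤ.∣ (+ toℕ i ℤ.- + toℕ j ℤ.- e)

LColourable : Rel (Fin n) 0ℓ → (Fin n → Subset s) → Set
LColourable {n} {s} E L = ∃ λ (f : Fin n → Fin s) →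
  (∀ x → f x ∈ L x) × (∀ x y → E x y → f x ≢ f y)

cyclePower? : ∀ n k → Decidable (CyclePower n k)
cyclePower? n k i j = ¬? (i Fin.≟ j) ×-dec map′ to from (ℕ.anyUpTo? P? (suc k))
  where
  d = + toℕ i ℤ.- + toℕ j
  P : Pred ℕ 0ℓ
  P m = 1 ℕ.≤ m × (+ n ℤ.∣ (d ℤ.- + m) ⊎ + n ℤ.∣ (d ℤ.- ℤ.- + m))
  P? : Decidable₁ P
  P? m = (1 ℕ.≤? m) ×-dec ((n ℕ.∣? ℤ.∣ d ℤ.- + m ∣) ⊎-dec (n ℕ.∣? ℤ.∣ d ℤ.- ℤ.- + m ∣))
  Q : Set
  Q = ∃ λ e → 1 ℕ.≤ ℤ.∣ e ∣ × ℤ.∣ e ∣ ℕ.≤ k × + n ℤ.∣ (d ℤ.- e)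
  to : (∃ λ m → m ℕ.< suc k × P m) → Q
  to (m , s≤s m≤k , 1≤m , inj₁ h) = + m , 1≤m , m≤k , h
  to (m , s≤s m≤k , 1≤m , inj₂ h) = ℤ.- + m ,
    subst (1 ℕ.≤_) (sym (ℤ.∣-i∣≡∣i∣ (+ m))) 1≤m ,
    subst (ℕ._≤ k) (sym (ℤ.∣-i∣≡∣i∣ (+ m))) m≤k , h
  from : Q → ∃ λ m → m ℕ.< suc k × P m
  from (+ m , 1≤m , m≤k , h)      = m , s≤s m≤k , 1≤m , inj₁ h
  from (-[1+ m ] , 1≤m , m≤k , h) = suc m , s≤s m≤k , 1≤m , inj₂ h

lColourable? : {E : Rel (Fin n) 0ℓ} → Decidable E → (L : Fin n → Subset s) → Dec (LColourable E L)
lColourable? {n} {s} {E} E? L = map′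
  (λ (i , h) → Fin.finToFun i , h)
  (λ (f , f∈L , f≢) → Fin.funToFin f ,
    (λ x → subst (_∈ L x) (sym (Fin.finToFun-funToFin f x)) (f∈L x)) ,
    (λ x y e h → f≢ x y e
      (trans (sym (Fin.finToFun-funToFin f x)) (trans h (Fin.finToFun-funToFin f y)))))
  (Fin.any? λ i → let f = Fin.finToFun {s} {n} i in
    Fin.all? (λ x → f x ∈? L x) ×-dec
    Fin.all? (λ x → Fin.all? (λ y → E? x y →-dec ¬? (f x Fin.≟ f y))))

-- Probability of P under the uniform distribution on the entries of a
-- duplicate-free list Ω of outcomes (junk value 0 if Ω is empty).
ℙ : {P : Pred A 0ℓ} → List A → Decidable₁ P → ℚ
ℙ Ω P? = ratio (length (filter P? Ω)) (length Ω)
  where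
  ratio : ℕ → ℕ → ℚ
  ratio a zero    = 0ℚ
  ratio a (suc b) = + a ℚ./ suc b

vectors : List A → (n : ℕ) → List (Vec A n)
vectors xs zero    = [] ∷ []
vectors xs (suc n) = cartesianProductWith _∷_ xs (vectors xs n)

subsetsOfSize : (c s : ℕ) → List (Subset s)
subsetsOfSize c s = filter (λ A → ∣ A ∣ ℕ.≟ c) (vectors (inside ∷ outside ∷ []) s)

-- Independent uniform choices of the lists amount to a uniform choice
-- from the n-fold product of the set of c-element subsets.
p : (n c k s : ℕ) → ℚ
p n c k s = ℙ (vectors (subsetsOfSize c s) n)
  (λ L → lColourable? (cyclePower? n k) (lookup L))

module Submission where

-- Call c∣W∣ - ∣⋃ L(W)∣ the deficiency of a set W of vertices. A set W of bounded
-- size has deficiency greater than c² with probability O(s^-(c²+1)) = o(1/n), so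
-- with high probability no ball of fixed radius has such a deficiency. Then the
-- graph can fail to be L-colourable only through a (c+1)-clique with c + 1
-- identical lists: each link by a common colour raises the deficiency, so a
-- minimal uncolourable set stays inside a ball, and a violator W of Hall's
-- condition ∣⋃ L(W)∣ ≥ ∣W∣ in it must carry c + 1 equal lists (the case c = 1
-- is immediate).
-- The cliques not running across a fixed cut of the cycle are about n (k choose c)
-- in number; each has identical lists with probability q = (s choose c)^-c, and the
-- events attached to disjoint cliques are independent while two cliques that meet
-- are both bad with probability at most q / (s choose c). Adding the cliques one
-- at a time therefore gives P(no bad clique) = (1 - q)^r + o(1) with
-- r q → (k choose c) t^-c² (c!)^c.

open import Defs
open import Data.Bool.Base using (if_then_else_)
import Data.Bool.Properties as Bool
open import Data.Fin.Base using (Fin; fromℕ<; opposite; suc; toℕ; zero)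
import Data.Fin.Properties as Fin
import Data.Integer.DivMod as ℤ
import Data.Integer.Divisibility as ℤ
import Data.Integer.Divisibility.Signed as Signed
import Data.Integer.Properties as ℤ
open import Data.List.Base using (List; []; _++_; _∷_; allFin; cartesianProductWith; filter; length; map; upTo)
import Data.List.Membership.Propositional as List
import Data.List.Membership.Propositional.Properties as List
import Data.List.Properties as List
open import Data.List.Relation.Unary.All as All using (All; []; _∷_)
import Data.List.Relation.Unary.All.Properties as All
open import Data.List.Relation.Unary.AllPairs using ([]; _∷_)
open import Data.List.Relation.Unary.Any as Any using (Any; here; there)
open import Data.List.Relation.Unary.Unique.Propositional using (Unique)
import Data.List.Relation.Unary.Unique.Propositional.Properties as Unique
import Data.Nat.Base as ℕ
import Data.Nat.Divisibility as ℕ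
import Data.Nat.Properties as ℕ
import Data.Nat.Solver as ℕSolver
open import Data.Product.Base using (_,_; _×_; proj₁; proj₂; ∃; ∃₂)
import Data.Rational.Base as ℚ
import Data.Rational.Properties as ℚ
open import Data.Sum.Base using ([_,_]′; _⊎_; inj₁; inj₂)
open import Data.Vec.Base as Vec using (Vec; []; _∷_; here; lookup; there)
import Data.Vec.Properties as Vec
import Data.Vec.Relation.Unary.All as VecAll
import Data.Vec.Relation.Unary.All.Properties as VecAll
open import Function.Base using (_∘_; id)
open import Level using (0ℓ)
open import Relation.Binary.Core using (Rel)
open import Relation.Binary.Definitions using (Decidable; DecidableEquality; Symmetric)
open import Relation.Nullary using (Dec; no; yes; ¬_)
open import Relation.Nullary.Decidable using (_×-dec_; _→-dec_; decidable-stable; does; ¬?)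
open import Relation.Unary using (Pred) renaming (Decidable to Decidable₁)
import Algebra.Definitions.RawSemiring as RawSemiringDefs
open import Relation.Binary.PropositionalEquality

open ℚLemmas
open RawSemiringDefs ℚ.+-*-rawSemiring using () renaming (_^_ to _^ℚ_)

-- The threshold c² is forced from both sides. A (c+1)-clique with one common list has deficiency
-- c(c+1) - c = c², and n has the order of s^(c²): deficiency c² is met a bounded expected number of
-- times, and one unit more costs a further factor 1/s. On the deterministic side, a Hall violator W
-- of deficiency at most c² satisfies (c - 1)∣W∣ ≤ c² - 1, so ∣W∣ ≤ c + 1; dividing by c - 1 is what
-- sets c = 1 apart. The cut spares a count of cyclic cliques: a bad clique across it contains one
-- of at most k² pairs with equal lists, and each of these has probability at most 1/(s choose c),
-- which tends to 0. Each clique added multiplies the survival probability by 1 - q up to O(q / (s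
-- choose c)); the r errors add up to O(r q / (s choose c)), which vanishes because r q stays
-- bounded. No logarithm is used: the binomial expansion of (1 - q)^r is compared with the
-- exponential series term by term. Reals are Cauchy sequences, so limits concern families of
-- rationals indexed by n and by the approximant i, where "i large" may depend on n.

module FiniteSets where

  -- Cardinalities of finite sets and Hall's theorem.

  open import Data.Nat.Base using (ℕ; zero; suc; _+_; _*_; _≤_; _<_; z≤n; s≤s; s≤s⁻¹)
  open import Data.Nat.Properties hiding (_≟_; _≤?_; _<?_)
  open import Data.Nat.Properties using (_<?_; _≤?_)
  open import Data.Fin.Properties using (_≟_; any?)
  open import Data.Fin.Subset
  open import Data.Fin.Subset.Properties
  open import Data.Empty using (⊥-elim) renaming (⊥ to ∅)

  private
    variable
      n s : ℕ

  ∣∪∣+∣∩∣ : (p q : Subset n) → ∣ p ∪ q ∣ + ∣ p ∩ q ∣ ≡ ∣ p ∣ + ∣ q ∣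
  ∣∪∣+∣∩∣ [] [] = refl
  ∣∪∣+∣∩∣ (outside ∷ p) (outside ∷ q) = ∣∪∣+∣∩∣ p q
  ∣∪∣+∣∩∣ (inside ∷ p) (outside ∷ q) = cong suc (∣∪∣+∣∩∣ p q)
  ∣∪∣+∣∩∣ (outside ∷ p) (inside ∷ q) = trans (cong suc (∣∪∣+∣∩∣ p q)) (sym (+-suc ∣ p ∣ ∣ q ∣))
  ∣∪∣+∣∩∣ (inside ∷ p) (inside ∷ q) = cong suc (trans (+-suc ∣ p ∪ q ∣ ∣ p ∩ q ∣)
    (trans (cong suc (∣∪∣+∣∩∣ p q)) (sym (+-suc ∣ p ∣ ∣ q ∣))))

  ∣∪∣≤ : (p q : Subset n) → ∣ p ∪ q ∣ ≤ ∣ p ∣ + ∣ q ∣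
  ∣∪∣≤ p q = subst (∣ p ∪ q ∣ ≤_) (∣∪∣+∣∩∣ p q) (m≤m+n _ _)

  ∣∪∣-disjoint : (p q : Subset n) → (∀ {x} → x ∈ p → x ∉ q) → ∣ p ∪ q ∣ ≡ ∣ p ∣ + ∣ q ∣
  ∣∪∣-disjoint {n} p q p#q = trans (sym (+-identityʳ _))
    (trans (cong (∣ p ∪ q ∣ +_) (sym (trans (cong ∣_∣ (Empty-unique empty)) (∣⊥∣≡0 n)))) (∣∪∣+∣∩∣ p q))
    where
    empty : Empty (p ∩ q)
    empty (x , x∈) = let x∈p , x∈q = x∈p∩q⁻ p q x∈ in p#q x∈p x∈q

  ∣∪⁅⁆∣ : (p : Subset n) (x : Fin n) → x ∉ p → ∣ p ∪ ⁅ x ⁆ ∣ ≡ suc ∣ p ∣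
  ∣∪⁅⁆∣ p x x∉p = trans
    (∣∪∣-disjoint p ⁅ x ⁆ λ y∈p y∈x → x∉p (subst (_∈ p) (x∈⁅y⁆⇒x≡y x y∈x) y∈p))
    (trans (cong (∣ p ∣ +_) (∣⁅x⁆∣≡1 x)) (+-comm ∣ p ∣ 1))

  ∣p∣≤1+∣p-x∣ : (p : Subset n) (x : Fin n) → ∣ p ∣ ≤ suc ∣ p - x ∣
  ∣p∣≤1+∣p-x∣ p x = ≤-trans (p⊆q⇒∣p∣≤∣q∣ sub) (≤-trans (∣∪∣≤ (p - x) ⁅ x ⁆)
    (≤-reflexive (trans (cong (∣ p - x ∣ +_) (∣⁅x⁆∣≡1 x)) (+-comm ∣ p - x ∣ 1))))
    where
    sub : p ⊆ (p - x) ∪ ⁅ x ⁆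
    sub {y} y∈p with y ≟ x
    ... | yes refl = x∈p∪q⁺ (inj₂ (x∈⁅x⁆ x))
    ... | no y≢x  = x∈p∪q⁺ (inj₁ (x∈p∧x≢y⇒x∈p-y y∈p y≢x))

  x∉p-x : (p : Subset n) (x : Fin n) → x ∉ p - x
  x∉p-x (_ ∷ p) zero ()
  x∉p-x (_ ∷ p) (suc x) (there h) = x∉p-x p x h

  ∣p∣≡∣q∣+∣p─q∣ : (p q : Subset n) → q ⊆ p → ∣ p ∣ ≡ ∣ q ∣ + ∣ p ─ q ∣
  ∣p∣≡∣q∣+∣p─q∣ [] [] q⊆p = refl
  ∣p∣≡∣q∣+∣p─q∣ (inside ∷ p) (inside ∷ q) q⊆p = cong suc (∣p∣≡∣q∣+∣p─q∣ p q (drop-∷-⊆ q⊆p))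
  ∣p∣≡∣q∣+∣p─q∣ (outside ∷ p) (inside ∷ q) q⊆p with () ← q⊆p here
  ∣p∣≡∣q∣+∣p─q∣ (inside ∷ p) (outside ∷ q) q⊆p =
    trans (cong suc (∣p∣≡∣q∣+∣p─q∣ p q (drop-∷-⊆ q⊆p))) (sym (+-suc ∣ q ∣ _))
  ∣p∣≡∣q∣+∣p─q∣ (outside ∷ p) (outside ∷ q) q⊆p = ∣p∣≡∣q∣+∣p─q∣ p q (drop-∷-⊆ q⊆p)

  ⊆∧∣∣≥⇒≡ : {p q : Subset n} → p ⊆ q → ∣ q ∣ ≤ ∣ p ∣ → p ≡ q
  ⊆∧∣∣≥⇒≡ {p = []} {[]} p⊆q h = refl
  ⊆∧∣∣≥⇒≡ {p = inside ∷ p} {inside ∷ q} p⊆q (s≤s h) = cong (inside ∷_) (⊆∧∣∣≥⇒≡ (drop-∷-⊆ p⊆q) h)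
  ⊆∧∣∣≥⇒≡ {p = inside ∷ p} {outside ∷ q} p⊆q h with () ← p⊆q here
  ⊆∧∣∣≥⇒≡ {p = outside ∷ p} {inside ∷ q} p⊆q h =
    ⊥-elim (<-irrefl refl (≤-trans h (p⊆q⇒∣p∣≤∣q∣ (drop-∷-⊆ p⊆q))))
  ⊆∧∣∣≥⇒≡ {p = outside ∷ p} {outside ∷ q} p⊆q h = cong (outside ∷_) (⊆∧∣∣≥⇒≡ (drop-∷-⊆ p⊆q) h)

  0<∣p∣⇒Nonempty : (p : Subset n) → 0 < ∣ p ∣ → Nonempty p
  0<∣p∣⇒Nonempty (inside ∷ p) h = zero , here
  0<∣p∣⇒Nonempty (outside ∷ p) h = let x , x∈ = 0<∣p∣⇒Nonempty p h in suc x , there x∈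

  Nonempty⇒0<∣p∣ : {p : Subset n} → Nonempty p → 0 < ∣ p ∣
  Nonempty⇒0<∣p∣ {p = p} (x , x∈p) = subst (_≤ ∣ p ∣) (∣⁅x⁆∣≡1 x)
    (p⊆q⇒∣p∣≤∣q∣ λ y∈ → subst (_∈ p) (sym (x∈⁅y⁆⇒x≡y x y∈)) x∈p)

  twoElements : (p : Subset n) → 2 ≤ ∣ p ∣ → ∃₂ λ a b → a ∈ p × b ∈ p × a ≢ b
  twoElements p h = a , b , a∈p , p─q⊆p p ⁅ a ⁆ b∈ , λ a≡b → x∉p-x p a (subst (_∈ p - a) (sym a≡b) b∈)
    where
    ne = 0<∣p∣⇒Nonempty p (≤-trans (s≤s z≤n) h)
    a = proj₁ ne
    a∈p = proj₂ ne
    ne′ = 0<∣p∣⇒Nonempty (p - a) (s≤s⁻¹ (≤-trans h (∣p∣≤1+∣p-x∣ p a)))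
    b = proj₁ ne′
    b∈ = proj₂ ne′

  ⋃[_] : Subset n → (Fin n → Subset s) → Subset s
  ⋃[ [] ] L = ⊥
  ⋃[ inside ∷ W ] L = L zero ∪ ⋃[ W ] (L ∘ suc)
  ⋃[ outside ∷ W ] L = ⋃[ W ] (L ∘ suc)

  module _ {s : ℕ} where

    ∈⋃⁺ : (W : Subset n) (L : Fin n → Subset s) → ∀ {x σ} → x ∈ W → σ ∈ L x → σ ∈ ⋃[ W ] L
    ∈⋃⁺ (inside ∷ W) L here h = x∈p∪q⁺ (inj₁ h)
    ∈⋃⁺ (inside ∷ W) L (there x∈) h = x∈p∪q⁺ (inj₂ (∈⋃⁺ W (L ∘ suc) x∈ h))
    ∈⋃⁺ (outside ∷ W) L (there x∈) h = ∈⋃⁺ W (L ∘ suc) x∈ h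

    ∈⋃⁻ : (W : Subset n) (L : Fin n → Subset s) → ∀ {σ} → σ ∈ ⋃[ W ] L → ∃ λ x → x ∈ W × σ ∈ L x
    ∈⋃⁻ [] L h = ⊥-elim (∉⊥ h)
    ∈⋃⁻ (inside ∷ W) L h with x∈p∪q⁻ (L zero) _ h
    ... | inj₁ h₁ = zero , here , h₁
    ... | inj₂ h₂ = let x , x∈ , hx = ∈⋃⁻ W (L ∘ suc) h₂ in suc x , there x∈ , hx
    ∈⋃⁻ (outside ∷ W) L h = let x , x∈ , hx = ∈⋃⁻ W (L ∘ suc) h in suc x , there x∈ , hx

    ∣⋃∣≤ : ∀ c (W : Subset n) (L : Fin n → Subset s) → (∀ x → ∣ L x ∣ ≤ c) → ∣ ⋃[ W ] L ∣ ≤ c * ∣ W ∣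
    ∣⋃∣≤ c [] L h = ≤-reflexive (trans (∣⊥∣≡0 s) (sym (*-zeroʳ c)))
    ∣⋃∣≤ c (inside ∷ W) L h = ≤-trans (∣∪∣≤ (L zero) _)
      (≤-trans (+-mono-≤ (h zero) (∣⋃∣≤ c W (L ∘ suc) (h ∘ suc))) (≤-reflexive (sym (*-suc c ∣ W ∣))))
    ∣⋃∣≤ c (outside ∷ W) L h = ∣⋃∣≤ c W (L ∘ suc) (h ∘ suc)

    replace : (Fin n → Subset s) → Fin n → Subset s → Fin n → Subset s
    replace L x A y with y ≟ x
    ... | yes _ = A
    ... | no _  = L y

    replace-≡ : ∀ (L : Fin n → Subset s) x A → replace L x A x ≡ A
    replace-≡ L x A with x ≟ x
    ... | yes _ = refl
    ... | no x≢x = ⊥-elim (x≢x refl)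

    replace-≢ : ∀ (L : Fin n → Subset s) {x y} A → y ≢ x → replace L x A y ≡ L y
    replace-≢ L {x} {y} A y≢x with y ≟ x
    ... | yes y≡x = ⊥-elim (y≢x y≡x)
    ... | no _ = refl

    -- The measure of the induction in `hall`: it drops whenever a colour is deleted from a list.
    totalSize : (Fin n → Subset s) → ℕ
    totalSize {zero} L = 0
    totalSize {suc n} L = ∣ L zero ∣ + totalSize (L ∘ suc)

    totalSize-mono : (L L′ : Fin n → Subset s) → (∀ x → ∣ L x ∣ ≤ ∣ L′ x ∣) → totalSize L ≤ totalSize L′
    totalSize-mono {zero} L L′ h = z≤n
    totalSize-mono {suc n} L L′ h = +-mono-≤ (h zero) (totalSize-mono (L ∘ suc) (L′ ∘ suc) (h ∘ suc))

    totalSize-strict : (L L′ : Fin n → Subset s) (x : Fin n) → (∀ y → ∣ L y ∣ ≤ ∣ L′ y ∣) → ∣ L x ∣ < ∣ L′ x ∣ →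
      totalSize L < totalSize L′
    totalSize-strict L L′ zero h hx = +-mono-<-≤ hx (totalSize-mono (L ∘ suc) (L′ ∘ suc) (h ∘ suc))
    totalSize-strict L L′ (suc x) h hx = +-mono-≤-< (h zero) (totalSize-strict (L ∘ suc) (L′ ∘ suc) x (h ∘ suc) hx)

    totalSize-replace : (L : Fin n → Subset s) (x : Fin n) (A : Subset s) → ∣ A ∣ < ∣ L x ∣ →
      totalSize (replace L x A) < totalSize L
    totalSize-replace L x A A<L = totalSize-strict (replace L x A) L x le
      (subst (λ B → ∣ B ∣ < ∣ L x ∣) (sym (replace-≡ L x A)) A<L)
      where
      le : ∀ y → ∣ replace L x A y ∣ ≤ ∣ L y ∣
      le y with y ≟ x
      ... | yes refl = <⇒≤ A<L
      ... | no _ = ≤-refl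

    -- Relative to `H`, while the lists live on all of `Fin n`: parts of a graph can then be
    -- coloured without changing the vertex type.
    HallCondition : Subset n → (Fin n → Subset s) → Set
    HallCondition H L = ∀ W → W ⊆ H → ∣ W ∣ ≤ ∣ ⋃[ W ] L ∣

    Violator : Subset n → (Fin n → Subset s) → Subset n → Set
    Violator H L W = W ⊆ H × ∣ ⋃[ W ] L ∣ < ∣ W ∣

    hallOrViolator : (H : Subset n) (L : Fin n → Subset s) → HallCondition H L ⊎ ∃ (Violator H L)
    hallOrViolator H L with anySubset? (λ W → (W ⊆? H) ×-dec (∣ ⋃[ W ] L ∣ <? ∣ W ∣))
    ... | yes (W , v) = inj₂ (W , v)
    ... | no none = inj₁ λ W W⊆H → ≮⇒≥ λ lt → none (W , W⊆H , lt)

    -- If deleting a spoils W₁ and deleting b spoils W₂, submodularity of the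
    -- size of the union contradicts Hall's condition for W₁ ∪ W₂ and W₁ ∩ W₂ - x.
    noTwoViolators : (H : Subset n) (L : Fin n → Subset s) → HallCondition H L →
      ∀ x {a b} → a ≢ b → ∀ {W₁ W₂} → Violator H (replace L x (L x - a)) W₁ →
      Violator H (replace L x (L x - b)) W₂ → ∅
    noTwoViolators H L hall x {a} {b} a≢b {W₁} {W₂} (W₁⊆H , v₁) (W₂⊆H , v₂) =
      <-irrefl refl (begin-strict
        suc (∣ P ∣ + ∣ Q ∣) <⟨ ≤-reflexive (cong suc (sym (+-suc ∣ P ∣ ∣ Q ∣))) ⟩
        suc ∣ P ∣ + suc ∣ Q ∣ ≤⟨ +-mono-≤ v₁ v₂ ⟩
        ∣ W₁ ∣ + ∣ W₂ ∣ ≡⟨ ∣∪∣+∣∩∣ W₁ W₂ ⟨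
        ∣ W₁ ∪ W₂ ∣ + ∣ W₁ ∩ W₂ ∣ ≤⟨ +-mono-≤ union inter ⟩
        ∣ P ∪ Q ∣ + suc ∣ P ∩ Q ∣ ≡⟨ +-suc _ _ ⟩
        suc (∣ P ∪ Q ∣ + ∣ P ∩ Q ∣) ≡⟨ cong suc (∣∪∣+∣∩∣ P Q) ⟩
        suc (∣ P ∣ + ∣ Q ∣) ∎)
      where
      open ≤-Reasoning
      P = ⋃[ W₁ ] (replace L x (L x - a))
      Q = ⋃[ W₂ ] (replace L x (L x - b))
      other : ∀ {d y σ} W → y ≢ x → y ∈ W → σ ∈ L y → σ ∈ ⋃[ W ] (replace L x (L x - d))
      other W y≢x y∈W σ∈ = ∈⋃⁺ W _ y∈W (subst (_ ∈_) (sym (replace-≢ L _ y≢x)) σ∈)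
      self : ∀ {d σ} W → σ ≢ d → x ∈ W → σ ∈ L x → σ ∈ ⋃[ W ] (replace L x (L x - d))
      self W σ≢d x∈W σ∈ = ∈⋃⁺ W _ x∈W (subst (_ ∈_) (sym (replace-≡ L x _)) (x∈p∧x≢y⇒x∈p-y σ∈ σ≢d))
      -- A violator avoiding `x` would have its union unaffected by the deletion, against Hall's
      -- condition for `L`.
      contains : ∀ d W → W ⊆ H → ∣ ⋃[ W ] (replace L x (L x - d)) ∣ < ∣ W ∣ → x ∈ W
      contains d W W⊆H v with x ∈? W
      ... | yes x∈W = x∈W
      ... | no x∉W = ⊥-elim (<-irrefl refl (<-≤-trans v (≤-trans (hall W W⊆H)
        (p⊆q⇒∣p∣≤∣q∣ λ σ∈ → let y , y∈W , σ∈y = ∈⋃⁻ W L σ∈ in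
          other {d} W (λ y≡x → x∉W (subst (_∈ W) y≡x y∈W)) y∈W σ∈y))))
      x∈W₁ = contains a W₁ W₁⊆H v₁
      x∈W₂ = contains b W₂ W₂⊆H v₂
      union : ∣ W₁ ∪ W₂ ∣ ≤ ∣ P ∪ Q ∣
      union = ≤-trans (hall (W₁ ∪ W₂) λ y∈ → [ W₁⊆H , W₂⊆H ]′ (x∈p∪q⁻ W₁ W₂ y∈)) (p⊆q⇒∣p∣≤∣q∣ sub)
        where
        sub : ⋃[ W₁ ∪ W₂ ] L ⊆ P ∪ Q
        sub {σ} σ∈ with ∈⋃⁻ (W₁ ∪ W₂) L σ∈
        ... | y , y∈ , σ∈y with y ≟ x | x∈p∪q⁻ W₁ W₂ y∈
        ...   | no y≢x | inj₁ y∈₁ = x∈p∪q⁺ (inj₁ (other W₁ y≢x y∈₁ σ∈y))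
        ...   | no y≢x | inj₂ y∈₂ = x∈p∪q⁺ (inj₂ (other W₂ y≢x y∈₂ σ∈y))
        -- The only colour of `x` that may be missing from `P` is `a`, and `Q` keeps it because
        -- `a ≢ b`.
        ...   | yes refl | _ with σ ≟ a
        ...     | no σ≢a = x∈p∪q⁺ (inj₁ (self W₁ σ≢a x∈W₁ σ∈y))
        ...     | yes refl = x∈p∪q⁺ (inj₂ (self W₂ a≢b x∈W₂ σ∈y))
      -- `P ∩ Q` may lack both `a` and `b`, so `x` is left out; the loss of one is affordable
      -- because the two violations together give two.
      W₀ = (W₁ ∩ W₂) - x
      inter : ∣ W₁ ∩ W₂ ∣ ≤ suc ∣ P ∩ Q ∣
      inter = ≤-trans (∣p∣≤1+∣p-x∣ (W₁ ∩ W₂) x) (s≤s (≤-trans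
        (hall W₀ λ y∈ → W₁⊆H (p∩q⊆p W₁ W₂ (p─q⊆p (W₁ ∩ W₂) ⁅ x ⁆ y∈))) (p⊆q⇒∣p∣≤∣q∣ sub)))
        where
        sub : ⋃[ W₀ ] L ⊆ P ∩ Q
        sub σ∈ with ∈⋃⁻ W₀ L σ∈
        ... | y , y∈ , σ∈y = x∈p∩q⁺ (other W₁ y≢x (proj₁ y∈∩) σ∈y , other W₂ y≢x (proj₂ y∈∩) σ∈y)
          where
          y∈∩ = x∈p∩q⁻ W₁ W₂ (p─q⊆p (W₁ ∩ W₂) ⁅ x ⁆ y∈)
          y≢x : y ≢ x
          y≢x refl = x∉p-x (W₁ ∩ W₂) x y∈

    InjectiveOn : Subset n → (Fin n → Fin s) → Set
    InjectiveOn H f = ∀ {x y} → x ∈ H → y ∈ H → f x ≡ f y → x ≡ y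

    -- Rado's proof: shrink the sets while Hall's condition persists.
    hall : (H : Subset n) (L : Fin n → Subset s) → (∀ x → Nonempty (L x)) → HallCondition H L →
      ∃ λ f → (∀ x → f x ∈ L x) × InjectiveOn H f
    hall {n} H L = go (totalSize L) L ≤-refl
      where
      go : ∀ m (L : Fin n → Subset s) → totalSize L ≤ m → (∀ x → Nonempty (L x)) → HallCondition H L →
        ∃ λ f → (∀ x → f x ∈ L x) × InjectiveOn H f
      shrink : ∀ m (L : Fin n → Subset s) → totalSize L ≤ suc m → (∀ x → Nonempty (L x)) →
        ∀ x d e → d ∈ L x → e ∈ L x → e ≢ d → HallCondition H (replace L x (L x - d)) →
        ∃ λ f → (∀ x → f x ∈ L x) × InjectiveOn H f
      shrink m L size ne x d e d∈ e∈ e≢d h =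
        let f , f∈ , inj = go m L′ (s≤s⁻¹ (<-≤-trans (totalSize-replace L x _ (x∈p⇒∣p-x∣<∣p∣ d∈)) size)) ne′ h
        in f , (λ y → L′⊆L y (f∈ y)) , inj
        where
        L′ = replace L x (L x - d)
        L′⊆L : ∀ y → L′ y ⊆ L y
        L′⊆L y σ∈ with y ≟ x
        ... | yes refl = p─q⊆p (L x) ⁅ d ⁆ σ∈
        ... | no _ = σ∈
        ne′ : ∀ y → Nonempty (L′ y)
        ne′ y with y ≟ x
        ... | yes refl = e , x∈p∧x≢y⇒x∈p-y e∈ e≢d
        ... | no _ = ne y
      go m L size ne hc with any? (λ x → (x ∈? H) ×-dec (2 ≤? ∣ L x ∣))
      -- All lists on `H` are now singletons, and Hall's condition for pairs says that they are
      -- distinct.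
      go m L size ne hc | no none = f , (proj₂ ∘ ne) , inj
        where
        f = proj₁ ∘ ne
        single : ∀ {x σ} → x ∈ H → σ ∈ L x → L x ⊆ ⁅ σ ⁆
        single {x} {σ} x∈H σ∈ τ∈ = subst (_ ∈_) (sym eq) τ∈
          where
          eq : ⁅ σ ⁆ ≡ L x
          eq = ⊆∧∣∣≥⇒≡ (λ ρ∈ → subst (_∈ L x) (sym (x∈⁅y⁆⇒x≡y σ ρ∈)) σ∈)
            (subst (∣ L x ∣ ≤_) (sym (∣⁅x⁆∣≡1 σ)) (≮⇒≥ λ lt → none (x , x∈H , lt)))
        inj : InjectiveOn H f
        inj {x} {y} x∈H y∈H fx≡fy with x ≟ y
        ... | yes x≡y = x≡y
        ... | no x≢y = ⊥-elim (<-irrefl refl (begin-strict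
            1 ≡⟨ ∣⁅x⁆∣≡1 x ⟨
            ∣ ⁅ x ⁆ ∣ <⟨ ≤-reflexive (sym (∣∪⁅⁆∣ ⁅ x ⁆ y (x≢y ∘ sym ∘ x∈⁅y⁆⇒x≡y x))) ⟩
            ∣ W ∣ ≤⟨ hc W W⊆H ⟩
            ∣ ⋃[ W ] L ∣ ≤⟨ p⊆q⇒∣p∣≤∣q∣ sub ⟩
            ∣ ⁅ f x ⁆ ∣ ≡⟨ ∣⁅x⁆∣≡1 (f x) ⟩
            1 ∎))
          where
          open ≤-Reasoning
          W = ⁅ x ⁆ ∪ ⁅ y ⁆
          elim : ∀ {z} → z ∈ W → z ≡ x ⊎ z ≡ y
          elim z∈ = [ inj₁ ∘ x∈⁅y⁆⇒x≡y x , inj₂ ∘ x∈⁅y⁆⇒x≡y y ]′ (x∈p∪q⁻ ⁅ x ⁆ ⁅ y ⁆ z∈)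
          W⊆H : W ⊆ H
          W⊆H z∈ = [ (λ { refl → x∈H }) , (λ { refl → y∈H }) ]′ (elim z∈)
          sub : ⋃[ W ] L ⊆ ⁅ f x ⁆
          sub σ∈ with ∈⋃⁻ W L σ∈
          ... | z , z∈ , σ∈z with elim z∈
          ...   | inj₁ refl = single x∈H (proj₂ (ne x)) σ∈z
          ...   | inj₂ refl = single y∈H (subst (_∈ L y) (sym fx≡fy) (proj₂ (ne y))) σ∈z
      go zero L size ne hc | yes (x , x∈H , two) =
        ⊥-elim (<-irrefl refl (<-≤-trans (totalSize-replace L x ⊥
          (subst (_< ∣ L x ∣) (sym (∣⊥∣≡0 s)) (≤-trans (s≤s z≤n) two))) (≤-trans size z≤n)))
      go (suc m) L size ne hc | yes (x , x∈H , two) with twoElements (L x) two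
      ... | a , b , a∈ , b∈ , a≢b with hallOrViolator H (replace L x (L x - a)) | hallOrViolator H (replace L x (L x - b))
      ...   | inj₁ h | _ = shrink m L size ne x a b a∈ b∈ (a≢b ∘ sym) h
      ...   | inj₂ _ | inj₁ h = shrink m L size ne x b a b∈ a∈ a≢b h
      ...   | inj₂ (_ , v₁) | inj₂ (_ , v₂) = ⊥-elim (noTwoViolators H L hc x a≢b v₁ v₂)

-- The deterministic part: locally sparse lists without a monochromatic clique admit a colouring.

module ListColouring where

  open FiniteSets
  open import Data.Nat.Base using (ℕ; zero; suc; _+_; _*_; _≤_; _<_; z≤n; s≤s; s≤s⁻¹)
  open import Data.Nat.Properties hiding (_≟_; _≤?_; _<?_)
  open import Data.Nat.Solver using (module +-*-Solver)
  open import Data.Fin.Properties using (_≟_; any?)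
  open import Data.Fin.Subset
  open import Data.Fin.Subset.Properties
  open import Data.Empty using (⊥-elim) renaming (⊥ to ∅)

  module _ {n s : ℕ} (c : ℕ) (0<c : 0 < c)
    (E : Rel (Fin n) 0ℓ) (E? : Decidable E) (E-sym : Symmetric E) (E-irrefl : ∀ {x y} → E x y → x ≢ y)
    (L : Fin n → Subset s) (∣L∣≡c : ∀ x → ∣ L x ∣ ≡ c)
    where

    open ≤-Reasoning

    L-nonempty : ∀ x → Nonempty (L x)
    L-nonempty x = 0<∣p∣⇒Nonempty (L x) (subst (0 <_) (sym (∣L∣≡c x)) 0<c)

    -- The deficiency c∣W∣ - ∣⋃[ W ] L∣ of W is at most c².
    Sparse : Subset n → Set
    Sparse W = c * ∣ W ∣ ≤ ∣ ⋃[ W ] L ∣ + c * c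

    -- Deficiency is monotone: each vertex added to `R` brings at most `c` new colours.
    Sparse-⊆ : ∀ {R W} → R ⊆ W → Sparse W → Sparse R
    Sparse-⊆ {R} {W} R⊆W sp = +-cancelʳ-≤ (c * ∣ W ─ R ∣) _ _ (begin
      c * ∣ R ∣ + c * ∣ W ─ R ∣ ≡⟨ *-distribˡ-+ c ∣ R ∣ ∣ W ─ R ∣ ⟨
      c * (∣ R ∣ + ∣ W ─ R ∣) ≡⟨ cong (c *_) (∣p∣≡∣q∣+∣p─q∣ W R R⊆W) ⟨
      c * ∣ W ∣ ≤⟨ sp ⟩
      ∣ ⋃[ W ] L ∣ + c * c ≤⟨ +-monoˡ-≤ (c * c) (p⊆q⇒∣p∣≤∣q∣ sub) ⟩
      ∣ ⋃[ R ] L ∪ ⋃[ W ─ R ] L ∣ + c * c ≤⟨ +-monoˡ-≤ (c * c) (∣∪∣≤ (⋃[ R ] L) _) ⟩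
      ∣ ⋃[ R ] L ∣ + ∣ ⋃[ W ─ R ] L ∣ + c * c ≤⟨ +-monoˡ-≤ (c * c) (+-monoʳ-≤ ∣ ⋃[ R ] L ∣
          (∣⋃∣≤ c (W ─ R) L (≤-reflexive ∘ ∣L∣≡c))) ⟩
      ∣ ⋃[ R ] L ∣ + c * ∣ W ─ R ∣ + c * c ≡⟨ solve 3 (λ a b d → a :+ b :+ d := a :+ d :+ b) refl
          ∣ ⋃[ R ] L ∣ (c * ∣ W ─ R ∣) (c * c) ⟩
      ∣ ⋃[ R ] L ∣ + c * c + c * ∣ W ─ R ∣ ∎)
      where
      open +-*-Solver
      sub : ⋃[ W ] L ⊆ ⋃[ R ] L ∪ ⋃[ W ─ R ] L
      sub σ∈ with ∈⋃⁻ W L σ∈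
      ... | y , y∈W , σ∈y with y ∈? R
      ...   | yes y∈R = x∈p∪q⁺ (inj₁ (∈⋃⁺ R L y∈R σ∈y))
      ...   | no y∉R = x∈p∪q⁺ (inj₂ (∈⋃⁺ (W ─ R) L (x∈p∧x∉q⇒x∈p─q y∈W y∉R) σ∈y))

    -- Only an edge whose ends share a colour can cause a conflict, so these are the edges that
    -- matter between `R` and the rest of `H`.
    Link : Subset n → Subset n → Set
    Link H R = ∃ λ x → (x ∈ H × x ∉ R) × ∃ λ y → y ∈ R × E x y × Nonempty (L x ∩ L y)

    link? : ∀ H R → Dec (Link H R)
    link? H R = any? λ x → ((x ∈? H) ×-dec ¬? (x ∈? R)) ×-dec
      any? λ y → (y ∈? R) ×-dec E? x y ×-dec nonempty? (L x ∩ L y)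

    -- The shared colour is already present, so `x` brings at most `c - 1` new ones: a link raises
    -- the deficiency by at least one.
    link-union : ∀ R {x y} → y ∈ R → Nonempty (L x ∩ L y) → suc ∣ ⋃[ R ∪ ⁅ x ⁆ ] L ∣ ≤ ∣ ⋃[ R ] L ∣ + c
    link-union R {x} {y} y∈R (σ , σ∈) = begin
      suc ∣ ⋃[ R ∪ ⁅ x ⁆ ] L ∣ ≤⟨ s≤s (p⊆q⇒∣p∣≤∣q∣ sub) ⟩
      suc ∣ ⋃[ R ] L ∪ L x ∣ ≡⟨ +-comm 1 _ ⟩
      ∣ ⋃[ R ] L ∪ L x ∣ + 1 ≤⟨ +-monoʳ-≤ _ (Nonempty⇒0<∣p∣ (σ , σ∈∩)) ⟩
      ∣ ⋃[ R ] L ∪ L x ∣ + ∣ ⋃[ R ] L ∩ L x ∣ ≡⟨ ∣∪∣+∣∩∣ (⋃[ R ] L) (L x) ⟩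
      ∣ ⋃[ R ] L ∣ + ∣ L x ∣ ≡⟨ cong (∣ ⋃[ R ] L ∣ +_) (∣L∣≡c x) ⟩
      ∣ ⋃[ R ] L ∣ + c ∎
      where
      σ∈∩ : σ ∈ ⋃[ R ] L ∩ L x
      σ∈∩ = let σ∈x , σ∈y = x∈p∩q⁻ (L x) (L y) σ∈ in x∈p∩q⁺ (∈⋃⁺ R L y∈R σ∈y , σ∈x)
      sub : ⋃[ R ∪ ⁅ x ⁆ ] L ⊆ ⋃[ R ] L ∪ L x
      sub τ∈ with ∈⋃⁻ (R ∪ ⁅ x ⁆) L τ∈
      ... | z , z∈ , τ∈z with x∈p∪q⁻ R ⁅ x ⁆ z∈
      ...   | inj₁ z∈R = x∈p∪q⁺ (inj₁ (∈⋃⁺ R L z∈R τ∈z))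
      ...   | inj₂ z∈x = x∈p∪q⁺ (inj₂ (subst (λ w → _ ∈ L w) (x∈⁅y⁆⇒x≡y x z∈x) τ∈z))

    Clique : Subset n → Set
    Clique K = ∀ {x y} → x ∈ K → y ∈ K → x ≢ y → E x y

    NoMonoClique : Set
    NoMonoClique = ∀ K → ∣ K ∣ ≡ suc c → Clique K → ∀ A → (∀ {x} → x ∈ K → L x ≡ A) → ∅

    Colouring : Subset n → (Fin n → Fin s) → Set
    Colouring H f = (∀ x → f x ∈ L x) × (∀ {x y} → x ∈ H → y ∈ H → E x y → f x ≢ f y)

    ColourableOn : Subset n → Set
    ColourableOn H = ∃ (Colouring H)

    ⋃∣≥∣ : ∀ W → Nonempty W → c ≤ ∣ ⋃[ W ] L ∣
    ⋃∣≥∣ W (x , x∈W) = subst (_≤ _) (∣L∣≡c x) (p⊆q⇒∣p∣≤∣q∣ (∈⋃⁺ W L x∈W))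

    identicalLists : ∀ W → ∣ ⋃[ W ] L ∣ ≤ c → ∀ {x} → x ∈ W → L x ≡ ⋃[ W ] L
    identicalLists W le {x} x∈W = ⊆∧∣∣≥⇒≡ (∈⋃⁺ W L x∈W) (subst (∣ ⋃[ W ] L ∣ ≤_) (sym (∣L∣≡c x)) le)

    -- A conflict between the two colourings would be an edge whose ends share a colour, that is, a
    -- link.
    combine : ∀ H R → ¬ Link H R → ColourableOn R → ColourableOn (H ─ R) → ColourableOn H
    combine H R unlinked (f , f∈ , f≢) (g , g∈ , g≢) = h , h∈ , h≢
      where
      h : Fin n → Fin s
      h x with x ∈? R
      ... | yes _ = f x
      ... | no _ = g x
      h∈ : ∀ x → h x ∈ L x
      h∈ x with x ∈? R
      ... | yes _ = f∈ x
      ... | no _ = g∈ x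
      h≢ : ∀ {x y} → x ∈ H → y ∈ H → E x y → h x ≢ h y
      h≢ {x} {y} x∈H y∈H e with x ∈? R | y ∈? R
      ... | yes x∈R | yes y∈R = f≢ x∈R y∈R e
      ... | no x∉R  | no y∉R  = g≢ (x∈p∧x∉q⇒x∈p─q x∈H x∉R) (x∈p∧x∉q⇒x∈p─q y∈H y∉R) e
      ... | no x∉R  | yes y∈R = λ eq → unlinked (x , (x∈H , x∉R) , y , y∈R , e ,
          g x , x∈p∩q⁺ (g∈ x , subst (_∈ L y) (sym eq) (f∈ y)))
      ... | yes x∈R | no y∉R  = λ eq → unlinked (y , (y∈H , y∉R) , x , x∈R , E-sym e ,
          g y , x∈p∩q⁺ (g∈ y , subst (_∈ L x) eq (f∈ x)))

    -- Connectedness of `H` in the graph of those edges whose ends share a colour.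
    Linked : Subset n → Set
    Linked H = ∀ R → R ⊆ H → Nonempty R → ∃ (λ x → x ∈ H × x ∉ R) → Link H R

    injective⇒colouring : ∀ H → (∃ λ f → (∀ x → f x ∈ L x) × InjectiveOn H f) → ColourableOn H
    injective⇒colouring H (f , f∈ , inj) = f , f∈ , λ x∈ y∈ e eq → E-irrefl e (inj x∈ y∈ eq)

    -- Two non-adjacent vertices of H take the same colour, the others distinct ones.
    identical⇒colourable : NoMonoClique → ∀ H → ∣ H ∣ ≡ suc c → ∣ ⋃[ H ] L ∣ ≤ c → ColourableOn H
    identical⇒colourable noClique H ∣H∣ ∣⋃∣ with
      any? (λ x → any? λ y → (x ∈? H) ×-dec (y ∈? H) ×-dec ¬? (x ≟ y) ×-dec ¬? (E? x y))
    ... | no none = ⊥-elim (noClique H ∣H∣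
            (λ {x} {y} x∈ y∈ x≢y → decidable-stable (E? x y) λ ¬e → none (x , y , x∈ , y∈ , x≢y , ¬e))
            (⋃[ H ] L) (identicalLists H ∣⋃∣))
    ... | yes (x , y , x∈H , y∈H , x≢y , ¬e) = h , h∈ , h≢
      where
      ∣H-y∣≤c : ∣ H - y ∣ ≤ c
      ∣H-y∣≤c = s≤s⁻¹ (subst (∣ H - y ∣ <_) ∣H∣ (x∈p⇒∣p-x∣<∣p∣ y∈H))
      -- At most `c` vertices remain, and every nonempty union already has `c` colours.
      hallCondition : HallCondition (H - y) L
      hallCondition W W⊆ with nonempty? W
      ... | yes ne = ≤-trans (≤-trans (p⊆q⇒∣p∣≤∣q∣ W⊆) ∣H-y∣≤c) (⋃∣≥∣ W ne)
      ... | no empty = subst (_≤ ∣ ⋃[ W ] L ∣) (sym (trans (cong ∣_∣ (Empty-unique empty)) (∣⊥∣≡0 n))) z≤n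
      sdr = hall (H - y) L L-nonempty hallCondition
      f = proj₁ sdr
      f∈ = proj₁ (proj₂ sdr)
      inj = proj₂ (proj₂ sdr)
      h : Fin n → Fin s
      h z with z ≟ y
      ... | yes _ = f x
      ... | no _ = f z
      Lx≡Ly : L x ≡ L y
      Lx≡Ly = trans (identicalLists H ∣⋃∣ x∈H) (sym (identicalLists H ∣⋃∣ y∈H))
      h∈ : ∀ z → h z ∈ L z
      h∈ z with z ≟ y
      ... | yes refl = subst (f x ∈_) Lx≡Ly (f∈ x)
      ... | no _ = f∈ z
      h≢ : ∀ {w z} → w ∈ H → z ∈ H → E w z → h w ≢ h z
      h≢ {w} {z} w∈H z∈H e with w ≟ y | z ≟ y
      ... | yes refl | yes refl = ⊥-elim (E-irrefl e refl)
      ... | yes refl | no z≢y = λ eq → ¬e (subst (λ v → E v y)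
            (sym (inj (x∈p∧x≢y⇒x∈p-y x∈H x≢y) (x∈p∧x≢y⇒x∈p-y z∈H z≢y) eq)) (E-sym e))
      ... | no w≢y | yes refl = λ eq → ¬e (subst (λ v → E v y)
            (inj (x∈p∧x≢y⇒x∈p-y w∈H w≢y) (x∈p∧x≢y⇒x∈p-y x∈H x≢y) eq) e)
      ... | no w≢y | no z≢y = λ eq → E-irrefl e
            (inj (x∈p∧x≢y⇒x∈p-y w∈H w≢y) (x∈p∧x≢y⇒x∈p-y z∈H z≢y) eq)

    -- From c w ≤ u + c² and u < w follows (c - 1) w ≤ c² - 1 = (c - 1)(c + 1); the factor c - 1 is
    -- cancelled, whence `1 < c`.
    violator-size : ∀ W → 1 < c → Sparse W → ∣ ⋃[ W ] L ∣ < ∣ W ∣ → ∣ W ∣ ≤ suc c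
    violator-size W 1<c sp v = go c 1<c sp
      where
      w = ∣ W ∣
      u = ∣ ⋃[ W ] L ∣
      go : ∀ c → 1 < c → c * w ≤ u + c * c → w ≤ suc c
      go (suc (suc b)) (s≤s (s≤s z≤n)) sp = *-cancelˡ-≤ (suc b) (+-cancelˡ-≤ (suc w) _ _ (begin
        suc w + suc b * w ≡⟨⟩
        suc (suc (suc b) * w) ≤⟨ s≤s sp ⟩
        suc u + suc (suc b) * suc (suc b) ≤⟨ +-monoˡ-≤ (suc (suc b) * suc (suc b)) v ⟩
        w + suc (suc b) * suc (suc b) ≡⟨ solve 2 (λ w b →
            w :+ (con 2 :+ b) :* (con 2 :+ b) := con 1 :+ w :+ (con 1 :+ b) :* (con 3 :+ b)) refl w b ⟩
        suc w + suc b * suc (suc (suc b)) ∎))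
        where open +-*-Solver

    -- A nonempty union has at least `c` colours, which closes the gap left by `violator-size`; by
    -- `identicalLists` all lists on `W` then coincide.
    violator-tight : ∀ W → 1 < c → Sparse W → ∣ ⋃[ W ] L ∣ < ∣ W ∣ → Nonempty W × ∣ W ∣ ≡ suc c × ∣ ⋃[ W ] L ∣ ≤ c
    violator-tight W 1<c sp v = ne , ≤-antisym ∣W∣≤ (≤-<-trans (⋃∣≥∣ W ne) v) , s≤s⁻¹ (≤-trans v ∣W∣≤)
      where
      ∣W∣≤ = violator-size W 1<c sp v
      ne = 0<∣p∣⇒Nonempty W (≤-<-trans z≤n v)

    -- A violator has c + 1 vertices and at most c colours. If `H` had a further vertex, a link
    -- would attach one, giving c + 2 vertices with at most 2c - 1 colours and so deficiency c² + 1.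
    -- Hence the violator is all of `H`, and the lists on `H` are identical.
    colourSparse : NoMonoClique → 1 < c → ∀ H → Linked H → (∀ W → W ⊆ H → Sparse W) → ColourableOn H
    colourSparse noClique 1<c H linked sparse with hallOrViolator H L
    ... | inj₁ hc = injective⇒colouring H (hall H L L-nonempty hc)
    ... | inj₂ (W , W⊆H , v) with violator-tight W 1<c (sparse W W⊆H) v | any? (λ x → (x ∈? H) ×-dec ¬? (x ∈? W))
    ...   | _ , ∣W∣≡ , ∣⋃W∣≤ | no none = identical⇒colourable noClique H
            (subst (λ V → ∣ V ∣ ≡ suc c) W≡H ∣W∣≡) (subst (λ V → ∣ ⋃[ V ] L ∣ ≤ c) W≡H ∣⋃W∣≤)
      where
      W≡H : W ≡ H
      W≡H = ⊆-antisym W⊆H λ {x} x∈H → decidable-stable (x ∈? W) λ x∉W → none (x , x∈H , x∉W)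
    ...   | ne , ∣W∣≡ , ∣⋃W∣≤ | yes more = ⊥-elim (contra (linked W W⊆H ne more))
      where
      contra : Link H W → ∅
      contra (x , (x∈H , x∉W) , y , y∈W , _ , common) = <-irrefl refl (begin-strict
        u + c * c <⟨ +-monoˡ-≤ (c * c) (link-union W y∈W common) ⟩
        ∣ ⋃[ W ] L ∣ + c + c * c ≤⟨ +-monoˡ-≤ (c * c) (+-monoˡ-≤ c ∣⋃W∣≤) ⟩
        c + c + c * c ≡⟨ solve 1 (λ c → c :+ c :+ c :* c := c :* (con 2 :+ c)) refl c ⟩
        c * suc (suc c) ≡⟨ cong (c *_) (trans (cong suc (sym ∣W∣≡)) (sym (∣∪⁅⁆∣ W x x∉W))) ⟩
        c * ∣ W ∪ ⁅ x ⁆ ∣ ≤⟨ sparse (W ∪ ⁅ x ⁆) W+x⊆H ⟩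
        u + c * c ∎)
        where
        open +-*-Solver
        u = ∣ ⋃[ W ∪ ⁅ x ⁆ ] L ∣
        W+x⊆H : W ∪ ⁅ x ⁆ ⊆ H
        W+x⊆H z∈ = [ W⊆H , (λ z∈x → subst (_∈ H) (sym (x∈⁅y⁆⇒x≡y x z∈x)) x∈H) ]′ (x∈p∪q⁻ W ⁅ x ⁆ z∈)

    module _ (Near : ℕ → Fin n → Fin n → Set)
      (near-refl : ∀ v → Near 0 v v)
      (near-suc : ∀ {j v x} → Near j v x → Near (suc j) v x)
      (near-step : ∀ {j v x y} → Near j v y → E x y → Near (suc j) v x)
      where

      -- The field `few` says that the deficiency of `R` is at least `j`: each vertex after `v` was
      -- attached by a link.
      record Grown (H : Subset n) (v : Fin n) (j : ℕ) : Set where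
        field
          R      : Subset n
          R⊆H    : R ⊆ H
          v∈R    : v ∈ R
          size   : ∣ R ∣ ≡ suc j
          few    : ∣ ⋃[ R ] L ∣ + j ≤ c * suc j
          near   : ∀ {x} → x ∈ R → Near j v x

      -- Links are available until `R` exhausts `H`, and in that case all of `H` is near `v`.
      grow : ∀ H v → v ∈ H → Linked H → ∀ j → Grown H v j ⊎ (∀ {x} → x ∈ H → Near j v x)
      grow H v v∈H linked zero = inj₁ record
        { R = ⁅ v ⁆
        ; R⊆H = λ x∈ → subst (_∈ H) (sym (x∈⁅y⁆⇒x≡y v x∈)) v∈H
        ; v∈R = x∈⁅x⁆ v
        ; size = ∣⁅x⁆∣≡1 v
        ; few = subst₂ _≤_ (sym (+-identityʳ _)) (cong (c *_) (∣⁅x⁆∣≡1 v)) (∣⋃∣≤ c ⁅ v ⁆ L (≤-reflexive ∘ ∣L∣≡c))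
        ; near = λ x∈ → subst (Near 0 v) (sym (x∈⁅y⁆⇒x≡y v x∈)) (near-refl v)
        }
      grow H v v∈H linked (suc j) with grow H v v∈H linked j
      ... | inj₂ all = inj₂ (near-suc ∘ all)
      ... | inj₁ g with any? (λ x → (x ∈? H) ×-dec ¬? (x ∈? Grown.R g))
      ...   | no none = inj₂ λ {x} x∈H → near-suc (near
              (decidable-stable (x ∈? R) λ x∉R → none (x , x∈H , x∉R)))
        where open Grown g
      ...   | yes more with linked (Grown.R g) (Grown.R⊆H g) (v , Grown.v∈R g) more
      ...     | x , (x∈H , x∉R) , y , y∈R , e , common = inj₁ record
        { R = R ∪ ⁅ x ⁆
        ; R⊆H = λ z∈ → [ R⊆H , (λ z∈x → subst (_∈ H) (sym (x∈⁅y⁆⇒x≡y x z∈x)) x∈H) ]′ (x∈p∪q⁻ R ⁅ x ⁆ z∈)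
        ; v∈R = x∈p∪q⁺ (inj₁ v∈R)
        ; size = trans (∣∪⁅⁆∣ R x x∉R) (cong suc size)
        ; few = begin
            ∣ ⋃[ R ∪ ⁅ x ⁆ ] L ∣ + suc j ≡⟨ +-suc _ j ⟩
            suc ∣ ⋃[ R ∪ ⁅ x ⁆ ] L ∣ + j ≤⟨ +-monoˡ-≤ j (link-union R y∈R common) ⟩
            ∣ ⋃[ R ] L ∣ + c + j ≡⟨ solve 3 (λ a c j → a :+ c :+ j := c :+ (a :+ j)) refl ∣ ⋃[ R ] L ∣ c j ⟩
            c + (∣ ⋃[ R ] L ∣ + j) ≤⟨ +-monoʳ-≤ c few ⟩
            c + c * suc j ≡⟨ *-suc c (suc j) ⟨
            c * suc (suc j) ∎
        ; near = λ z∈ → [ near-suc ∘ near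
                        , (λ z∈x → subst (Near (suc j) v) (sym (x∈⁅y⁆⇒x≡y x z∈x)) (near-step (near y∈R) e)) ]′
                        (x∈p∪q⁻ R ⁅ x ⁆ z∈)
        }
        where
        open Grown g
        open +-*-Solver

      module _ (window : Fin n → Subset n)
        (near⇒window : ∀ {v x} → Near (suc (c * c)) v x → x ∈ window v)
        (sparse : ∀ v → Sparse (window v))
        (noClique : NoMonoClique)
        (1<c : 1 < c)
        where

        -- After c² + 1 links the grown set would be a part of the window at `v` with deficiency
        -- exceeding c². So growth stops earlier, and all of `H` lies in the window.
        Sparse-linked : ∀ H v → v ∈ H → Linked H → ∀ W → W ⊆ H → Sparse W
        Sparse-linked H v v∈H linked W W⊆H with grow H v v∈H linked (suc (c * c))
        ... | inj₂ all = Sparse-⊆ (λ x∈ → near⇒window (all (W⊆H x∈))) (sparse v)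
        ... | inj₁ g = ⊥-elim (<-irrefl refl (begin-strict
          c * ∣ R ∣ ≤⟨ Sparse-⊆ (near⇒window ∘ near) (sparse v) ⟩
          ∣ ⋃[ R ] L ∣ + c * c <⟨ ≤-reflexive (sym (+-suc _ (c * c))) ⟩
          ∣ ⋃[ R ] L ∣ + suc (c * c) ≤⟨ few ⟩
          c * suc (suc (c * c)) ≡⟨ cong (c *_) size ⟨
          c * ∣ R ∣ ∎))
          where open Grown g

        -- An unlinked part is split off and coloured separately as long as there is one; a set
        -- without such a part is linked and falls to `colourSparse`.
        colourOn : ∀ m H → ∣ H ∣ ≤ m → ColourableOn H
        colourOn m H ∣H∣≤m with nonempty? H
        ... | no empty = injective⇒colouring H
                (proj₁ ∘ L-nonempty , proj₂ ∘ L-nonempty , λ {x} x∈H → ⊥-elim (empty (x , x∈H)))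
        colourOn zero H ∣H∣≤m | yes ne = ⊥-elim (<-irrefl refl (≤-trans (Nonempty⇒0<∣p∣ ne) ∣H∣≤m))
        colourOn (suc m) H ∣H∣≤m | yes (v , v∈H) with anySubset? (λ R → (R ⊆? H) ×-dec nonempty? R ×-dec
          any? (λ x → (x ∈? H) ×-dec ¬? (x ∈? R)) ×-dec ¬? (link? H R))
        ... | yes (R , R⊆H , (y , y∈R) , (x , x∈H , x∉R) , unlinked) = combine H R unlinked
          (colourOn m R (s≤s⁻¹ (≤-trans (p⊂q⇒∣p∣<∣q∣ (R⊆H , x , x∈H , x∉R)) ∣H∣≤m)))
          (colourOn m (H ─ R) (s≤s⁻¹ (≤-trans (p∩q≢∅⇒∣p─q∣<∣p∣ H R (y , x∈p∩q⁺ (R⊆H y∈R , y∈R))) ∣H∣≤m)))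
        ... | no none = colourSparse noClique 1<c H linked (Sparse-linked H v v∈H linked)
          where
          linked : Linked H
          linked R R⊆H ne more = decidable-stable (link? H R) λ unlinked → none (R , R⊆H , ne , more , unlinked)

    -- The only candidate colouring takes the unique colour of each list, and a conflict along an
    -- edge is a 2-clique with identical lists.
    singletonLists⇒colourable : c ≡ 1 → NoMonoClique → ColourableOn ⊤
    singletonLists⇒colourable c≡1 noClique = f , proj₂ ∘ L-nonempty , λ {x} {y} _ _ e fx≡fy →
      noClique (⁅ x ⁆ ∪ ⁅ y ⁆)
        (trans (∣∪⁅⁆∣ ⁅ x ⁆ y (λ y∈ → E-irrefl e (sym (x∈⁅y⁆⇒x≡y x y∈)))) (cong suc (trans (∣⁅x⁆∣≡1 x) (sym c≡1))))
        (λ w∈ z∈ w≢z → pair e (elim w∈) (elim z∈) w≢z)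
        ⁅ f x ⁆
        (λ z∈ → trans (single _) (cong ⁅_⁆ ([ (λ { refl → refl }) , (λ { refl → sym fx≡fy }) ]′ (elim z∈))))
      where
      f = proj₁ ∘ L-nonempty
      elim : ∀ {x y z} → z ∈ ⁅ x ⁆ ∪ ⁅ y ⁆ → z ≡ x ⊎ z ≡ y
      elim {x} {y} z∈ = [ inj₁ ∘ x∈⁅y⁆⇒x≡y x , inj₂ ∘ x∈⁅y⁆⇒x≡y y ]′ (x∈p∪q⁻ ⁅ x ⁆ ⁅ y ⁆ z∈)
      pair : ∀ {x y w z} → E x y → w ≡ x ⊎ w ≡ y → z ≡ x ⊎ z ≡ y → w ≢ z → E w z
      pair e (inj₁ refl) (inj₁ refl) w≢z = ⊥-elim (w≢z refl)
      pair e (inj₁ refl) (inj₂ refl) w≢z = e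
      pair e (inj₂ refl) (inj₁ refl) w≢z = E-sym e
      pair e (inj₂ refl) (inj₂ refl) w≢z = ⊥-elim (w≢z refl)
      single : ∀ x → L x ≡ ⁅ f x ⁆
      single x = sym (⊆∧∣∣≥⇒≡ (λ y∈ → subst (_∈ L x) (sym (x∈⁅y⁆⇒x≡y (f x) y∈)) (proj₂ (L-nonempty x)))
        (≤-reflexive (trans (∣L∣≡c x) (trans c≡1 (sym (∣⁅x⁆∣≡1 (f x)))))))

-- Sums, indicators and expectation over independent uniform choices.

module Expectations where

  open import Data.Nat.Base as ℕ using (ℕ; zero; suc)
  open import Data.Rational.Base using (ℚ; 0ℚ; 1ℚ; _+_; _*_; _≤_; _<_)
  open import Data.Rational.Solver using (module +-*-Solver)
  open import Data.Fin.Subset using (Subset; _∈_; ∣_∣; inside; outside; ∁)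
  open import Data.Fin.Subset.Properties using (_∈?_)
  open import Data.Empty using (⊥-elim)

  0≤1 : 0ℚ ≤ 1ℚ
  0≤1 = ℚ.<⇒≤ 0<1

  private
    variable
      A B : Set
      P Q R : Set
      n : ℕ

  Σ : List A → (A → ℚ) → ℚ
  Σ []       f = 0ℚ
  Σ (x ∷ xs) f = f x + Σ xs f

  Σ-mono : (xs : List A) {f g : A → ℚ} → (∀ {x} → x List.∈ xs → f x ≤ g x) → Σ xs f ≤ Σ xs g
  Σ-mono []       h = ℚ.≤-refl
  Σ-mono (x ∷ xs) h = ℚ.+-mono-≤ (h (here refl)) (Σ-mono xs (h ∘ there))

  Σ-cong : (xs : List A) {f g : A → ℚ} → (∀ {x} → x List.∈ xs → f x ≡ g x) → Σ xs f ≡ Σ xs g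
  Σ-cong []       h = refl
  Σ-cong (x ∷ xs) h = cong₂ _+_ (h (here refl)) (Σ-cong xs (h ∘ there))

  Σ-+ : (xs : List A) (f g : A → ℚ) → Σ xs (λ x → f x + g x) ≡ Σ xs f + Σ xs g
  Σ-+ []       f g = refl
  Σ-+ (x ∷ xs) f g = trans (cong (f x + g x +_) (Σ-+ xs f g))
    (solve 4 (λ a b c d → (a :+ b) :+ (c :+ d) := (a :+ c) :+ (b :+ d)) refl (f x) (g x) (Σ xs f) (Σ xs g))
    where open +-*-Solver

  Σ-*ʳ : (xs : List A) (f : A → ℚ) (a : ℚ) → Σ xs (λ x → f x * a) ≡ Σ xs f * a
  Σ-*ʳ []       f a = sym (ℚ.*-zeroˡ a)
  Σ-*ʳ (x ∷ xs) f a = trans (cong (f x * a +_) (Σ-*ʳ xs f a)) (sym (ℚ.*-distribʳ-+ a (f x) (Σ xs f)))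

  Σ-const : (xs : List A) (a : ℚ) → Σ xs (λ _ → a) ≡ fromℕ (length xs) * a
  Σ-const []       a = sym (ℚ.*-zeroˡ a)
  Σ-const (x ∷ xs) a = trans (cong₂ _+_ (sym (ℚ.*-identityˡ a)) (Σ-const xs a))
    (trans (sym (ℚ.*-distribʳ-+ a 1ℚ (fromℕ (length xs)))) (cong (_* a) (sym (fromℕ-suc (length xs)))))

  Σ-++ : (xs ys : List A) (f : A → ℚ) → Σ (xs ++ ys) f ≡ Σ xs f + Σ ys f
  Σ-++ []       ys f = sym (ℚ.+-identityˡ _)
  Σ-++ (x ∷ xs) ys f = trans (cong (f x +_) (Σ-++ xs ys f)) (sym (ℚ.+-assoc (f x) _ _))

  Σ-map : (g : A → B) (xs : List A) (f : B → ℚ) → Σ (map g xs) f ≡ Σ xs (f ∘ g)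
  Σ-map g []       f = refl
  Σ-map g (x ∷ xs) f = cong (f (g x) +_) (Σ-map g xs f)

  Σ-nonNeg : (xs : List A) {f : A → ℚ} → (∀ x → 0ℚ ≤ f x) → 0ℚ ≤ Σ xs f
  Σ-nonNeg []       h = ℚ.≤-refl
  Σ-nonNeg (x ∷ xs) h = +-nonNeg (h x) (Σ-nonNeg xs h)

  Σ-bound : (xs : List A) {f : A → ℚ} (a : ℚ) → (∀ {x} → x List.∈ xs → f x ≤ a) → Σ xs f ≤ fromℕ (length xs) * a
  Σ-bound xs a h = ℚ.≤-trans (Σ-mono xs h) (ℚ.≤-reflexive (Σ-const xs a))

  𝟙 : Dec P → ℚ
  𝟙 P? = if does P? then 1ℚ else 0ℚ

  𝟙-yes : (P? : Dec P) → P → 𝟙 P? ≡ 1ℚ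
  𝟙-yes (yes _) p = refl
  𝟙-yes (no ¬p) p = ⊥-elim (¬p p)

  𝟙-no : (P? : Dec P) → ¬ P → 𝟙 P? ≡ 0ℚ
  𝟙-no (yes p) ¬p = ⊥-elim (¬p p)
  𝟙-no (no _)  ¬p = refl

  0≤𝟙 : (P? : Dec P) → 0ℚ ≤ 𝟙 P?
  0≤𝟙 (yes _) = 0≤1
  0≤𝟙 (no _)  = ℚ.≤-refl

  𝟙≤1 : (P? : Dec P) → 𝟙 P? ≤ 1ℚ
  𝟙≤1 (yes _) = ℚ.≤-refl
  𝟙≤1 (no _)  = 0≤1

  𝟙-mono : (P? : Dec P) (Q? : Dec Q) → (P → Q) → 𝟙 P? ≤ 𝟙 Q?
  𝟙-mono (yes p) Q? f = ℚ.≤-reflexive (sym (𝟙-yes Q? (f p)))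
  𝟙-mono (no _)  Q? f = 0≤𝟙 Q?

  𝟙-cong : (P? : Dec P) (Q? : Dec Q) → (P → Q) → (Q → P) → 𝟙 P? ≡ 𝟙 Q?
  𝟙-cong P? Q? f g = ℚ.≤-antisym (𝟙-mono P? Q? f) (𝟙-mono Q? P? g)

  𝟙-×ˡ : (P? : Dec P) (Q? : Dec Q) (R? : Dec R) → (P → Q → R) → 𝟙 P? * 𝟙 Q? ≤ 𝟙 R?
  𝟙-×ˡ (yes p) (yes q) R? f = ℚ.≤-reflexive (sym (𝟙-yes R? (f p q)))
  𝟙-×ˡ (yes p) (no _)  R? f = 0≤𝟙 R?
  𝟙-×ˡ (no _)  (yes _) R? f = 0≤𝟙 R?
  𝟙-×ˡ (no _)  (no _)  R? f = 0≤𝟙 R?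

  𝟙-× : (P? : Dec P) (Q? : Dec Q) (R? : Dec R) → (P → Q → R) → (R → P × Q) → 𝟙 R? ≡ 𝟙 P? * 𝟙 Q?
  𝟙-× (yes p) (yes q) R? f g = 𝟙-yes R? (f p q)
  𝟙-× (yes p) (no ¬q) R? f g = 𝟙-no R? (¬q ∘ proj₂ ∘ g)
  𝟙-× (no ¬p) (yes _) R? f g = 𝟙-no R? (¬p ∘ proj₁ ∘ g)
  𝟙-× (no ¬p) (no _)  R? f g = 𝟙-no R? (¬p ∘ proj₁ ∘ g)

  -- Taking expectations turns this pointwise inequality into the union bound.
  𝟙-any : {P : Pred A 0ℓ} (P? : Decidable₁ P) (xs : List A) → 𝟙 (Any.any? P? xs) ≤ Σ xs (λ x → 𝟙 (P? x))
  𝟙-any P? [] = ℚ.≤-refl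
  𝟙-any P? (x ∷ xs) with P? x
  ... | yes p = ≤-+ʳ {1ℚ} (Σ-nonNeg xs (λ y → 0≤𝟙 (P? y)))
  ... | no ¬p = subst (𝟙 (Any.any? P? xs) ≤_) (sym (ℚ.+-identityˡ _)) (𝟙-any P? xs)

  Σ-𝟙-zero : {P : Pred A 0ℓ} (P? : Decidable₁ P) (xs : List A) → All (¬_ ∘ P) xs → Σ xs (λ x → 𝟙 (P? x)) ≡ 0ℚ
  Σ-𝟙-zero P? [] [] = refl
  Σ-𝟙-zero P? (x ∷ xs) (¬p ∷ ¬ps) = trans (cong₂ _+_ (𝟙-no (P? x) ¬p) (Σ-𝟙-zero P? xs ¬ps)) (ℚ.+-identityʳ 0ℚ)

  -- Mutually exclusive events make the union bound exact; duplicates in `xs` would be counted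
  -- twice, hence `Unique`.
  𝟙-any-exclusive : {P : Pred A 0ℓ} (P? : Decidable₁ P) (xs : List A) → Unique xs →
    (∀ {x y} → P x → P y → x ≡ y) → Σ xs (λ x → 𝟙 (P? x)) ≡ 𝟙 (Any.any? P? xs)
  𝟙-any-exclusive P? [] _ excl = refl
  𝟙-any-exclusive {P = P} P? (x ∷ xs) (x∉xs ∷ u) excl with P? x
  ... | yes p = trans (cong (1ℚ +_) (Σ-𝟙-zero P? xs (All.map (λ x≢y q → x≢y (excl p q)) x∉xs))) (ℚ.+-identityʳ 1ℚ)
  ... | no ¬p = trans (ℚ.+-identityˡ _) ((𝟙-any-exclusive P? xs u excl))

  Σ-filter : {P : Pred A 0ℓ} (P? : Decidable₁ P) (xs : List A) →
    Σ xs (λ x → 𝟙 (P? x)) ≡ fromℕ (length (filter P? xs))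
  Σ-filter P? [] = refl
  Σ-filter P? (x ∷ xs) with P? x
  ... | yes p = trans (cong (1ℚ +_) (Σ-filter P? xs)) (sym (fromℕ-suc (length (filter P? xs))))
  ... | no ¬p = trans (ℚ.+-identityˡ _) (Σ-filter P? xs)

  Σ-cartesianProductWith : ∀ {C : Set} (f : A → B → C) xs ys (g : C → ℚ) →
    Σ (cartesianProductWith f xs ys) g ≡ Σ xs (λ x → Σ ys (λ y → g (f x y)))
  Σ-cartesianProductWith f []       ys g = refl
  Σ-cartesianProductWith f (x ∷ xs) ys g = trans (Σ-++ (map (f x) ys) _ g)
    (cong₂ _+_ (Σ-map (f x) ys g) (Σ-cartesianProductWith f xs ys g))

  fromℕ-*-homo : ∀ a b → fromℕ (a ℕ.* b) ≡ fromℕ a * fromℕ b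
  fromℕ-*-homo a b = sym (/-* a 1 b 1)

  fromℕ-+-homo : ∀ a b → fromℕ (a ℕ.+ b) ≡ fromℕ a + fromℕ b
  fromℕ-+-homo a b = sym (/-+ a b 1)

  fromℕ-^ : ∀ a m → fromℕ (a ℕ.^ m) ≡ fromℕ a ^ℚ m
  fromℕ-^ a zero    = refl
  fromℕ-^ a (suc m) = trans (fromℕ-*-homo a (a ℕ.^ m)) (cong (fromℕ a *_) (fromℕ-^ a m))

  ^-nonNeg : ∀ {a} m → 0ℚ ≤ a → 0ℚ ≤ a ^ℚ m
  ^-nonNeg zero    h = 0≤1
  ^-nonNeg (suc m) h = *-nonNeg h (^-nonNeg m h)

  ^-pos : ∀ {a} m → 0ℚ < a → 0ℚ < a ^ℚ m
  ^-pos zero    h = 0<1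
  ^-pos (suc m) h = *-pos h (^-pos m h)

  ^-≤1 : ∀ {a} m → 0ℚ ≤ a → a ≤ 1ℚ → a ^ℚ m ≤ 1ℚ
  ^-≤1 zero    h k = ℚ.≤-refl
  ^-≤1 {a} (suc m) h k = ℚ.≤-trans (*-mono h 0≤1 k (^-≤1 m h k)) (ℚ.≤-reflexive (ℚ.*-identityʳ 1ℚ))

  ^-anti : ∀ {a m o} → 0ℚ ≤ a → a ≤ 1ℚ → m ℕ.≤ o → a ^ℚ o ≤ a ^ℚ m
  ^-anti {a} {m} {o} h k ℕ.z≤n = ^-≤1 o h k
  ^-anti h k (ℕ.s≤s le) = *-monoˡ h (^-anti h k le)

  ^-mono : ∀ {a b} m → 0ℚ ≤ a → a ≤ b → a ^ℚ m ≤ b ^ℚ m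
  ^-mono zero    0≤a a≤b = ℚ.≤-refl
  ^-mono (suc m) 0≤a a≤b = *-mono 0≤a (^-nonNeg m (ℚ.≤-trans 0≤a a≤b)) a≤b (^-mono m 0≤a a≤b)

  1≤2 : 1ℚ ≤ fromℕ 2
  1≤2 = fromℕ-mono {1} {2} (ℕ.s≤s ℕ.z≤n)

  1≤^ : ∀ {a} m → 1ℚ ≤ a → 1ℚ ≤ a ^ℚ m
  1≤^ zero    1≤a = ℚ.≤-refl
  1≤^ {a} (suc m) 1≤a = subst (_≤ a ^ℚ suc m) (ℚ.*-identityʳ 1ℚ)
    (*-mono 0≤1 (ℚ.≤-trans 0≤1 (1≤^ m 1≤a)) 1≤a (1≤^ m 1≤a))

  ^-mono-exp : ∀ {a m o} → 1ℚ ≤ a → m ℕ.≤ o → a ^ℚ m ≤ a ^ℚ o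
  ^-mono-exp {o = o} 1≤a ℕ.z≤n = 1≤^ o 1≤a
  ^-mono-exp 1≤a (ℕ.s≤s le) = *-monoˡ (ℚ.≤-trans 0≤1 1≤a) (^-mono-exp 1≤a le)

  ^-+ : ∀ a m o → a ^ℚ (m ℕ.+ o) ≡ a ^ℚ m * a ^ℚ o
  ^-+ a zero    o = sym (ℚ.*-identityˡ _)
  ^-+ a (suc m) o = trans (cong (a *_) (^-+ a m o)) (sym (ℚ.*-assoc a (a ^ℚ m) (a ^ℚ o)))
  ^-^ : ∀ a m o → (a ^ℚ m) ^ℚ o ≡ a ^ℚ (m ℕ.* o)
  ^-^ a m zero    = cong (a ^ℚ_) (sym (ℕ.*-zeroʳ m))
  ^-^ a m (suc o) = trans (cong (a ^ℚ m *_) (^-^ a m o))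
    (trans (sym (^-+ a m (m ℕ.* o))) (cong (a ^ℚ_) (sym (ℕ.*-suc m o))))

  *-^ : ∀ a b m → (a * b) ^ℚ m ≡ a ^ℚ m * b ^ℚ m
  *-^ a b zero    = refl
  *-^ a b (suc m) = trans (cong (a * b *_) (*-^ a b m))
    (solve 4 (λ a b x y → (a :* b) :* (x :* y) := (a :* x) :* (b :* y)) refl a b (a ^ℚ m) (b ^ℚ m))
    where open +-*-Solver

  1^ : ∀ m → 1ℚ ^ℚ m ≡ 1ℚ
  1^ zero    = refl
  1^ (suc m) = trans (ℚ.*-identityˡ _) (1^ m)

  0≤recip : ∀ {a} → 0ℚ < a → 0ℚ ≤ recip a
  0≤recip h = ℚ.<⇒≤ (0<recip h)

  ∣∣≤-nonNeg : ∀ {a} → 0ℚ ≤ a → ℚ.∣ a ∣ ≤ a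
  ∣∣≤-nonNeg h = ℚ.≤-reflexive (ℚ.0≤p⇒∣p∣≡p h)

  recip-unique : ∀ {a b} → 0ℚ < a → a * b ≡ 1ℚ → recip a ≡ b
  recip-unique {a} {b} h e = trans (sym (ℚ.*-identityʳ (recip a))) (trans (cong (recip a *_) (sym e))
    (trans (solve 3 (λ r a b → r :* (a :* b) := (a :* r) :* b) refl (recip a) a b)
      (trans (cong (_* b) (*-recip h)) (ℚ.*-identityˡ b))))
    where open +-*-Solver

  recip-* : ∀ {a b} → 0ℚ < a → 0ℚ < b → recip (a * b) ≡ recip a * recip b
  recip-* {a} {b} ha hb = recip-unique (*-pos ha hb)
    (trans (solve 4 (λ a b r s → (a :* b) :* (r :* s) := (a :* r) :* (b :* s)) refl a b (recip a) (recip b))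
      (trans (cong₂ _*_ (*-recip ha) (*-recip hb)) (ℚ.*-identityʳ 1ℚ)))
    where open +-*-Solver

  recip-^ : ∀ {a} m → 0ℚ < a → recip (a ^ℚ m) ≡ recip a ^ℚ m
  recip-^ {a} zero    h = recip-unique 0<1 (ℚ.*-identityʳ 1ℚ)
  recip-^ {a} (suc m) h = trans (recip-* h (^-pos m h)) (cong (recip a *_) (recip-^ m h))

  module Expectation {A : Set} (X : List A) (0<N : 0ℚ < fromℕ (length X)) where

    N w : ℚ
    N = fromℕ (length X)
    w = recip N

    0<w : 0ℚ < w
    0<w = 0<recip 0<N

    0≤w : 0ℚ ≤ w
    0≤w = ℚ.<⇒≤ 0<w

    avg : (A → ℚ) → ℚ
    avg f = Σ X f * w

    avg-cong : {f g : A → ℚ} → (∀ x → f x ≡ g x) → avg f ≡ avg g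
    avg-cong h = cong (_* w) (Σ-cong X (λ {x} _ → h x))

    avg-const : ∀ a → avg (λ _ → a) ≡ a
    avg-const a = trans (cong (_* w) (Σ-const X a))
      (trans (solve 3 (λ n a w → n :* a :* w := a :* (n :* w)) refl N a w)
        (trans (cong (a *_) (*-recip 0<N)) (ℚ.*-identityʳ a)))
      where open +-*-Solver

    -- Averaging one coordinate at a time, rather than over the list of all vectors, lets
    -- independence be proved by induction on coordinates; `E-vectors` identifies the two.
    E : ∀ {n} → (Vec A n → ℚ) → ℚ
    E {zero}  f = f []
    E {suc n} f = avg (λ x → E (λ v → f (x ∷ v)))

    -- Colourability statements need every list to have `c` colours, so `E-mono` asks for its
    -- inequality only on vectors with entries in `X`.
    InX : Vec A n → Set
    InX = VecAll.All (List._∈ X)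

    E-mono : {f g : Vec A n → ℚ} → (∀ v → InX v → f v ≤ g v) → E f ≤ E g
    E-mono {zero}  h = h [] VecAll.[]
    E-mono {suc n} h = *-monoʳ 0≤w (Σ-mono X λ {x} x∈ → E-mono (λ v v∈ → h (x ∷ v) (x∈ VecAll.∷ v∈)))

    E-cong : {f g : Vec A n → ℚ} → (∀ v → f v ≡ g v) → E f ≡ E g
    E-cong {zero}  h = h []
    E-cong {suc n} h = avg-cong λ x → E-cong (λ v → h (x ∷ v))

    E-+ : (f g : Vec A n → ℚ) → E (λ v → f v + g v) ≡ E f + E g
    E-+ {zero}  f g = refl
    E-+ {suc n} f g = trans
      (cong (_* w) (trans (Σ-cong X (λ {x} _ → E-+ (λ v → f (x ∷ v)) (λ v → g (x ∷ v))))
        (Σ-+ X (λ x → E (λ v → f (x ∷ v))) (λ x → E (λ v → g (x ∷ v))))))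
      (ℚ.*-distribʳ-+ w (Σ X (λ x → E (λ v → f (x ∷ v)))) _)

    E-const : ∀ a → E {n} (λ _ → a) ≡ a
    E-const {zero}  a = refl
    E-const {suc n} a = trans (avg-cong (λ _ → E-const {n} a)) (avg-const a)

    E-Σ : ∀ {B : Set} (ys : List B) (f : B → Vec A n → ℚ) → E (λ v → Σ ys (λ y → f y v)) ≡ Σ ys (λ y → E (f y))
    E-Σ {n = n} []       f = E-const {n} 0ℚ
    E-Σ (y ∷ ys) f = trans (E-+ (f y) _) (cong (E (f y) +_) (E-Σ ys f))

    E-*ʳ : (f : Vec A n → ℚ) (a : ℚ) → E (λ v → f v * a) ≡ E f * a
    E-*ʳ {zero}  f a = refl
    E-*ʳ {suc n} f a = trans
      (cong (_* w) (trans (Σ-cong X (λ {x} _ → E-*ʳ (λ v → f (x ∷ v)) a)) (Σ-*ʳ X F a)))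
      (solve 3 (λ b a w → b :* a :* w := b :* w :* a) refl (Σ X F) a w)
      where
      open +-*-Solver
      F : A → ℚ
      F x = E (λ v → f (x ∷ v))

    E-*ˡ : (a : ℚ) (f : Vec A n → ℚ) → E (λ v → a * f v) ≡ a * E f
    E-*ˡ a f = trans (E-cong λ v → ℚ.*-comm a (f v)) (trans (E-*ʳ f a) (ℚ.*-comm (E f) a))

    E-vectors : (f : Vec A n → ℚ) → E f ≡ Σ (vectors X n) f * (w ^ℚ n)
    E-vectors {zero}  f = trans (sym (ℚ.+-identityʳ (f []))) (sym (ℚ.*-identityʳ _))
    E-vectors {suc n} f = trans
      (cong (_* w) (trans (Σ-cong X (λ {x} _ → E-vectors (λ v → f (x ∷ v)))) (Σ-*ʳ X g (w ^ℚ n))))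
      (trans (solve 3 (λ a b c → a :* b :* c := a :* (c :* b)) refl (Σ X g) (w ^ℚ n) w)
        (cong (_* (w ^ℚ suc n)) (sym (Σ-cartesianProductWith _∷_ X (vectors X n) f))))
      where
      open +-*-Solver
      g : A → ℚ
      g x = Σ (vectors X n) (λ v → f (x ∷ v))

    AgreeOn : Subset n → Vec A n → Vec A n → Set
    AgreeOn K v v′ = ∀ {x} → x ∈ K → lookup v x ≡ lookup v′ x

    DependsOn : Subset n → (Vec A n → ℚ) → Set
    DependsOn K f = ∀ v v′ → AgreeOn K v v′ → f v ≡ f v′

    private
      -- Once the head is fixed the expectations factor, and the factor of `g` is `E g` whatever the
      -- head is, so it leaves the outer average.
      E-indep-head : (f g : Vec A (suc n) → ℚ) → (∀ x y v → g (x ∷ v) ≡ g (y ∷ v)) →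
        (∀ x → E (λ v → f (x ∷ v) * g (x ∷ v)) ≡ E (λ v → f (x ∷ v)) * E (λ v → g (x ∷ v))) →
        E (λ v → f v * g v) ≡ E f * E g
      E-indep-head f g same h = trans
        (avg-cong λ x → trans (h x) (cong (E (λ v → f (x ∷ v)) *_) (sym
          (trans (avg-cong λ y → E-cong (same y x)) (avg-const _)))))
        (trans (cong (_* w) (Σ-*ʳ X F (E g)))
          (solve 3 (λ a b c → a :* b :* c := a :* c :* b) refl (Σ X F) (E g) w))
        where
        open +-*-Solver
        F : A → ℚ
        F x = E (λ v → f (x ∷ v))

      dependsOn-tail : ∀ b {K : Subset n} {f : Vec A (suc n) → ℚ} x → DependsOn (b ∷ K) f → DependsOn K (λ v → f (x ∷ v))
      dependsOn-tail b {K} x h v v′ agree = h (x ∷ v) (x ∷ v′) λ { here → refl ; (there y∈) → agree y∈ }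

      dependsOn-outside : {K : Subset n} {f : Vec A (suc n) → ℚ} → DependsOn (outside ∷ K) f →
        ∀ x y v → f (x ∷ v) ≡ f (y ∷ v)
      dependsOn-outside h x y v = h (x ∷ v) (y ∷ v) λ { (there _) → refl }

    -- Each coordinate is read by at most one of `f` and `g`; the two cases differ only in which of
    -- them ignores the head.
    E-indep : (K : Subset n) {f g : Vec A n → ℚ} → DependsOn K f → DependsOn (∁ K) g →
      E (λ v → f v * g v) ≡ E f * E g
    E-indep []            hf hg = refl
    E-indep (inside ∷ K)  {f} {g} hf hg = E-indep-head f g (dependsOn-outside {f = g} hg)
      λ x → E-indep K (dependsOn-tail inside {f = f} x hf) (dependsOn-tail outside {f = g} x hg)
    E-indep (outside ∷ K) {f} {g} hf hg = trans (E-cong λ v → ℚ.*-comm (f v) (g v))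
      (trans (E-indep-head g f (dependsOn-outside {f = f} hf) λ x →
          trans (E-cong λ v → ℚ.*-comm (g (x ∷ v)) (f (x ∷ v)))
          (trans (E-indep K (dependsOn-tail outside {f = f} x hf) (dependsOn-tail inside {f = g} x hg))
            (ℚ.*-comm (E (λ v → f (x ∷ v))) _)))
        (ℚ.*-comm (E g) (E f)))

    AllOn : Subset n → Pred A 0ℓ → Vec A n → Set
    AllOn W P v = ∀ x → x ∈ W → P (lookup v x)

    allOn? : (W : Subset n) {P : Pred A 0ℓ} → Decidable₁ P → ∀ v → Dec (AllOn W P v)
    allOn? W P? v = Fin.all? λ x → (x ∈? W) →-dec P? (lookup v x)

    E-allOn : (W : Subset n) {P : Pred A 0ℓ} (P? : Decidable₁ P) →
      E (λ v → 𝟙 (allOn? W P? v)) ≡ avg (λ x → 𝟙 (P? x)) ^ℚ ∣ W ∣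
    E-allOn []            P? = 𝟙-yes (allOn? [] P? []) λ ()
    E-allOn (outside ∷ W) P? = trans
      (avg-cong λ x → trans
        (E-cong λ v → 𝟙-cong (allOn? (outside ∷ W) P? (x ∷ v)) (allOn? W P? v)
          (λ h y y∈ → h (suc y) (there y∈)) (λ { h (suc y) (there y∈) → h y y∈ }))
        (E-allOn W P?))
      (avg-const _)
    E-allOn (inside ∷ W) {P} P? = trans
      (avg-cong λ x → trans
        (E-cong λ v → 𝟙-× (P? x) (allOn? W P? v) (allOn? (inside ∷ W) P? (x ∷ v))
          (λ { p h zero here → p ; p h (suc y) (there y∈) → h y y∈ })
          (λ h → h zero here , λ y y∈ → h (suc y) (there y∈)))
        (trans (E-*ˡ (𝟙 (P? x)) (λ v → 𝟙 (allOn? W P? v))) (cong (𝟙 (P? x) *_) (E-allOn W P?))))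
      (trans (cong (_* w) (Σ-*ʳ X F z))
        (solve 3 (λ a b c → a :* b :* c := a :* c :* b) refl (Σ X F) z w))
      where
      open +-*-Solver
      F : A → ℚ
      F x = 𝟙 (P? x)
      z : ℚ
      z = avg F ^ℚ ∣ W ∣

-- Probability that no set of a family is monochromatic.

module MonochromaticSets where

  open FiniteSets using (Nonempty⇒0<∣p∣)
  open Expectations
  open import Data.Nat.Base as ℕ using (ℕ; zero; suc)
  open import Data.Rational.Base using (ℚ; 0ℚ; 1ℚ; _+_; _-_; _*_; -_; _≤_; _<_)
  open import Data.Rational.Solver using (module +-*-Solver)
  open import Data.Fin.Subset using (Subset; _∈_; _⊆_; ∣_∣; ∁; _∩_; _∪_; Nonempty)
  open import Data.Fin.Subset.Properties using (x∉p⇒x∈∁p; x∈p∩q⁺; x∈p∩q⁻; x∈p∪q⁻; x∈p∪q⁺; nonempty?)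
  open import Data.Empty using (⊥; ⊥-elim)

  meets? : {n : ℕ} (K K′ : Subset n) → Dec (Nonempty (K ∩ K′))
  meets? K K′ = nonempty? (K ∩ K′)

  -- Each set is compared only with those after it, matching the addition of sets one at a time at
  -- the head.
  data FewMeet {n : ℕ} (C : ℕ) : List (Subset n) → Set where
    []   : FewMeet C []
    cons : ∀ {K Ks} → length (filter (meets? K) Ks) ℕ.≤ C → All (K ≢_) Ks → FewMeet C Ks → FewMeet C (K ∷ Ks)

  module Poisson {A : Set} (_≟_ : DecidableEquality A) (X : List A) (X-unique : Unique X)
    (0<∣X∣ : 0 ℕ.< length X) where

    0<N : 0ℚ < fromℕ (length X)
    0<N = ℚ.<-≤-trans 0<1 (fromℕ-mono {1} 0<∣X∣)

    open Expectation X 0<N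

    w≤1 : w ≤ 1ℚ
    w≤1 = ℚ.≤-trans (recip-anti 0<1 (fromℕ-mono {1} 0<∣X∣)) (ℚ.≤-reflexive (recip-unique 0<1 (ℚ.*-identityʳ 1ℚ)))

    private
      variable
        n : ℕ

    Mono : Subset n → Vec A n → Set
    Mono K v = Any (λ a → AllOn K (_≡ a) v) X

    mono? : (K : Subset n) → ∀ v → Dec (Mono K v)
    mono? K v = Any.any? (λ a → allOn? K (_≟ a) v) X

    avg-≡ : ∀ {a} → a List.∈ X → avg (λ x → 𝟙 (x ≟ a)) ≡ w
    avg-≡ {a} a∈X = trans (cong (_* w) (trans
        (𝟙-any-exclusive (_≟ a) X X-unique (λ x≡a y≡a → trans x≡a (sym y≡a)))
        (𝟙-yes (Any.any? (_≟ a) X) (Any.map sym a∈X))))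
      (ℚ.*-identityˡ w)

    private
      -- There are `N` candidates for the common list, each with probability `w ^ ∣K∣`, and
      -- `N w = 1`.
      E-Σ-allOn : (K : Subset n) → ∣ K ∣ ≢ 0 →
        E (λ v → Σ X (λ a → 𝟙 (allOn? K (_≟ a) v))) ≡ w ^ℚ ℕ.pred ∣ K ∣
      E-Σ-allOn K K≢∅ = trans (E-Σ X (λ a v → 𝟙 (allOn? K (_≟ a) v)))
        (trans (Σ-cong X λ {a} a∈ → trans (E-allOn K (_≟ a)) (cong (_^ℚ ∣ K ∣) (avg-≡ a∈)))
          (trans (Σ-const X (w ^ℚ ∣ K ∣)) (lower ∣ K ∣ K≢∅)))
        where
        lower : ∀ m → m ≢ 0 → N * w ^ℚ m ≡ w ^ℚ ℕ.pred m
        lower zero    m≢0 = ⊥-elim (m≢0 refl)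
        lower (suc m) _   = trans (sym (ℚ.*-assoc N w (w ^ℚ m)))
          (trans (cong (_* w ^ℚ m) (*-recip 0<N)) (ℚ.*-identityˡ (w ^ℚ m)))

    E-mono-≤ : (K : Subset n) → ∣ K ∣ ≢ 0 → E (λ v → 𝟙 (mono? K v)) ≤ w ^ℚ ℕ.pred ∣ K ∣
    E-mono-≤ K K≢∅ = ℚ.≤-trans (E-mono λ v _ → 𝟙-any (λ a → allOn? K (_≟ a) v) X)
      (ℚ.≤-reflexive (E-Σ-allOn K K≢∅))

    -- On a nonempty set the common list is unique, so the union bound behind `E-mono-≤` is an
    -- equality.
    E-mono-≡ : (K : Subset n) → Nonempty K → E (λ v → 𝟙 (mono? K v)) ≡ w ^ℚ ℕ.pred ∣ K ∣
    E-mono-≡ K (x , x∈K) = trans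
      (E-cong λ v → sym (𝟙-any-exclusive (λ a → allOn? K (_≟ a) v) X X-unique
        λ ha hb → trans (sym (ha x x∈K)) (hb x x∈K)))
      (E-Σ-allOn K λ ∣K∣≡0 → ℕ.<-irrefl (sym ∣K∣≡0) (Nonempty⇒0<∣p∣ (x , x∈K)))

    -- A common vertex forces the two common lists to agree.
    Mono-∪ : (K K′ : Subset n) → Nonempty (K ∩ K′) → ∀ v → Mono K v → Mono K′ v → Mono (K ∪ K′) v
    Mono-∪ K K′ (z , z∈) v m m′ with List.find m | List.find m′
    ... | a , a∈X , h | b , _ , h′ = List.lose a∈X λ x x∈ →
      [ h x , (λ x∈K′ → trans (h′ x x∈K′) b≡a) ]′ (x∈p∪q⁻ K K′ x∈)
      where
      b≡a : b ≡ a
      b≡a = let z∈K , z∈K′ = x∈p∩q⁻ K K′ z∈ in trans (sym (h′ z z∈K′)) (h z z∈K)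

    Alive : List (Subset n) → Vec A n → Set
    Alive Ks v = All (λ K → ¬ Mono K v) Ks

    alive? : (Ks : List (Subset n)) → ∀ v → Dec (Alive Ks v)
    alive? Ks v = All.all? (λ K → ¬? (mono? K v)) Ks

    Mono-agree : {K S : Subset n} → K ⊆ S → ∀ v v′ → AgreeOn S v v′ → Mono K v → Mono K v′
    Mono-agree K⊆S v v′ agree = Any.map λ h x x∈K → trans (sym (agree (K⊆S x∈K))) (h x x∈K)

    AgreeOn-sym : {S : Subset n} (v v′ : Vec A n) → AgreeOn S v v′ → AgreeOn S v′ v
    AgreeOn-sym v v′ agree x∈ = sym (agree x∈)

    mono-dependsOn : (K : Subset n) → DependsOn K (λ v → 𝟙 (mono? K v))
    mono-dependsOn K v v′ agree = 𝟙-cong (mono? K v) (mono? K v′)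
      (Mono-agree id v v′ agree) (Mono-agree id v′ v (AgreeOn-sym v v′ agree))

    disjoint-⊆∁ : (K K′ : Subset n) → ¬ Nonempty (K ∩ K′) → K′ ⊆ ∁ K
    disjoint-⊆∁ K K′ disj x∈K′ = x∉p⇒x∈∁p λ x∈K → disj (_ , x∈p∩q⁺ (x∈K , x∈K′))

    alive-dependsOn : (K : Subset n) (D : List (Subset n)) → All (λ K′ → ¬ Nonempty (K ∩ K′)) D →
      DependsOn (∁ K) (λ v → 𝟙 (alive? D v))
    alive-dependsOn K D disj v v′ agree = 𝟙-cong (alive? D v) (alive? D v′) (transfer v v′ agree) (transfer v′ v (AgreeOn-sym v v′ agree))
      where
      transfer : ∀ v v′ → AgreeOn (∁ K) v v′ → Alive D v → Alive D v′
      transfer v v′ agree al = All.zipWith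
        (λ {K′} (d , ¬m) m → ¬m (Mono-agree (disjoint-⊆∁ K K′ d) v′ v (AgreeOn-sym v v′ agree) m)) (disj , al)

    module _ {n : ℕ} (c C : ℕ) (0<c : 0 ℕ.< c) where

      q : ℚ
      q = w ^ℚ c

      0≤q : 0ℚ ≤ q
      0≤q = ^-nonNeg c 0≤w

      q≤w : q ≤ w
      q≤w = ℚ.≤-trans (^-anti 0≤w w≤1 0<c) (ℚ.≤-reflexive (ℚ.*-identityʳ w))

      q≤1 : q ≤ 1ℚ
      q≤1 = ℚ.≤-trans q≤w w≤1

      error : ℚ
      error = fromℕ C * w ^ℚ suc c

      -- The sets disjoint from K are independent of it. The at most C others change
      -- the probability of survival by C q, and C w^(c+1) bounds the probability that
      -- one of them is monochromatic together with K.
      module Step (K : Subset n) (Ks : List (Subset n)) (∣K∣ : ∣ K ∣ ≡ suc c)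
        (∣Ks∣ : All (λ K′ → ∣ K′ ∣ ≡ suc c) Ks) (K∉Ks : All (K ≢_) Ks)
        (few : length (filter (meets? K) Ks) ℕ.≤ C)
        where

        M D : List (Subset n)
        M = filter (meets? K) Ks
        D = filter (λ K′ → ¬? (meets? K K′)) Ks

        f gD gK : Vec A n → ℚ
        f v = 𝟙 (mono? K v)
        gD v = 𝟙 (alive? D v)
        gK v = 𝟙 (alive? Ks v)

        -- `a` is the survival probability before `K` is added, and `b` is what adding `K` takes
        -- away from it.
        a b : ℚ
        a = E gK
        b = E (λ v → f v * gK v)

        Ef≡q : E f ≡ q
        Ef≡q = trans (E-mono-≡ K (FiniteSets.0<∣p∣⇒Nonempty K (subst (0 ℕ.<_) (sym ∣K∣) (ℕ.s≤s ℕ.z≤n))))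
          (cong (λ m → w ^ℚ ℕ.pred m) ∣K∣)

        T≡ : E (λ v → f v * gD v) ≡ q * E gD
        T≡ = trans (E-indep K (mono-dependsOn K)
            (alive-dependsOn K D (All.all-filter (λ K′ → ¬? (meets? K K′)) Ks)))
          (cong (_* E gD) Ef≡q)

        gK≤gD : ∀ v → gK v ≤ gD v
        gK≤gD v = 𝟙-mono (alive? Ks v) (alive? D v) (All.filter⁺ (λ K′ → ¬? (meets? K K′)))

        -- If the disjoint sets survive but `Ks` does not, one of the sets meeting `K` is
        -- monochromatic.
        gD≤ : ∀ v → gD v ≤ gK v + Σ M (λ K′ → 𝟙 (mono? K′ v))
        gD≤ v = ℚ.≤-trans (split (Any.any? (λ K′ → mono? K′ v) M))
          (ℚ.+-monoʳ-≤ (gK v) (𝟙-any (λ K′ → mono? K′ v) M))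
          where
          split : (d : Dec (Any (λ K′ → Mono K′ v) M)) → gD v ≤ gK v + 𝟙 d
          split (yes _) = ℚ.≤-trans (𝟙≤1 (alive? D v))
            (subst (_≤ gK v + 1ℚ) (ℚ.+-identityˡ 1ℚ) (ℚ.+-monoˡ-≤ 1ℚ (0≤𝟙 (alive? Ks v))))
          split (no none) = subst (gD v ≤_) (sym (ℚ.+-identityʳ (gK v))) (𝟙-mono (alive? D v) (alive? Ks v)
            λ al → All.tabulate λ {K′} K′∈ m → decide al K′∈ m (meets? K K′))
            where
            decide : Alive D v → ∀ {K′} → K′ List.∈ Ks → Mono K′ v → Dec (Nonempty (K ∩ K′)) → ⊥
            decide al K′∈ m (yes meet) = none (List.lose (List.∈-filter⁺ (meets? K) K′∈ meet) m)
            decide al K′∈ m (no disj) = All.lookup al (List.∈-filter⁺ (λ K′ → ¬? (meets? K K′)) K′∈ disj) m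

        -- Two distinct sets of size c + 1 have a union of size at least c + 2, hence the exponent c
        -- + 1.
        E-union≤ : ∀ {K′} → K′ List.∈ M → E (λ v → 𝟙 (mono? (K ∪ K′) v)) ≤ w ^ℚ suc c
        E-union≤ {K′} K′∈M = ℚ.≤-trans (E-mono-≤ (K ∪ K′) λ ≡0 → contra ≡0 big)
          (^-anti 0≤w w≤1 (ℕ.pred-mono-≤ big))
          where
          contra : ∀ {m} → m ≡ 0 → suc (suc c) ℕ.≤ m → ⊥
          contra refl ()
          K′∈Ks = proj₁ (List.∈-filter⁻ (meets? K) {xs = Ks} K′∈M)
          big : suc (suc c) ℕ.≤ ∣ K ∪ K′ ∣
          big = ℕ.≰⇒> λ le → All.lookup K∉Ks K′∈Ks (trans
            (FiniteSets.⊆∧∣∣≥⇒≡ (x∈p∪q⁺ ∘ inj₁) (ℕ.≤-trans le (ℕ.≤-reflexive (sym ∣K∣))))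
            (sym (FiniteSets.⊆∧∣∣≥⇒≡ (x∈p∪q⁺ ∘ inj₂) (ℕ.≤-trans le (ℕ.≤-reflexive (sym (All.lookup ∣Ks∣ K′∈Ks)))))))

        E-mono-M : ∀ {K′} → K′ List.∈ M → E (λ v → 𝟙 (mono? K′ v)) ≤ q
        E-mono-M {K′} K′∈M = ℚ.≤-trans (E-mono-≤ K′ λ ≡0 → ℕ.0≢1+n (trans (sym ≡0) ∣K′∣))
          (ℚ.≤-reflexive (cong (λ m → w ^ℚ ℕ.pred m) ∣K′∣))
          where
          ∣K′∣ = All.lookup ∣Ks∣ (proj₁ (List.∈-filter⁻ (meets? K) {xs = Ks} K′∈M))

        ΣM≤ : {h : Subset n → ℚ} (z : ℚ) → 0ℚ ≤ z → (∀ {K′} → K′ List.∈ M → h K′ ≤ z) → Σ M h ≤ fromℕ C * z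
        ΣM≤ z 0≤z h≤ = ℚ.≤-trans (Σ-bound M z h≤) (*-monoʳ 0≤z (fromℕ-mono few))

        EgD≤ : E gD ≤ a + fromℕ C * q
        EgD≤ = begin
          E gD ≤⟨ E-mono (λ v _ → gD≤ v) ⟩
          E (λ v → gK v + Σ M (λ K′ → 𝟙 (mono? K′ v))) ≡⟨ E-+ gK _ ⟩
          a + E (λ v → Σ M (λ K′ → 𝟙 (mono? K′ v))) ≡⟨ cong (a +_) (E-Σ M (λ K′ v → 𝟙 (mono? K′ v))) ⟩
          a + Σ M (λ K′ → E (λ v → 𝟙 (mono? K′ v))) ≤⟨ ℚ.+-monoʳ-≤ a (ΣM≤ q 0≤q E-mono-M) ⟩
          a + fromℕ C * q ∎
          where open ℚ.≤-Reasoning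

        -- Forgetting the sets that meet `K` enlarges the event and makes it independent of `K`. The
        -- price C q² is within `error` because `q ≤ w`.
        upper : b ≤ q * a + error
        upper = begin
          b ≤⟨ E-mono (λ v _ → *-monoˡ (0≤𝟙 (mono? K v)) (gK≤gD v)) ⟩
          E (λ v → f v * gD v) ≡⟨ T≡ ⟩
          q * E gD ≤⟨ *-monoˡ 0≤q EgD≤ ⟩
          q * (a + fromℕ C * q) ≡⟨ solve 3 (λ q a z → q :* (a :+ z :* q) := q :* a :+ z :* (q :* q)) refl q a (fromℕ C) ⟩
          q * a + fromℕ C * (q * q) ≤⟨ ℚ.+-monoʳ-≤ (q * a) (*-monoˡ (0≤fromℕ C) (*-monoʳ 0≤q q≤w)) ⟩
          q * a + error ∎
          where
          open ℚ.≤-Reasoning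
          open +-*-Solver

        f*gD≤ : ∀ v → f v * gD v ≤ f v * gK v + Σ M (λ K′ → 𝟙 (mono? (K ∪ K′) v))
        f*gD≤ v = begin
          f v * gD v ≤⟨ *-monoˡ (0≤𝟙 (mono? K v)) (gD≤ v) ⟩
          f v * (gK v + Σ M h) ≡⟨ ℚ.*-distribˡ-+ (f v) (gK v) (Σ M h) ⟩
          f v * gK v + f v * Σ M h ≡⟨ cong (f v * gK v +_) (trans (ℚ.*-comm (f v) (Σ M h)) (sym (Σ-*ʳ M h (f v)))) ⟩
          f v * gK v + Σ M (λ K′ → h K′ * f v) ≤⟨ ℚ.+-monoʳ-≤ (f v * gK v) (Σ-mono M λ {K′} K′∈ →
              𝟙-×ˡ (mono? K′ v) (mono? K v) (mono? (K ∪ K′) v) λ m′ m →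
              Mono-∪ K K′ (proj₂ (List.∈-filter⁻ (meets? K) {xs = Ks} K′∈)) v m m′) ⟩
          f v * gK v + Σ M (λ K′ → 𝟙 (mono? (K ∪ K′) v)) ∎
          where
          open ℚ.≤-Reasoning
          h : Subset n → ℚ
          h K′ = 𝟙 (mono? K′ v)

        -- The independent event exceeds the true one only where `K` and a set meeting it are both
        -- monochromatic, so their union is.
        lower : q * a ≤ b + error
        lower = begin
          q * a ≤⟨ *-monoˡ 0≤q (E-mono λ v _ → gK≤gD v) ⟩
          q * E gD ≡⟨ T≡ ⟨
          E (λ v → f v * gD v) ≤⟨ E-mono (λ v _ → f*gD≤ v) ⟩
          E (λ v → f v * gK v + Σ M (λ K′ → 𝟙 (mono? (K ∪ K′) v))) ≡⟨ E-+ (λ v → f v * gK v) _ ⟩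
          b + E (λ v → Σ M (λ K′ → 𝟙 (mono? (K ∪ K′) v))) ≡⟨ cong (b +_) (E-Σ M (λ K′ v → 𝟙 (mono? (K ∪ K′) v))) ⟩
          b + Σ M (λ K′ → E (λ v → 𝟙 (mono? (K ∪ K′) v))) ≤⟨ ℚ.+-monoʳ-≤ b (ΣM≤ (w ^ℚ suc c) (^-nonNeg (suc c) 0≤w) E-union≤) ⟩
          b + error ∎
          where open ℚ.≤-Reasoning

        E-alive-∷ : E (λ v → 𝟙 (alive? (K ∷ Ks) v)) + b ≡ a
        E-alive-∷ = trans (sym (E-+ (λ v → 𝟙 (alive? (K ∷ Ks) v)) (λ v → f v * gK v))) (E-cong pointwise)
          where
          pointwise : ∀ v → 𝟙 (alive? (K ∷ Ks) v) + f v * gK v ≡ gK v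
          pointwise v with mono? K v
          ... | yes m = trans (ℚ.+-identityˡ _) (ℚ.*-identityˡ (gK v))
          ... | no ¬m = trans (cong (𝟙 (alive? Ks v) +_) (ℚ.*-zeroˡ (gK v))) (ℚ.+-identityʳ _)

        -- The new survival probability is a - b, and b differs from q a by at most `error`. As 0 ≤
        -- 1 - q ≤ 1, the earlier error `d` is not amplified, so errors merely add.
        step : ∀ z d → ℚ.∣ a - z ∣ ≤ d → ℚ.∣ E (λ v → 𝟙 (alive? (K ∷ Ks) v)) - (1ℚ - q) * z ∣ ≤ error + d
        step z d h = begin
          ℚ.∣ a′ - (1ℚ - q) * z ∣ ≡⟨ cong ℚ.∣_∣ (trans
              (solve 5 (λ a′ b a z q → a′ :- (con 1ℚ :- q) :* z
                := (q :* a :- b) :+ (con 1ℚ :- q) :* (a :- z) :+ ((a′ :+ b) :- a)) refl a′ b a z q)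
              (trans (cong ((q * a - b) + (1ℚ - q) * (a - z) +_) (trans (cong (_- a) E-alive-∷) (ℚ.+-inverseʳ a)))
                (ℚ.+-identityʳ _))) ⟩
          ℚ.∣ (q * a - b) + (1ℚ - q) * (a - z) ∣ ≤⟨ ∣+∣-≤ (∣∣-≤
              (shift q*a b error lower)
              (subst (_≤ error) (solve 2 (λ x y → y :- x := :- (x :- y)) refl q*a b) (shift b q*a error upper)))
              (∣*∣-≤ (ℚ.≤-trans (∣∣≤-nonNeg 0≤1-q) 1-q≤1) h) ⟩
          error + 1ℚ * d ≡⟨ cong (error +_) (ℚ.*-identityˡ d) ⟩
          error + d ∎
          where
          open ℚ.≤-Reasoning
          open +-*-Solver
          a′ = E (λ v → 𝟙 (alive? (K ∷ Ks) v))
          q*a = q * a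
          shift : ∀ x y e → x ≤ y + e → x - y ≤ e
          shift x y e le = subst (x - y ≤_) (solve 2 (λ y e → y :+ e :- y := e) refl y e) (ℚ.+-monoˡ-≤ (- y) le)
          0≤1-q : 0ℚ ≤ 1ℚ - q
          0≤1-q = subst (_≤ 1ℚ - q) (ℚ.+-inverseʳ q) (ℚ.+-monoˡ-≤ (- q) q≤1)
          1-q≤1 : 1ℚ - q ≤ 1ℚ
          1-q≤1 = subst (1ℚ - q ≤_) (ℚ.+-identityʳ 1ℚ) (ℚ.+-monoʳ-≤ 1ℚ (ℚ.neg-antimono-≤ 0≤q))

      poisson : (Ks : List (Subset n)) → All (λ K → ∣ K ∣ ≡ suc c) Ks → FewMeet C Ks →
        ℚ.∣ E (λ v → 𝟙 (alive? Ks v)) - (1ℚ - q) ^ℚ length Ks ∣ ≤ fromℕ (length Ks) * error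
      poisson [] [] [] = ℚ.≤-reflexive (trans
        (cong ℚ.∣_∣ (trans (cong (_- 1ℚ) (E-const {n} 1ℚ)) (ℚ.+-inverseʳ 1ℚ))) (sym (ℚ.*-zeroˡ error)))
      poisson (K ∷ Ks) (∣K∣ ∷ ∣Ks∣) (cons few K∉Ks fm) = ℚ.≤-trans
        (Step.step K Ks ∣K∣ ∣Ks∣ K∉Ks few ((1ℚ - q) ^ℚ length Ks) _ (poisson Ks ∣Ks∣ fm))
        (ℚ.≤-reflexive (trans (solve 2 (λ e l → e :+ l :* e := (con 1ℚ :+ l) :* e) refl error (fromℕ (length Ks)))
          (cong (_* error) (sym (fromℕ-suc (length Ks))))))
        where open +-*-Solver

-- Counting subsets, and the probability of a dense window.

module SubsetCounting where

  open FiniteSets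
  open Expectations
  open import Data.Nat.Base as ℕ using (ℕ; zero; suc; _!; _∸_)
  open import Data.Nat.Combinatorics using (_C_; nCk+nC[k+1]≡[n+1]C[k+1])
  open import Data.Rational.Base using (ℚ; 0ℚ; 1ℚ; _+_; _*_; _≤_; _<_)
  open import Data.Rational.Solver using (module +-*-Solver)
  open import Data.Fin.Subset using (Subset; _∈_; ∣_∣; inside; outside)
  open import Data.Fin.Subset.Properties using (_⊆?_; drop-∷-⊆; out⊆; in⊆in)

  private
    variable
      n s : ℕ

  subsets : (n : ℕ) → List (Subset n)
  subsets n = vectors (inside ∷ outside ∷ []) n

  ∈-subsets : (p : Subset n) → p List.∈ subsets n
  ∈-subsets []            = here refl
  ∈-subsets (inside ∷ p)  = List.∈-cartesianProductWith⁺ _∷_ {xs = inside ∷ outside ∷ []} {ys = subsets _} (here refl) (∈-subsets p)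
  ∈-subsets (outside ∷ p) = List.∈-cartesianProductWith⁺ _∷_ {xs = inside ∷ outside ∷ []} {ys = subsets _} (there (here refl)) (∈-subsets p)

  subsets-unique : ∀ n → Unique (subsets n)
  subsets-unique zero    = [] ∷ []
  subsets-unique (suc n) = Unique.cartesianProductWith⁺ _∷_ Vec.∷-injective
    (((λ ()) ∷ []) ∷ [] ∷ []) (subsets-unique n)

  Σ-subsets : ∀ n (f : Subset (suc n) → ℚ) →
    Σ (subsets (suc n)) f ≡ Σ (subsets n) (λ p → f (inside ∷ p)) + Σ (subsets n) (λ p → f (outside ∷ p))
  Σ-subsets n f = trans (Σ-cartesianProductWith _∷_ (inside ∷ outside ∷ []) (subsets n) f)
    (cong (Σ (subsets n) (λ p → f (inside ∷ p)) +_) (ℚ.+-identityʳ _))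

  Σ-subsets-zero : {P : Pred (Subset n) 0ℓ} (P? : Decidable₁ P) → (∀ p → ¬ P p) → Σ (subsets n) (λ p → 𝟙 (P? p)) ≡ 0ℚ
  Σ-subsets-zero {n} P? ¬P = Σ-𝟙-zero P? (subsets n) (All.tabulate λ {p} _ → ¬P p)

  Σ-𝟙-cong : {A : Set} {P Q : Pred A 0ℓ} (xs : List A) (P? : Decidable₁ P) (Q? : Decidable₁ Q) →
    (∀ {x} → P x → Q x) → (∀ {x} → Q x → P x) → Σ xs (λ x → 𝟙 (P? x)) ≡ Σ xs (λ x → 𝟙 (Q? x))
  Σ-𝟙-cong xs P? Q? f g = Σ-cong xs λ {x} _ → 𝟙-cong (P? x) (Q? x) f g

  Σ-𝟙-mono : {A : Set} {P Q : Pred A 0ℓ} (xs : List A) (P? : Decidable₁ P) (Q? : Decidable₁ Q) →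
    (∀ {x} → P x → Q x) → Σ xs (λ x → 𝟙 (P? x)) ≤ Σ xs (λ x → 𝟙 (Q? x))
  Σ-𝟙-mono xs P? Q? f = Σ-mono xs λ {x} _ → 𝟙-mono (P? x) (Q? x) f

  Σ-filter-≤ : {A : Set} {P : Pred A 0ℓ} (P? : Decidable₁ P) (xs : List A) {f : A → ℚ} → (∀ x → 0ℚ ≤ f x) →
    Σ (filter P? xs) f ≤ Σ xs f
  Σ-filter-≤ P? [] h = ℚ.≤-refl
  Σ-filter-≤ P? (x ∷ xs) {f} h with P? x
  ... | yes _ = ℚ.+-monoʳ-≤ (f x) (Σ-filter-≤ P? xs h)
  ... | no _  = ℚ.≤-trans (Σ-filter-≤ P? xs h)
    (subst (_≤ f x + Σ xs f) (ℚ.+-identityˡ (Σ xs f)) (ℚ.+-monoˡ-≤ (Σ xs f) (h x)))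

  count-size : ∀ c s → Σ (subsets s) (λ p → 𝟙 (∣ p ∣ ℕ.≟ c)) ≡ fromℕ (s C c)
  count-size zero    zero    = refl
  count-size (suc c) zero    = refl
  count-size zero    (suc s) = trans (Σ-subsets s (λ p → 𝟙 (∣ p ∣ ℕ.≟ 0)))
    (trans (cong₂ _+_ (Σ-subsets-zero {s} (λ p → suc ∣ p ∣ ℕ.≟ 0) (λ _ ())) (count-size zero s)) (ℚ.+-identityˡ _))
  count-size (suc c) (suc s) = trans (Σ-subsets s (λ p → 𝟙 (∣ p ∣ ℕ.≟ suc c)))
    (trans (cong₂ _+_
        (trans (Σ-𝟙-cong (subsets s) (λ p → suc ∣ p ∣ ℕ.≟ suc c) (λ p → ∣ p ∣ ℕ.≟ c) ℕ.suc-injective (cong suc)) (count-size c s))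
        (count-size (suc c) s))
      (trans (sym (fromℕ-+-homo (s C c) (s C suc c))) (cong fromℕ (nCk+nC[k+1]≡[n+1]C[k+1] s c))))

  ∣subsetsOfSize∣ : ∀ c s → fromℕ (length (subsetsOfSize c s)) ≡ fromℕ (s C c)
  ∣subsetsOfSize∣ c s = trans (sym (Σ-filter (λ p → ∣ p ∣ ℕ.≟ c) (subsets s))) (count-size c s)

  subsetsOfSize-unique : ∀ c s → Unique (subsetsOfSize c s)
  subsetsOfSize-unique c s = Unique.filter⁺ (λ p → ∣ p ∣ ℕ.≟ c) (subsets-unique s)

  ∈-subsetsOfSize⁻ : ∀ {c s p} → p List.∈ subsetsOfSize c s → ∣ p ∣ ≡ c
  ∈-subsetsOfSize⁻ {c} {s} h = proj₂ (List.∈-filter⁻ (λ p → ∣ p ∣ ℕ.≟ c) {xs = subsets s} h)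

  absorption : ∀ s c → suc c ℕ.* (suc s C suc c) ≡ suc s ℕ.* (s C c)
  absorption zero zero = refl
  absorption zero (suc c) = ℕ.*-zeroʳ (suc (suc c))
  absorption (suc s) zero = begin
    1 ℕ.* (suc (suc s) C 1) ≡⟨ ℕ.*-identityˡ _ ⟩
    suc (suc s) C 1 ≡⟨ nCk+nC[k+1]≡[n+1]C[k+1] (suc s) 0 ⟨
    1 ℕ.+ (suc s C 1) ≡⟨ cong (1 ℕ.+_) (trans (sym (ℕ.*-identityˡ _)) (absorption s zero)) ⟩
    1 ℕ.+ suc s ℕ.* 1 ≡⟨⟩
    suc (suc s) ℕ.* 1 ∎
    where open ≡-Reasoning
  absorption (suc s) (suc c) = begin
    suc (suc c) ℕ.* (suc (suc s) C suc (suc c)) ≡⟨ cong (suc (suc c) ℕ.*_) (nCk+nC[k+1]≡[n+1]C[k+1] (suc s) (suc c)) ⟨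
    suc (suc c) ℕ.* (x ℕ.+ (suc s C suc (suc c))) ≡⟨ solve 3 (λ c x y → (con 2 :+ c) :* (x :+ y)
        := x :+ (con 1 :+ c) :* x :+ (con 2 :+ c) :* y) refl c x _ ⟩
    x ℕ.+ suc c ℕ.* x ℕ.+ suc (suc c) ℕ.* (suc s C suc (suc c)) ≡⟨ cong₂ (λ a b → x ℕ.+ a ℕ.+ b) (absorption s c) (absorption s (suc c)) ⟩
    x ℕ.+ suc s ℕ.* (s C c) ℕ.+ suc s ℕ.* (s C suc c) ≡⟨ solve 4 (λ x s a b → x :+ (con 1 :+ s) :* a :+ (con 1 :+ s) :* b
        := x :+ (con 1 :+ s) :* (a :+ b)) refl x s (s C c) (s C suc c) ⟩
    x ℕ.+ suc s ℕ.* ((s C c) ℕ.+ (s C suc c)) ≡⟨ cong (λ z → x ℕ.+ suc s ℕ.* z) (nCk+nC[k+1]≡[n+1]C[k+1] s c) ⟩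
    suc (suc s) ℕ.* x ∎
    where
    open ≡-Reasoning
    open ℕSolver.+-*-Solver
    x = suc s C suc c

  -- The recursion of the falling factorial s(s - 1)...(s - c + 1), which is what `c ! * (s C c)`
  -- denotes.
  falling : ∀ s c → suc c ! ℕ.* (suc s C suc c) ≡ suc s ℕ.* (c ! ℕ.* (s C c))
  falling s c = begin
    suc c ! ℕ.* (suc s C suc c) ≡⟨ solve 3 (λ a b x → a :* b :* x := b :* (a :* x)) refl (suc c) (c !) (suc s C suc c) ⟩
    c ! ℕ.* (suc c ℕ.* (suc s C suc c)) ≡⟨ cong (c ! ℕ.*_) (absorption s c) ⟩
    c ! ℕ.* (suc s ℕ.* (s C c)) ≡⟨ solve 3 (λ a b x → b :* (a :* x) := a :* (b :* x)) refl (suc s) (c !) (s C c) ⟩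
    suc s ℕ.* (c ! ℕ.* (s C c)) ∎
    where
    open ≡-Reasoning
    open ℕSolver.+-*-Solver

  falling-≤ : ∀ s c → c ! ℕ.* (s C c) ℕ.≤ s ℕ.^ c
  falling-≤ s       zero    = ℕ.≤-refl
  falling-≤ zero    (suc c) = ℕ.≤-reflexive (ℕ.*-zeroʳ (suc c !))
  falling-≤ (suc s) (suc c) = ℕ.≤-trans (ℕ.≤-reflexive (falling s c))
    (ℕ.*-monoʳ-≤ (suc s) (ℕ.≤-trans (falling-≤ s c) (ℕ.^-monoˡ-≤ c (ℕ.n≤1+n s))))

  falling-≥ : ∀ s c → (s ∸ c) ℕ.^ c ℕ.≤ c ! ℕ.* (s C c)
  falling-≥ s       zero    = ℕ.≤-refl
  falling-≥ zero    (suc c) = ℕ.z≤n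
  falling-≥ (suc s) (suc c) = ℕ.≤-trans
    (ℕ.*-mono-≤ (ℕ.≤-trans (ℕ.m∸n≤m s c) (ℕ.n≤1+n s)) (falling-≥ s c))
    (ℕ.≤-reflexive (sym (falling s c)))

  count-⊆ : (U : Subset s) → Σ (subsets s) (λ p → 𝟙 (p ⊆? U)) ≡ fromℕ 2 ^ℚ ∣ U ∣
  count-⊆ [] = refl
  count-⊆ {suc s} (inside ∷ U) = trans (Σ-subsets s (λ p → 𝟙 (p ⊆? (inside ∷ U))))
    (trans (cong₂ _+_
        (trans (Σ-𝟙-cong (subsets s) (λ p → (inside ∷ p) ⊆? (inside ∷ U)) (_⊆? U) drop-∷-⊆ in⊆in) (count-⊆ U))
        (trans (Σ-𝟙-cong (subsets s) (λ p → (outside ∷ p) ⊆? (inside ∷ U)) (_⊆? U) drop-∷-⊆ out⊆) (count-⊆ U)))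
      (solve 1 (λ x → x :+ x := con (fromℕ 2) :* x) refl (fromℕ 2 ^ℚ ∣ U ∣)))
    where open +-*-Solver
  count-⊆ {suc s} (outside ∷ U) = trans (Σ-subsets s (λ p → 𝟙 (p ⊆? (outside ∷ U))))
    (trans (cong₂ _+_
        (Σ-subsets-zero (λ p → (inside ∷ p) ⊆? (outside ∷ U)) (λ p h → inside∉ (h here)))
        (trans (Σ-𝟙-cong (subsets s) (λ p → (outside ∷ p) ⊆? (outside ∷ U)) (_⊆? U) drop-∷-⊆ out⊆) (count-⊆ U)))
      (ℚ.+-identityˡ _))
    where
    inside∉ : ¬ (zero ∈ (outside ∷ U))
    inside∉ ()

  -- Splitting on the first element reduces the bound to (s+1)^u + (s+1)^(u+1) = (s+2)(s+1)^u ≤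
  -- (s+2)^(u+1).
  count-small : ∀ u s → Σ (subsets s) (λ p → 𝟙 (∣ p ∣ ℕ.≤? u)) ≤ fromℕ (suc s ℕ.^ u)
  count-small u       zero    = ℚ.≤-trans (ℚ.≤-reflexive (cong (_+ 0ℚ) (𝟙-yes (0 ℕ.≤? u) ℕ.z≤n)))
    (fromℕ-mono {1} (ℕ.≤-reflexive (sym (ℕ.^-zeroˡ u))))
  count-small zero    (suc s) = ℚ.≤-trans (ℚ.≤-reflexive (trans (Σ-subsets s (λ p → 𝟙 (∣ p ∣ ℕ.≤? 0)))
    (trans (cong (_+ Σ (subsets s) (λ p → 𝟙 (∣ p ∣ ℕ.≤? 0))) (Σ-subsets-zero {s} (λ p → suc ∣ p ∣ ℕ.≤? 0) (λ _ ()))) (ℚ.+-identityˡ _)))) (count-small zero s)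
  count-small (suc u) (suc s) = begin
    Σ (subsets (suc s)) (λ p → 𝟙 (∣ p ∣ ℕ.≤? suc u)) ≡⟨ Σ-subsets s (λ p → 𝟙 (∣ p ∣ ℕ.≤? suc u)) ⟩
    Σ (subsets s) (λ p → 𝟙 (suc ∣ p ∣ ℕ.≤? suc u)) + Σ (subsets s) (λ p → 𝟙 (∣ p ∣ ℕ.≤? suc u))
      ≤⟨ ℚ.+-mono-≤ (Σ-𝟙-mono (subsets s) (λ p → suc ∣ p ∣ ℕ.≤? suc u) (λ p → ∣ p ∣ ℕ.≤? u) ℕ.s≤s⁻¹) ℚ.≤-refl ⟩
    Σ (subsets s) (λ p → 𝟙 (∣ p ∣ ℕ.≤? u)) + Σ (subsets s) (λ p → 𝟙 (∣ p ∣ ℕ.≤? suc u))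
      ≤⟨ ℚ.+-mono-≤ (count-small u s) (count-small (suc u) s) ⟩
    fromℕ (suc s ℕ.^ u) + fromℕ (suc s ℕ.^ suc u) ≡⟨ fromℕ-+-homo (suc s ℕ.^ u) (suc s ℕ.^ suc u) ⟨
    fromℕ (suc (suc s) ℕ.* suc s ℕ.^ u) ≤⟨ fromℕ-mono (ℕ.*-monoʳ-≤ (suc (suc s)) (ℕ.^-monoˡ-≤ u (ℕ.n≤1+n (suc s)))) ⟩
    fromℕ (suc (suc s) ℕ.^ suc u) ∎
    where open ℚ.≤-Reasoning

  private
    -- With `S σ = 1` and u + e = c d the product S^u σ^(c d) collapses to σ^e. In the remaining
    -- factor `u` and `d` may grow to `m` and `D`, since `b` and `B` are at least 1.
    dense-estimate : ∀ b B S σ w x {c d D e m u} → 1ℚ ≤ b → 1ℚ ≤ B → 0ℚ < σ → S * σ ≡ 1ℚ → 0ℚ ≤ w → w ≤ B * σ ^ℚ c →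
      x ≤ b ^ℚ u * S ^ℚ u → u ℕ.+ e ≡ c ℕ.* d → u ℕ.≤ m → d ℕ.≤ D →
      x * (b ^ℚ u * w) ^ℚ d ≤ b ^ℚ m * (b ^ℚ m * B) ^ℚ D * σ ^ℚ e
    dense-estimate b B S σ w x {c} {d} {D} {e} {m} {u} 1≤b 1≤B 0<σ Sσ≡1 0≤w w≤ x≤ u+e u≤m d≤D = begin
      x * (y * w) ^ℚ d ≤⟨ *-monoʳ (^-nonNeg d (*-nonNeg 0≤y 0≤w)) x≤ ⟩
      (y * S ^ℚ u) * (y * w) ^ℚ d ≤⟨ *-monoˡ (*-nonNeg 0≤y 0≤Sᵘ) (^-mono d (*-nonNeg 0≤y 0≤w) (*-monoˡ 0≤y w≤)) ⟩
      (y * S ^ℚ u) * (y * (B * σ ^ℚ c)) ^ℚ d ≡⟨ cong (λ z → (y * S ^ℚ u) * z)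
          (trans (cong (_^ℚ d) (sym (ℚ.*-assoc y B (σ ^ℚ c))))
          (trans (*-^ (y * B) (σ ^ℚ c) d) (cong ((y * B) ^ℚ d *_)
          (trans (^-^ σ c d) (trans (cong (σ ^ℚ_) (sym u+e)) (^-+ σ u e)))))) ⟩
      (y * S ^ℚ u) * (z * (σ ^ℚ u * σ ^ℚ e)) ≡⟨ solve 5 (λ t a b x y → (t :* a) :* (b :* (x :* y)) := t :* b :* y :* (a :* x)) refl
          y (S ^ℚ u) z (σ ^ℚ u) (σ ^ℚ e) ⟩
      y * z * σ ^ℚ e * (S ^ℚ u * σ ^ℚ u) ≡⟨ cong (y * z * σ ^ℚ e *_) Sᵘσᵘ ⟩
      y * z * σ ^ℚ e * 1ℚ ≡⟨ ℚ.*-identityʳ _ ⟩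
      y * z * σ ^ℚ e ≤⟨ *-monoʳ (^-nonNeg e (ℚ.<⇒≤ 0<σ)) (*-mono 0≤y 0≤bound y≤ z≤) ⟩
      b ^ℚ m * (b ^ℚ m * B) ^ℚ D * σ ^ℚ e ∎
      where
      open ℚ.≤-Reasoning
      open +-*-Solver
      y z : ℚ
      y = b ^ℚ u
      z = (y * B) ^ℚ d
      0≤b = ℚ.≤-trans 0≤1 1≤b
      0≤B = ℚ.≤-trans 0≤1 1≤B
      0≤y = ^-nonNeg u 0≤b
      0≤bound = ^-nonNeg D (*-nonNeg (^-nonNeg m 0≤b) 0≤B)
      Sᵘσᵘ : S ^ℚ u * σ ^ℚ u ≡ 1ℚ
      Sᵘσᵘ = trans (sym (*-^ S σ u)) (trans (cong (_^ℚ u) Sσ≡1) (1^ u))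
      y≤ : y ≤ b ^ℚ m
      y≤ = ^-mono-exp 1≤b u≤m
      1≤yB : 1ℚ ≤ y * B
      1≤yB = ℚ.≤-trans (ℚ.≤-reflexive (sym (ℚ.*-identityʳ 1ℚ))) (*-mono 0≤1 0≤B (1≤^ u 1≤b) 1≤B)
      z≤ : z ≤ (b ^ℚ m * B) ^ℚ D
      z≤ = ℚ.≤-trans (^-mono-exp 1≤yB d≤D) (^-mono D (*-nonNeg 0≤y 0≤B) (*-monoʳ 0≤B y≤))
      0≤S : 0ℚ ≤ S
      0≤S = ℚ.≮⇒≥ λ S<0 → ℚ.<-irrefl refl (ℚ.<-trans 0<1 (subst₂ _<_ Sσ≡1 (ℚ.*-zeroˡ σ) (ℚ.*-monoˡ-<-pos σ {{ℚ.positive 0<σ}} S<0)))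
      0≤Sᵘ = ^-nonNeg u 0≤S

  module Windows (c s : ℕ) (0<N : 0ℚ < fromℕ (length (subsetsOfSize c s))) where

    open Expectation (subsetsOfSize c s) 0<N

    -- All subsets of `U` are counted, not only those of size `c`; `U` has bounded size in the
    -- application, so only a constant is lost.
    avg-⊆ : (U : Subset s) → avg (λ A → 𝟙 (A ⊆? U)) ≤ fromℕ 2 ^ℚ ∣ U ∣ * w
    avg-⊆ U = *-monoʳ 0≤w (ℚ.≤-trans
      (Σ-filter-≤ (λ A → ∣ A ∣ ℕ.≟ c) (subsets s) (λ A → 0≤𝟙 (A ⊆? U)))
      (ℚ.≤-reflexive (count-⊆ U)))

    -- A union bound over the at most (s+1)^u sets `U` that can be the union; for a given `U` the
    -- lists on `W` fall into it independently.
    E-fewColours : (W : Subset n) (u : ℕ) → E (λ v → 𝟙 (∣ ⋃[ W ] (lookup v) ∣ ℕ.≤? u)) ≤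
      fromℕ (suc s ℕ.^ u) * (fromℕ 2 ^ℚ u * w) ^ℚ ∣ W ∣
    E-fewColours W u = begin
      E (λ v → 𝟙 (∣ ⋃[ W ] (lookup v) ∣ ℕ.≤? u)) ≤⟨ E-mono (λ v _ → pointwise v) ⟩
      E (λ v → Σ Us (λ U → 𝟙 (allOn? W (_⊆? U) v))) ≡⟨ E-Σ Us (λ U v → 𝟙 (allOn? W (_⊆? U) v)) ⟩
      Σ Us (λ U → E (λ v → 𝟙 (allOn? W (_⊆? U) v))) ≤⟨ Σ-bound Us z each ⟩
      fromℕ (length Us) * z ≤⟨ *-monoʳ 0≤z (ℚ.≤-trans
          (ℚ.≤-reflexive (sym (Σ-filter (λ p → ∣ p ∣ ℕ.≤? u) (subsets s))))
          (count-small u s)) ⟩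
      fromℕ (suc s ℕ.^ u) * z ∎
      where
      open ℚ.≤-Reasoning
      Us = filter (λ p → ∣ p ∣ ℕ.≤? u) (subsets s)
      z = (fromℕ 2 ^ℚ u * w) ^ℚ ∣ W ∣
      0≤z : 0ℚ ≤ z
      0≤z = ^-nonNeg ∣ W ∣ (*-nonNeg (^-nonNeg u (0≤fromℕ 2)) 0≤w)
      pointwise : ∀ v → 𝟙 (∣ ⋃[ W ] (lookup v) ∣ ℕ.≤? u) ≤ Σ Us (λ U → 𝟙 (allOn? W (_⊆? U) v))
      pointwise v = ℚ.≤-trans (𝟙-mono (∣ ⋃[ W ] (lookup v) ∣ ℕ.≤? u) (Any.any? (λ U → allOn? W (_⊆? U) v) Us)
          λ few → List.lose (List.∈-filter⁺ (λ p → ∣ p ∣ ℕ.≤? u) (∈-subsets _) few)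
            λ x x∈W → ∈⋃⁺ W (lookup v) x∈W)
        (𝟙-any (λ U → allOn? W (_⊆? U) v) Us)
      each : ∀ {U} → U List.∈ Us → E (λ v → 𝟙 (allOn? W (_⊆? U) v)) ≤ z
      each {U} U∈ = ℚ.≤-trans (ℚ.≤-reflexive (E-allOn W (_⊆? U)))
        (^-mono ∣ W ∣ (*-nonNeg (Σ-nonNeg (subsetsOfSize c s) (λ A → 0≤𝟙 (A ⊆? U))) 0≤w)
          (ℚ.≤-trans (avg-⊆ U) (*-monoʳ 0≤w (^-mono-exp 1≤2
            (proj₂ (List.∈-filter⁻ (λ p → ∣ p ∣ ℕ.≤? u) {xs = subsets s} U∈))))))

    sparse? : (W : Subset n) (v : Vec (Subset s) n) → Dec (c ℕ.* ∣ W ∣ ℕ.≤ ∣ ⋃[ W ] (lookup v) ∣ ℕ.+ c ℕ.* c)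
    sparse? W v = c ℕ.* ∣ W ∣ ℕ.≤? ∣ ⋃[ W ] (lookup v) ∣ ℕ.+ c ℕ.* c

    -- With w = O(s⁻ᶜ), a set of bounded size has deficiency exceeding c² with
    -- probability O(s^-(c²+1)).
    E-dense : (B σ : ℚ) (D : ℕ) → 1ℚ ≤ B → 0ℚ < σ → fromℕ s * σ ≡ 1ℚ → 1 ℕ.≤ s → w ≤ B * σ ^ℚ c →
      (W : Subset n) → ∣ W ∣ ℕ.≤ D →
      E (λ v → 𝟙 (¬? (sparse? W v))) ≤
      fromℕ 2 ^ℚ (c ℕ.* D) * (fromℕ 2 ^ℚ (c ℕ.* D) * B) ^ℚ D * σ ^ℚ suc (c ℕ.* c)
    E-dense {n} B σ D 1≤B 0<σ sσ≡1 1≤s w≤ W ∣W∣≤D = split (suc (c ℕ.* c) ℕ.≤? c ℕ.* ∣ W ∣)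
      where
      bound = fromℕ 2 ^ℚ (c ℕ.* D) * (fromℕ 2 ^ℚ (c ℕ.* D) * B) ^ℚ D * σ ^ℚ suc (c ℕ.* c)
      split : Dec (suc (c ℕ.* c) ℕ.≤ c ℕ.* ∣ W ∣) → E (λ v → 𝟙 (¬? (sparse? W v))) ≤ bound
      -- Here `c * ∣ W ∣ ≤ c * c`, so `W` is sparse for every choice of lists.
      split (no small) = ℚ.≤-trans (ℚ.≤-trans (E-mono λ v _ → ℚ.≤-reflexive (𝟙-no (¬? (sparse? W v)) λ dense →
                dense (ℕ.≤-trans (ℕ.s≤s⁻¹ (ℕ.≰⇒> small)) (ℕ.m≤n+m (c ℕ.* c) _)))) (ℚ.≤-reflexive (E-const {n} 0ℚ)))
              (*-nonNeg (*-nonNeg (^-nonNeg (c ℕ.* D) (0≤fromℕ 2))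
                (^-nonNeg D (*-nonNeg (^-nonNeg (c ℕ.* D) (0≤fromℕ 2)) (ℚ.≤-trans 0≤1 1≤B))))
                (^-nonNeg (suc (c ℕ.* c)) (ℚ.<⇒≤ 0<σ)))
      split (yes large) = begin
        E (λ v → 𝟙 (¬? (sparse? W v))) ≤⟨ E-mono (λ v _ → 𝟙-mono (¬? (sparse? W v)) (∣ ⋃[ W ] (lookup v) ∣ ℕ.≤? u) (few v)) ⟩
        E (λ v → 𝟙 (∣ ⋃[ W ] (lookup v) ∣ ℕ.≤? u)) ≤⟨ E-fewColours W u ⟩
        fromℕ (suc s ℕ.^ u) * (fromℕ 2 ^ℚ u * w) ^ℚ ∣ W ∣ ≤⟨ dense-estimate (fromℕ 2) B (fromℕ s) σ w (fromℕ (suc s ℕ.^ u)) {c = c}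
            1≤2 1≤B 0<σ sσ≡1 0≤w w≤ sᵘ≤ u+ u≤ ∣W∣≤D ⟩
        fromℕ 2 ^ℚ (c ℕ.* D) * (fromℕ 2 ^ℚ (c ℕ.* D) * B) ^ℚ D * σ ^ℚ suc (c ℕ.* c) ∎
        where
        open ℚ.≤-Reasoning
        -- The largest size of the union at which the deficiency of `W` still exceeds c².
        u : ℕ
        u = c ℕ.* ∣ W ∣ ∸ suc (c ℕ.* c)
        u+ : u ℕ.+ suc (c ℕ.* c) ≡ c ℕ.* ∣ W ∣
        u+ = ℕ.m∸n+n≡m large
        u≤ : u ℕ.≤ c ℕ.* D
        u≤ = ℕ.≤-trans (ℕ.m∸n≤m (c ℕ.* ∣ W ∣) (suc (c ℕ.* c))) (ℕ.*-monoʳ-≤ c ∣W∣≤D)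
        few : ∀ v → ¬ (c ℕ.* ∣ W ∣ ℕ.≤ ∣ ⋃[ W ] (lookup v) ∣ ℕ.+ c ℕ.* c) → ∣ ⋃[ W ] (lookup v) ∣ ℕ.≤ u
        few v dense = ℕ.+-cancelʳ-≤ (suc (c ℕ.* c)) _ _
          (ℕ.≤-trans (ℕ.≤-reflexive (ℕ.+-suc _ (c ℕ.* c))) (ℕ.≤-trans (ℕ.≰⇒> dense) (ℕ.≤-reflexive (sym u+))))
        sᵘ≤ : fromℕ (suc s ℕ.^ u) ≤ fromℕ 2 ^ℚ u * fromℕ s ^ℚ u
        sᵘ≤ = ℚ.≤-trans (fromℕ-mono (ℕ.^-monoˡ-≤ u s+1≤2s))
          (ℚ.≤-reflexive (trans (fromℕ-^ (2 ℕ.* s) u) (trans (cong (_^ℚ u) (fromℕ-*-homo 2 s)) (*-^ (fromℕ 2) (fromℕ s) u))))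
          where
          s+1≤2s : suc s ℕ.≤ 2 ℕ.* s
          s+1≤2s = ℕ.≤-trans (ℕ.+-monoˡ-≤ s 1≤s) (ℕ.≤-reflexive (cong (s ℕ.+_) (sym (ℕ.+-identityʳ s))))

-- Counting cliques in the power of a path.

module PathCliques where

  open Expectations
  open MonochromaticSets
  open SubsetCounting
  open import Data.Nat.Base as ℕ using (ℕ; zero; suc; _⊓_)
  open import Data.Nat.Combinatorics using (_C_; nCk+nC[k+1]≡[n+1]C[k+1])
  open import Data.Rational.Base using (ℚ; 0ℚ; 1ℚ; _+_; _*_; _≤_; _<_)
  open import Data.Rational.Solver using (module +-*-Solver)
  open import Data.Fin.Subset using (Subset; _∈_; ∣_∣; inside; outside; _∩_; Nonempty)
  open import Data.Fin.Subset.Properties using (_∈?_; x∈p∩q⁻; drop-there)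
  open import Data.Empty using (⊥-elim)

  private
    variable
      n : ℕ

  Σ-swap : {A B : Set} (xs : List A) (ys : List B) (f : A → B → ℚ) →
    Σ xs (λ x → Σ ys (f x)) ≡ Σ ys (λ y → Σ xs (λ x → f x y))
  Σ-swap []       ys f = sym (trans (Σ-const ys 0ℚ) (ℚ.*-zeroʳ (fromℕ (length ys))))
  Σ-swap (x ∷ xs) ys f = trans (cong (Σ ys (f x) +_) (Σ-swap xs ys f)) (sym (Σ-+ ys (f x) _))

  fromℕ-cancel-≤ : ∀ {a b} → fromℕ a ≤ fromℕ b → a ℕ.≤ b
  fromℕ-cancel-≤ {a} {b} h = ℕ.≮⇒≥ λ b<a → ℚ.<-irrefl refl (ℚ.<-≤-trans
    (subst₂ _<_ (ℚ.+-identityˡ (fromℕ b)) (sym (fromℕ-suc b)) (ℚ.+-monoˡ-< (fromℕ b) 0<1))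
    (ℚ.≤-trans (fromℕ-mono b<a) h))

  Σ-filter-× : {A : Set} {P Q : A → Set} (P? : ∀ x → Dec (P x)) (Q? : ∀ x → Dec (Q x)) (xs : List A) →
    Σ (filter P? xs) (λ x → 𝟙 (Q? x)) ≡ Σ xs (λ x → 𝟙 (P? x ×-dec Q? x))
  Σ-filter-× P? Q? [] = refl
  Σ-filter-× P? Q? (x ∷ xs) with P? x
  ... | yes _ = cong (𝟙 (Q? x) +_) (Σ-filter-× P? Q? xs)
  ... | no _  = trans (Σ-filter-× P? Q? xs) (sym (ℚ.+-identityˡ _))

  elements : Subset n → List (Fin n)
  elements []            = []
  elements (inside ∷ p)  = zero ∷ map suc (elements p)
  elements (outside ∷ p) = map suc (elements p)

  length-elements : (p : Subset n) → length (elements p) ≡ ∣ p ∣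
  length-elements []            = refl
  length-elements (inside ∷ p)  = cong suc (trans (List.length-map suc (elements p)) (length-elements p))
  length-elements (outside ∷ p) = trans (List.length-map suc (elements p)) (length-elements p)

  ∈-elements : (p : Subset n) → ∀ {x} → x ∈ p → x List.∈ elements p
  ∈-elements (inside ∷ p)  here       = here refl
  ∈-elements (inside ∷ p)  (there x∈) = there (List.∈-map⁺ suc (∈-elements p x∈))
  ∈-elements (outside ∷ p) (there x∈) = List.∈-map⁺ suc (∈-elements p x∈)

  Within : ℕ → Subset n → Set
  Within k p = ∀ x → x ∈ p → toℕ x ℕ.< k

  within? : ∀ k (p : Subset n) → Dec (Within k p)
  within? k p = Fin.all? λ x → (x ∈? p) →-dec (toℕ x ℕ.<? k)

  -- Cliques of size c + 1 of the k-th power of the path on n vertices.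
  LinearClique : ℕ → ℕ → Subset n → Set
  LinearClique c k p = ∣ p ∣ ≡ suc c × (∀ x → x ∈ p → ∀ y → y ∈ p → toℕ y ℕ.≤ toℕ x ℕ.+ k)

  linearClique? : ∀ c k (p : Subset n) → Dec (LinearClique c k p)
  linearClique? c k p = (∣ p ∣ ℕ.≟ suc c) ×-dec
    Fin.all? λ x → (x ∈? p) →-dec Fin.all? λ y → (y ∈? p) →-dec (toℕ y ℕ.≤? toℕ x ℕ.+ k)

  within-outside⁻ : ∀ {k} {p : Subset n} → Within (suc k) (outside ∷ p) → Within k p
  within-outside⁻ h x x∈ = ℕ.s≤s⁻¹ (h (suc x) (there x∈))

  within-outside⁺ : ∀ {k} {p : Subset n} → Within k p → Within (suc k) (outside ∷ p)
  within-outside⁺ h (suc x) (there x∈) = ℕ.s≤s (h x x∈)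

  within-inside⁻ : ∀ {k} {p : Subset n} → Within (suc k) (inside ∷ p) → Within k p
  within-inside⁻ h x x∈ = ℕ.s≤s⁻¹ (h (suc x) (there x∈))

  within-inside⁺ : ∀ {k} {p : Subset n} → Within k p → Within (suc k) (inside ∷ p)
  within-inside⁺ h zero    here       = ℕ.s≤s ℕ.z≤n
  within-inside⁺ h (suc x) (there x∈) = ℕ.s≤s (h x x∈)

  linear-outside⁻ : ∀ {c k} {p : Subset n} → LinearClique c k (outside ∷ p) → LinearClique c k p
  linear-outside⁻ (e , h) = e , λ x x∈ y y∈ → ℕ.s≤s⁻¹ (h (suc x) (there x∈) (suc y) (there y∈))

  linear-outside⁺ : ∀ {c k} {p : Subset n} → LinearClique c k p → LinearClique c k (outside ∷ p)
  linear-outside⁺ (e , h) = e , λ { (suc x) (there x∈) (suc y) (there y∈) → ℕ.s≤s (h x x∈ y y∈) }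

  -- When the first vertex belongs to the clique, the rest can be any `c` of the next `k` vertices;
  -- this is the source of the factor (k choose c).
  linear-inside⁻ : ∀ {c k} {p : Subset n} → LinearClique c k (inside ∷ p) → ∣ p ∣ ≡ c × Within k p
  linear-inside⁻ (e , h) = ℕ.suc-injective e , λ x x∈ → h zero here (suc x) (there x∈)

  linear-inside⁺ : ∀ {c k} {p : Subset n} → ∣ p ∣ ≡ c × Within k p → LinearClique c k (inside ∷ p)
  linear-inside⁺ {k = k} (e , h) = cong suc e , λ
    { x       x∈ zero    here       → ℕ.z≤n
    ; zero    _  (suc y) (there y∈) → h y y∈
    ; (suc x) _  (suc y) (there y∈) → ℕ.s≤s (ℕ.≤-trans (ℕ.<⇒≤ (h y y∈)) (ℕ.m≤n+m k (toℕ x))) }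

  sizeWithin? : ∀ c k (p : Subset n) → Dec (∣ p ∣ ≡ c × Within k p)
  sizeWithin? c k p = (∣ p ∣ ℕ.≟ c) ×-dec within? k p

  ¬within-0 : (p : Subset n) → ¬ Within 0 (inside ∷ p)
  ¬within-0 p h with () ← h zero here

  -- The ground set has size `k + j` so that `k` first vertices exist; splitting on the first vertex
  -- is Pascal's rule.
  count-sizeWithin : ∀ k j c → Σ (subsets (k ℕ.+ j)) (λ p → 𝟙 (sizeWithin? c k p)) ≡ fromℕ (k C c)
  count-sizeWithin zero zero zero = cong (_+ 0ℚ) (𝟙-yes (sizeWithin? 0 0 []) (refl , λ _ ()))
  count-sizeWithin zero zero (suc c) = cong (_+ 0ℚ) (𝟙-no (sizeWithin? (suc c) 0 []) λ { (() , _) })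
  count-sizeWithin zero (suc j) c = trans (Σ-subsets j (λ p → 𝟙 (sizeWithin? c 0 p)))
    (trans (cong₂ _+_
        (Σ-subsets-zero {j} (λ p → sizeWithin? c 0 (inside ∷ p)) (λ p → ¬within-0 p ∘ proj₂))
        (trans (Σ-𝟙-cong (subsets j) (λ p → sizeWithin? c 0 (outside ∷ p)) (sizeWithin? c 0)
          (λ (e , h) → e , λ x x∈ → ⊥-elim (ℕ.n≮0 (h (suc x) (there x∈))))
          (λ (e , h) → e , λ { (suc x) (there x∈) → ⊥-elim (ℕ.n≮0 (h x x∈)) }))
          (count-sizeWithin zero j c)))
      (ℚ.+-identityˡ _))
  count-sizeWithin (suc k) j zero = trans (Σ-subsets (k ℕ.+ j) (λ p → 𝟙 (sizeWithin? 0 (suc k) p)))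
    (trans (cong₂ _+_
        (Σ-subsets-zero {k ℕ.+ j} (λ p → sizeWithin? 0 (suc k) (inside ∷ p)) (λ p → λ { (() , _) }))
        (trans (Σ-𝟙-cong (subsets (k ℕ.+ j)) (λ p → sizeWithin? 0 (suc k) (outside ∷ p)) (sizeWithin? 0 k)
          (λ (e , h) → e , within-outside⁻ h) (λ (e , h) → e , within-outside⁺ h))
          (count-sizeWithin k j zero)))
      (ℚ.+-identityˡ _))
  count-sizeWithin (suc k) j (suc c) = trans (Σ-subsets (k ℕ.+ j) (λ p → 𝟙 (sizeWithin? (suc c) (suc k) p)))
    (trans (cong₂ _+_
        (trans (Σ-𝟙-cong (subsets (k ℕ.+ j)) (λ p → sizeWithin? (suc c) (suc k) (inside ∷ p)) (sizeWithin? c k)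
          (λ (e , h) → ℕ.suc-injective e , within-inside⁻ h) (λ (e , h) → cong suc e , within-inside⁺ h))
          (count-sizeWithin k j c))
        (trans (Σ-𝟙-cong (subsets (k ℕ.+ j)) (λ p → sizeWithin? (suc c) (suc k) (outside ∷ p)) (sizeWithin? (suc c) k)
          (λ (e , h) → e , within-outside⁻ h) (λ (e , h) → e , within-outside⁺ h))
          (count-sizeWithin k j (suc c))))
      (trans (sym (fromℕ-+-homo (k C c) (k C suc c))) (cong fromℕ (nCk+nC[k+1]≡[n+1]C[k+1] k c))))

  count-within-≤ : ∀ k n → Σ (subsets n) (λ p → 𝟙 (within? k p)) ≤ fromℕ (2 ℕ.^ k)
  count-within-≤ k zero = ℚ.≤-trans (ℚ.≤-reflexive (ℚ.+-identityʳ _))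
    (ℚ.≤-trans (𝟙≤1 (within? k [])) (fromℕ-mono {1} (ℕ.m^n>0 2 k)))
  count-within-≤ zero (suc n) = ℚ.≤-trans (ℚ.≤-reflexive
    (trans (Σ-subsets n (λ p → 𝟙 (within? 0 p))) (trans
      (cong (_+ Σ (subsets n) (λ p → 𝟙 (within? 0 (outside ∷ p))))
        (Σ-subsets-zero {n} (λ p → within? 0 (inside ∷ p)) ¬within-0))
      (ℚ.+-identityˡ _))))
    (ℚ.≤-trans (Σ-𝟙-mono (subsets n) (λ p → within? 0 (outside ∷ p)) (within? 0)
      (λ h x x∈ → ⊥-elim (ℕ.n≮0 (h (suc x) (there x∈)))))
      (count-within-≤ zero n))
  count-within-≤ (suc k) (suc n) = begin
    Σ (subsets (suc n)) (λ p → 𝟙 (within? (suc k) p)) ≡⟨ Σ-subsets n (λ p → 𝟙 (within? (suc k) p)) ⟩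
    Σ (subsets n) (λ p → 𝟙 (within? (suc k) (inside ∷ p))) + Σ (subsets n) (λ p → 𝟙 (within? (suc k) (outside ∷ p)))
      ≤⟨ ℚ.+-mono-≤
           (Σ-𝟙-mono (subsets n) (λ p → within? (suc k) (inside ∷ p)) (within? k) within-inside⁻)
           (Σ-𝟙-mono (subsets n) (λ p → within? (suc k) (outside ∷ p)) (within? k) within-outside⁻) ⟩
    W + W ≤⟨ ℚ.+-mono-≤ (count-within-≤ k n) (count-within-≤ k n) ⟩
    fromℕ (2 ℕ.^ k) + fromℕ (2 ℕ.^ k) ≡⟨ fromℕ-+-homo (2 ℕ.^ k) (2 ℕ.^ k) ⟨
    fromℕ (2 ℕ.^ k ℕ.+ 2 ℕ.^ k) ≡⟨ cong (λ z → fromℕ (2 ℕ.^ k ℕ.+ z)) (ℕ.+-identityʳ (2 ℕ.^ k)) ⟨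
    fromℕ (2 ℕ.^ suc k) ∎
    where
    open ℚ.≤-Reasoning
    W = Σ (subsets n) (λ p → 𝟙 (within? k p))

  cliques : ∀ c k n → List (Subset n)
  cliques c k n = filter (linearClique? c k) (subsets n)

  count-cliques-suc : ∀ c k j → let n = k ℕ.+ j in
    fromℕ (length (cliques c k (suc n))) ≡ fromℕ (k C c) + fromℕ (length (cliques c k n))
  count-cliques-suc c k j = let n = k ℕ.+ j in trans (sym (Σ-filter (linearClique? c k) (subsets (suc n))))
    (trans (Σ-subsets n (λ p → 𝟙 (linearClique? c k p)))
      (cong₂ _+_
        (trans (Σ-𝟙-cong (subsets n) (λ p → linearClique? c k (inside ∷ p)) (sizeWithin? c k) linear-inside⁻ linear-inside⁺)
          (count-sizeWithin k j c))
        (trans (Σ-𝟙-cong (subsets n) (λ p → linearClique? c k (outside ∷ p)) (linearClique? c k) linear-outside⁻ linear-outside⁺)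
          (Σ-filter (linearClique? c k) (subsets n)))))

  -- Each vertex added in front is the first vertex of (k choose c) cliques. The cliques among `k`
  -- vertices are a constant that the limit ignores.
  count-cliques : ∀ c k j →
    fromℕ (length (cliques c k (k ℕ.+ j))) ≡ fromℕ j * fromℕ (k C c) + fromℕ (length (cliques c k k))
  count-cliques c k zero = trans (cong (λ n → fromℕ (length (cliques c k n))) (ℕ.+-identityʳ k))
    (sym (trans (cong (_+ z) (ℚ.*-zeroˡ (fromℕ (k C c)))) (ℚ.+-identityˡ z)))
    where z = fromℕ (length (cliques c k k))
  count-cliques c k (suc j) = trans (cong (λ n → fromℕ (length (cliques c k n))) (ℕ.+-suc k j))
    (trans (count-cliques-suc c k j) (trans (cong (fromℕ (k C c) +_) (count-cliques c k j))
      (trans (solve 3 (λ b j z → b :+ (j :* b :+ z) := (con 1ℚ :+ j) :* b :+ z) refl (fromℕ (k C c)) (fromℕ j) _)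
        (cong (λ i → i * fromℕ (k C c) + fromℕ (length (cliques c k k))) (sym (fromℕ-suc j))))))
    where open +-*-Solver

  cliqueThrough? : ∀ c k (x : Fin n) (p : Subset n) → Dec (LinearClique c k p × x ∈ p)
  cliqueThrough? c k x p = linearClique? c k p ×-dec (x ∈? p)

  -- The first vertex of a clique through `x` is `x` or one of at most min(x, k) vertices before it,
  -- and the other members lie among the `k` vertices that follow it.
  count-cliquesThrough : ∀ c k n (x : Fin n) → Σ (subsets n) (λ p → 𝟙 (cliqueThrough? c k x p)) ≤
    fromℕ (suc (toℕ x ⊓ k)) * fromℕ (2 ℕ.^ k)
  count-cliquesThrough c k (suc n) zero = begin
    Σ (subsets (suc n)) (λ p → 𝟙 (cliqueThrough? c k zero p)) ≡⟨ Σ-subsets n (λ p → 𝟙 (cliqueThrough? c k zero p)) ⟩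
    Σ (subsets n) (λ p → 𝟙 (cliqueThrough? c k zero (inside ∷ p))) + Σ (subsets n) (λ p → 𝟙 (cliqueThrough? c k zero (outside ∷ p)))
      ≤⟨ ℚ.+-mono-≤
           (Σ-𝟙-mono (subsets n) (λ p → cliqueThrough? c k zero (inside ∷ p)) (within? k) (proj₂ ∘ linear-inside⁻ ∘ proj₁))
           (ℚ.≤-reflexive (Σ-subsets-zero {n} (λ p → cliqueThrough? c k zero (outside ∷ p)) λ { p (_ , ()) })) ⟩
    Σ (subsets n) (λ p → 𝟙 (within? k p)) + 0ℚ ≡⟨ ℚ.+-identityʳ _ ⟩
    Σ (subsets n) (λ p → 𝟙 (within? k p)) ≤⟨ count-within-≤ k n ⟩
    fromℕ (2 ℕ.^ k) ≡⟨ ℚ.*-identityˡ _ ⟨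
    fromℕ 1 * fromℕ (2 ℕ.^ k) ∎
    where open ℚ.≤-Reasoning
  count-cliquesThrough c k (suc n) (suc x) = ℚ.≤-trans (ℚ.≤-reflexive (Σ-subsets n (λ p → 𝟙 (cliqueThrough? c k (suc x) p))))
    (ℚ.≤-trans (ℚ.+-monoʳ-≤ I O≤) (bound (toℕ x ℕ.<? k)))
    where
    I = Σ (subsets n) (λ p → 𝟙 (cliqueThrough? c k (suc x) (inside ∷ p)))
    T = fromℕ (2 ℕ.^ k)
    O≤ : Σ (subsets n) (λ p → 𝟙 (cliqueThrough? c k (suc x) (outside ∷ p))) ≤ fromℕ (suc (toℕ x ⊓ k)) * T
    O≤ = ℚ.≤-trans (Σ-𝟙-mono (subsets n) (λ p → cliqueThrough? c k (suc x) (outside ∷ p)) (cliqueThrough? c k x)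
      λ (l , x∈) → linear-outside⁻ l , drop-there x∈) (count-cliquesThrough c k n x)
    bound : Dec (toℕ x ℕ.< k) → I + fromℕ (suc (toℕ x ⊓ k)) * T ≤ fromℕ (suc (suc (toℕ x) ⊓ k)) * T
    bound (yes x<k) = begin
      I + fromℕ (suc (toℕ x ⊓ k)) * T ≤⟨ ℚ.+-monoˡ-≤ _ (ℚ.≤-trans
          (Σ-𝟙-mono (subsets n) (λ p → cliqueThrough? c k (suc x) (inside ∷ p)) (within? k)
          (proj₂ ∘ linear-inside⁻ ∘ proj₁))
          (count-within-≤ k n)) ⟩
      T + fromℕ (suc (toℕ x ⊓ k)) * T ≡⟨ solve 2 (λ t m → t :+ m :* t := (con 1ℚ :+ m) :* t) refl T (fromℕ (suc (toℕ x ⊓ k))) ⟩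
      (1ℚ + fromℕ (suc (toℕ x ⊓ k))) * T ≡⟨ cong (_* T) (fromℕ-suc (suc (toℕ x ⊓ k))) ⟨
      fromℕ (suc (suc (toℕ x ⊓ k))) * T ≡⟨ cong (λ m → fromℕ (suc m) * T) (trans (cong suc (ℕ.m≤n⇒m⊓n≡m (ℕ.<⇒≤ x<k))) (sym (ℕ.m≤n⇒m⊓n≡m x<k))) ⟩
      fromℕ (suc (suc (toℕ x) ⊓ k)) * T ∎
      where
      open ℚ.≤-Reasoning
      open +-*-Solver
    bound (no x≮k) = begin
      I + fromℕ (suc (toℕ x ⊓ k)) * T ≡⟨ cong (_+ fromℕ (suc (toℕ x ⊓ k)) * T) (Σ-subsets-zero {n}
          (λ p → cliqueThrough? c k (suc x) (inside ∷ p))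
          (λ p (l , x∈) → x≮k (proj₂ (linear-inside⁻ l) x (drop-there x∈)))) ⟩
      0ℚ + fromℕ (suc (toℕ x ⊓ k)) * T ≡⟨ ℚ.+-identityˡ _ ⟩
      fromℕ (suc (toℕ x ⊓ k)) * T ≡⟨ cong (λ m → fromℕ (suc m) * T) (trans (ℕ.m≥n⇒m⊓n≡n (ℕ.≮⇒≥ x≮k))
          (sym (ℕ.m≥n⇒m⊓n≡n (ℕ.m≤n⇒m≤1+n (ℕ.≮⇒≥ x≮k))))) ⟩
      fromℕ (suc (suc (toℕ x) ⊓ k)) * T ∎
      where open ℚ.≤-Reasoning

  -- A clique has c + 1 vertices, and through each pass at most (k + 1) 2^k cliques. Only
  -- independence of `n` matters.
  meetBound : ℕ → ℕ → ℕ
  meetBound c k = suc c ℕ.* (suc k ℕ.* 2 ℕ.^ k)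

  count-meeting : ∀ c k n (K : Subset n) → ∣ K ∣ ≡ suc c →
    length (filter (meets? K) (cliques c k n)) ℕ.≤ meetBound c k
  count-meeting c k n K ∣K∣ = fromℕ-cancel-≤ (begin
    fromℕ (length (filter (meets? K) (cliques c k n))) ≡⟨ Σ-filter (meets? K) (cliques c k n) ⟨
    Σ (cliques c k n) (λ p → 𝟙 (meets? K p)) ≤⟨ Σ-mono (cliques c k n) (λ {p} _ → ℚ.≤-trans
        (𝟙-mono (meets? K p) (Any.any? (_∈? p) (elements K)) (meet p))
        (𝟙-any (_∈? p) (elements K))) ⟩
    Σ (cliques c k n) (λ p → Σ (elements K) (λ x → 𝟙 (x ∈? p))) ≡⟨ Σ-swap (cliques c k n) (elements K) (λ p x → 𝟙 (x ∈? p)) ⟩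
    Σ (elements K) (λ x → Σ (cliques c k n) (λ p → 𝟙 (x ∈? p))) ≤⟨ Σ-bound (elements K) M (λ {x} _ → through x) ⟩
    fromℕ (length (elements K)) * M ≡⟨ cong (λ m → fromℕ m * M) (trans (length-elements K) ∣K∣) ⟩
    fromℕ (suc c) * M ≡⟨ cong (fromℕ (suc c) *_) (fromℕ-*-homo (suc k) (2 ℕ.^ k)) ⟨
    fromℕ (suc c) * fromℕ (suc k ℕ.* 2 ℕ.^ k) ≡⟨ fromℕ-*-homo (suc c) (suc k ℕ.* 2 ℕ.^ k) ⟨
    fromℕ (meetBound c k) ∎)
    where
    open ℚ.≤-Reasoning
    M = fromℕ (suc k) * fromℕ (2 ℕ.^ k)
    meet : ∀ p → Nonempty (K ∩ p) → Any (_∈ p) (elements K)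
    meet p (x , x∈) = let x∈K , x∈p = x∈p∩q⁻ K p x∈ in List.lose (∈-elements K x∈K) x∈p
    through : ∀ x → Σ (cliques c k n) (λ p → 𝟙 (x ∈? p)) ≤ M
    through x = ℚ.≤-trans (ℚ.≤-reflexive (Σ-filter-× (linearClique? c k) (x ∈?_) (subsets n))) (ℚ.≤-trans (count-cliquesThrough c k n x)
      (*-monoʳ (0≤fromℕ (2 ℕ.^ k)) (fromℕ-mono (ℕ.s≤s (ℕ.m⊓n≤n (toℕ x) k)))))

  cliques-size : ∀ c k n → All (λ K → ∣ K ∣ ≡ suc c) (cliques c k n)
  cliques-size c k n = All.map proj₁ (All.all-filter (linearClique? c k) (subsets n))

  fewMeet : ∀ m (Ks : List (Subset n)) → Unique Ks → All (λ K → length (filter (meets? K) Ks) ℕ.≤ m) Ks → FewMeet m Ks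
  fewMeet m [] [] [] = []
  fewMeet {n} m (K ∷ Ks) (K∉ ∷ u) (few ∷ fews) = cons (shorter K few) K∉ (fewMeet m Ks u (All.map (shorter _) fews))
    where
    shorter : ∀ K′ → length (filter (meets? K′) (K ∷ Ks)) ℕ.≤ m → length (filter (meets? K′) Ks) ℕ.≤ m
    shorter K′ h with meets? K′ K
    ... | yes _ = ℕ.<⇒≤ h
    ... | no _  = h

  cliques-fewMeet : ∀ c k n → FewMeet (meetBound c k) (cliques c k n)
  cliques-fewMeet c k n = fewMeet (meetBound c k) (cliques c k n)
    (Unique.filter⁺ (linearClique? c k) (subsets-unique n))
    (All.map (count-meeting c k n _) (cliques-size c k n))

-- Balls, cliques and the cut in the power of a cycle.

module CyclePowers where

  open FiniteSets
  open ListColouring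
  open PathCliques
  open import Data.Nat.Base as ℕ using (ℕ; zero; suc; z≤n; s≤s)
  open import Data.Integer.Base as ℤ using (ℤ; +_; -[1+_])
  open import Data.Integer.Solver using (module +-*-Solver)
  open import Data.Fin.Subset using (Subset; _∈_; ∣_∣; _∪_; ⁅_⁆; ⊥; _-_; Nonempty; ⊤)
  open import Data.Fin.Subset.Properties
  open import Data.Empty using (⊥-elim)

  private
    variable
      n s k : ℕ

  toℤ : Fin n → ℤ
  toℤ x = + toℕ x

  ∣ℤ-+ : ∀ {m a b} → + m ℤ.∣ a → + m ℤ.∣ b → + m ℤ.∣ (a ℤ.+ b)
  ∣ℤ-+ {m} {a} {b} h k = Signed.∣⇒∣ᵤ (Signed.∣m∣n⇒∣m+n (Signed.∣ᵤ⇒∣ {+ m} {a} h) (Signed.∣ᵤ⇒∣ {+ m} {b} k))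

  ∣ℤ-neg : ∀ {m a} → + m ℤ.∣ a → + m ℤ.∣ (ℤ.- a)
  ∣ℤ-neg {m} {a} h = subst (m ℕ.∣_) (sym (ℤ.∣-i∣≡∣i∣ a)) h

  ∣∣-⊖ : ∀ a b → ℤ.∣ + a ℤ.- + b ∣ ≡ ℤ.∣ a ℤ.⊖ b ∣
  ∣∣-⊖ a b = cong ℤ.∣_∣ (ℤ.m-n≡m⊖n a b)

  -- The difference has absolute value below `n`, and the only such multiple of `n` is 0.
  residue-unique : ∀ {a b n} → a ℕ.< n → b ℕ.< n → + n ℤ.∣ (+ a ℤ.- + b) → a ≡ b
  residue-unique {a} {b} {n} a<n b<n n∣ = ℤ.+-injective (ℤ.i-j≡0⇒i≡j (+ a) (+ b) (ℤ.∣i∣≡0⇒i≡0 zero-abs))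
    where
    small : ℤ.∣ + a ℤ.- + b ∣ ℕ.< n
    small = ℕ.≤-<-trans (subst (ℕ._≤ a ℕ.⊔ b) (sym (∣∣-⊖ a b)) (ℤ.∣m⊝n∣≤m⊔n a b)) (ℕ.⊔-lub a<n b<n)
    multiple : ∀ m → m ℕ.< n → n ℕ.∣ m → m ≡ 0
    multiple zero    lt d = refl
    multiple (suc m) lt d = ⊥-elim (ℕ.<⇒≱ lt (ℕ.∣⇒≤ d))
    zero-abs : ℤ.∣ + a ℤ.- + b ∣ ≡ 0
    zero-abs = multiple ℤ.∣ + a ℤ.- + b ∣ small n∣

  cyclePower-sym : ∀ {x y : Fin n} → CyclePower n k x y → CyclePower n k y x
  cyclePower-sym {n} {k} {x} {y} (x≢y , e , 1≤e , e≤k , n∣) = x≢y ∘ sym , ℤ.- e ,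
    subst (1 ℕ.≤_) (sym (ℤ.∣-i∣≡∣i∣ e)) 1≤e , subst (ℕ._≤ k) (sym (ℤ.∣-i∣≡∣i∣ e)) e≤k ,
    subst (+ n ℤ.∣_) (solve 3 (λ x y e → :- (x :- y :- e) := y :- x :- (:- e)) refl (toℤ x) (toℤ y) e)
      (∣ℤ-neg {a = toℤ x ℤ.- toℤ y ℤ.- e} n∣)
    where open +-*-Solver

  -- Nearness is recorded by a displacement modulo `n`, since displacements along successive edges
  -- simply add.
  Near : (n k : ℕ) → ℕ → Fin n → Fin n → Set
  Near n k j v x = ∃ λ e → ℤ.∣ e ∣ ℕ.≤ j ℕ.* k × + n ℤ.∣ (toℤ x ℤ.- toℤ v ℤ.- e)

  near-refl : ∀ (v : Fin n) → Near n k 0 v v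
  near-refl {n} v = + 0 , z≤n , subst (+ n ℤ.∣_)
    (sym (solve 1 (λ v → v :- v :- con (+ 0) := con (+ 0)) refl (toℤ v))) (ℕ._∣0 n)
    where open +-*-Solver

  near-suc : ∀ {j} {v x : Fin n} → Near n k j v x → Near n k (suc j) v x
  near-suc {k = k} {j} (e , le , d) = e , ℕ.≤-trans le (ℕ.m≤n+m (j ℕ.* k) k) , d

  near-step : ∀ {j} {v x y : Fin n} → Near n k j v y → CyclePower n k x y → Near n k (suc j) v x
  near-step {n} {k} {j} {v} {x} {y} (e , le , d) (_ , e′ , _ , le′ , d′) = e′ ℤ.+ e ,
    ℕ.≤-trans (ℤ.∣i+j∣≤∣i∣+∣j∣ e′ e) (ℕ.+-mono-≤ le′ le) ,
    subst (+ n ℤ.∣_) (solve 5 (λ x y v e e′ → (x :- y :- e′) :+ (y :- v :- e) := x :- v :- (e′ :+ e)) refl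
        (toℤ x) (toℤ y) (toℤ v) e e′)
      (∣ℤ-+ {a = toℤ x ℤ.- toℤ y ℤ.- e′} {toℤ y ℤ.- toℤ v ℤ.- e} d′ d)
    where open +-*-Solver

  fromList : List (Fin n) → Subset n
  fromList []       = ⊥
  fromList (x ∷ xs) = ⁅ x ⁆ ∪ fromList xs

  ∣fromList∣≤ : (xs : List (Fin n)) → ∣ fromList xs ∣ ℕ.≤ length xs
  ∣fromList∣≤ {n} []       = ℕ.≤-reflexive (∣⊥∣≡0 n)
  ∣fromList∣≤ (x ∷ xs) = ℕ.≤-trans (∣∪∣≤ ⁅ x ⁆ (fromList xs))
    (ℕ.+-mono-≤ (ℕ.≤-reflexive (∣⁅x⁆∣≡1 x)) (∣fromList∣≤ xs))

  ∈-fromList : {xs : List (Fin n)} → ∀ {x} → x List.∈ xs → x ∈ fromList xs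
  ∈-fromList (here refl) = x∈p∪q⁺ (inj₁ (x∈⁅x⁆ _))
  ∈-fromList (there x∈)  = x∈p∪q⁺ (inj₂ (∈-fromList x∈))

  -- Zero is listed twice; only an upper bound for the size of a window is wanted.
  integers : ℕ → List ℤ
  integers R = map +_ (upTo (suc R)) ++ map (λ m → ℤ.- + m) (upTo (suc R))

  length-integers : ∀ R → length (integers R) ≡ suc R ℕ.+ suc R
  length-integers R = trans (List.length-++ (map +_ (upTo (suc R))))
    (cong₂ ℕ._+_ (trans (List.length-map +_ (upTo (suc R))) (List.length-upTo (suc R)))
      (trans (List.length-map (λ m → ℤ.- + m) (upTo (suc R))) (List.length-upTo (suc R))))

  ∈-integers : ∀ {R} e → ℤ.∣ e ∣ ℕ.≤ R → e List.∈ integers R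
  ∈-integers (+ m)      le = List.∈-++⁺ˡ (List.∈-map⁺ +_ (List.∈-upTo⁺ (s≤s le)))
  ∈-integers {R} -[1+ m ] le = List.∈-++⁺ʳ (map +_ (upTo (suc R))) (List.∈-map⁺ (λ m → ℤ.- + m) (List.∈-upTo⁺ (s≤s le)))

  shift : Fin n → ℤ → Fin n
  shift {suc n} v e = fromℕ< (ℤ.n%ℕd<d (toℤ v ℤ.+ e) (suc n))

  shift-unique : ∀ (v x : Fin n) e → + n ℤ.∣ (toℤ x ℤ.- toℤ v ℤ.- e) → x ≡ shift v e
  shift-unique {suc n} v x e d = Fin.toℕ-injective (trans
    (residue-unique (Fin.toℕ<n x) (ℤ.n%ℕd<d z (suc n)) (subst (+ suc n ℤ.∣_) eq
      (∣ℤ-+ {a = toℤ x ℤ.- toℤ v ℤ.- e} {z ℤ.- + r} d n∣z-r)))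
    (sym (Fin.toℕ-fromℕ< (ℤ.n%ℕd<d z (suc n)))))
    where
    open +-*-Solver
    z = toℤ v ℤ.+ e
    r = z ℤ.%ℕ suc n
    eq : (toℤ x ℤ.- toℤ v ℤ.- e) ℤ.+ (z ℤ.- + r) ≡ toℤ x ℤ.- + r
    eq = solve 4 (λ x v e r → (x :- v :- e) :+ ((v :+ e) :- r) := x :- r) refl (toℤ x) (toℤ v) e (+ r)
    n∣z-r : + suc n ℤ.∣ (z ℤ.- + r)
    n∣z-r = Signed.∣⇒∣ᵤ (Signed.divides (z ℤ./ℕ suc n) (trans (cong (ℤ._- + r) (ℤ.a≡a%ℕn+[a/ℕn]*n z (suc n)))
      (solve 2 (λ r q → r :+ q :- r := q) refl (+ r) ((z ℤ./ℕ suc n) ℤ.* + suc n))))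

  window : (k j : ℕ) → Fin n → Subset n
  window k j v = fromList (map (shift v) (integers (j ℕ.* k)))

  windowSize : (k j : ℕ) → ℕ
  windowSize k j = suc (j ℕ.* k) ℕ.+ suc (j ℕ.* k)

  ∣window∣≤ : ∀ k j (v : Fin n) → ∣ window k j v ∣ ℕ.≤ windowSize k j
  ∣window∣≤ k j v = ℕ.≤-trans (∣fromList∣≤ (map (shift v) (integers (j ℕ.* k))))
    (ℕ.≤-reflexive (trans (List.length-map (shift v) (integers (j ℕ.* k))) (length-integers (j ℕ.* k))))

  near⇒window : ∀ {j} {v x : Fin n} → Near n k j v x → x ∈ window k j v
  near⇒window {v = v} {x} (e , le , d) = ∈-fromList (subst (List._∈ _) (sym (shift-unique v x e d))
    (List.∈-map⁺ (shift v) (∈-integers e le)))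

  close⇒adjacent : ∀ {x y : Fin n} → x ≢ y → toℕ x ℕ.≤ toℕ y ℕ.+ k → toℕ y ℕ.≤ toℕ x ℕ.+ k → CyclePower n k x y
  close⇒adjacent {n} {k} {x} {y} x≢y x≤ y≤ = x≢y , toℤ x ℤ.- toℤ y ,
    ℕ.n≢0⇒n>0 (λ eq → x≢y (Fin.toℕ-injective (ℤ.+-injective (ℤ.i-j≡0⇒i≡j (toℤ x) (toℤ y) (ℤ.∣i∣≡0⇒i≡0 eq))))) ,
    subst (ℕ._≤ k) (sym (∣∣-⊖ (toℕ x) (toℕ y))) (bound (ℕ.≤-total (toℕ x) (toℕ y))) ,
    subst (+ n ℤ.∣_) (sym (ℤ.i≡j⇒i-j≡0 {toℤ x ℤ.- toℤ y} refl)) (ℕ._∣0 n)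
    where
    bound : toℕ x ℕ.≤ toℕ y ⊎ toℕ y ℕ.≤ toℕ x → ℤ.∣ toℕ x ℤ.⊖ toℕ y ∣ ℕ.≤ k
    bound (inj₁ le) = subst (ℕ._≤ k) (sym (ℤ.∣⊖∣-≤ le)) (ℕ.m≤n+o⇒m∸n≤o (toℕ y) (toℕ x) y≤)
    bound (inj₂ ge) = subst (ℕ._≤ k) (trans (sym (ℤ.∣⊖∣-≤ ge)) (ℤ.∣m⊖n∣≡∣n⊖m∣ (toℕ y) (toℕ x))) (ℕ.m≤n+o⇒m∸n≤o (toℕ x) (toℕ y) x≤)

  -- An edge whose ends are more than k apart runs across the point where the
  -- cycle was cut open.
  far⇒wrap : k ℕ.< n → ∀ {x y : Fin n} → CyclePower n k y x → toℕ x ℕ.+ k ℕ.< toℕ y →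
    toℕ x ℕ.< k × n ℕ.≤ toℕ y ℕ.+ k
  far⇒wrap {k} {n} k<n {x} {y} (_ , e , _ , e≤k , n∣) far = x<k , n≤y+k
    where
    X = toℕ x
    Y = toℕ y
    -- y - x - e is a nonzero multiple of n, since y - x exceeds k ≥ ∣e∣.
    case : ∀ e → ℤ.∣ e ∣ ℕ.≤ k → + n ℤ.∣ (+ Y ℤ.- + X ℤ.- e) → n ℕ.≤ Y ℕ.∸ X ℕ.+ k
    case e e≤k d = ℕ.≤-trans (ℕ.∣⇒≤ {{ℕ.≢-nonZero nz}} d) (ℕ.≤-trans (ℤ.∣i-j∣≤∣i∣+∣j∣ (+ Y ℤ.- + X) e)
      (ℕ.+-mono-≤ (ℕ.≤-reflexive (trans (∣∣-⊖ Y X) (trans (ℤ.∣m⊖n∣≡∣n⊖m∣ Y X) (ℤ.∣⊖∣-≤ X≤Y)))) e≤k))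
      where
      X≤Y : X ℕ.≤ Y
      X≤Y = ℕ.≤-trans (ℕ.m≤m+n X k) (ℕ.<⇒≤ far)
      nz : ℤ.∣ + Y ℤ.- + X ℤ.- e ∣ ≢ 0
      nz eq = ℕ.<⇒≱ (ℕ.m+n≤o⇒m≤o∸n (suc k) (subst (ℕ._≤ Y) (cong suc (ℕ.+-comm X k)) far))
        (subst (ℕ._≤ k) (trans (cong ℤ.∣_∣ (sym (ℤ.i-j≡0⇒i≡j (+ Y ℤ.- + X) e (ℤ.∣i∣≡0⇒i≡0 eq))))
          (trans (∣∣-⊖ Y X) (trans (ℤ.∣m⊖n∣≡∣n⊖m∣ Y X) (ℤ.∣⊖∣-≤ X≤Y)))) e≤k)
    n≤ : n ℕ.≤ Y ℕ.∸ X ℕ.+ k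
    n≤ = case e e≤k n∣
    n≤y+k : n ℕ.≤ Y ℕ.+ k
    n≤y+k = ℕ.≤-trans n≤ (ℕ.+-monoˡ-≤ k (ℕ.m∸n≤m Y X))
    -- If k ≤ X, then n ≤ Y - X + k ≤ Y, although Y is a vertex.
    x<k : X ℕ.< k
    x<k = ℕ.≰⇒> λ k≤X → ℕ.<-irrefl refl (ℕ.<-≤-trans (Fin.toℕ<n y) (ℕ.≤-trans n≤
      (ℕ.≤-trans (ℕ.+-monoʳ-≤ (Y ℕ.∸ X) k≤X) (ℕ.≤-reflexive (ℕ.m∸n+n≡m (ℕ.≤-trans (ℕ.m≤m+n X k) (ℕ.<⇒≤ far)))))))

  firsts : (k n : ℕ) → List (Fin n)
  firsts zero    n       = []
  firsts (suc k) zero    = []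
  firsts (suc k) (suc n) = zero ∷ map suc (firsts k n)

  length-firsts : ∀ k n → length (firsts k n) ℕ.≤ k
  length-firsts zero    n       = z≤n
  length-firsts (suc k) zero    = z≤n
  length-firsts (suc k) (suc n) = s≤s (subst (ℕ._≤ k) (sym (List.length-map suc (firsts k n))) (length-firsts k n))

  ∈-firsts : ∀ {k} (x : Fin n) → toℕ x ℕ.< k → x List.∈ firsts k n
  ∈-firsts zero    (s≤s h) = here refl
  ∈-firsts (suc x) (s≤s h) = there (List.∈-map⁺ suc (∈-firsts x h))

  -- The pairs of vertices that an edge across the cut may join.
  cutPairs : (k n : ℕ) → List (Subset n)
  cutPairs k n = filter (λ p → ∣ p ∣ ℕ.≟ 2)
    (cartesianProductWith (λ x y → ⁅ x ⁆ ∪ ⁅ y ⁆) (firsts k n) (map opposite (firsts k n)))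

  -- Coincident ends are filtered out because a single vertex is always monochromatic, whereas a
  -- genuine pair is so only with probability at most `w`.
  cutPairs-size : ∀ k n → All (λ K → ∣ K ∣ ≡ 2) (cutPairs k n)
  cutPairs-size k n = All.all-filter (λ p → ∣ p ∣ ℕ.≟ 2)
    (cartesianProductWith (λ x y → ⁅ x ⁆ ∪ ⁅ y ⁆) (firsts k n) (map opposite (firsts k n)))

  length-cartesianProductWith : {A B C : Set} (f : A → B → C) (xs : List A) (ys : List B) →
    length (cartesianProductWith f xs ys) ≡ length xs ℕ.* length ys
  length-cartesianProductWith f []       ys = refl
  length-cartesianProductWith f (x ∷ xs) ys = trans (List.length-++ (map (f x) ys))
    (cong₂ ℕ._+_ (List.length-map (f x) ys) (length-cartesianProductWith f xs ys))

  length-cutPairs : ∀ k n → length (cutPairs k n) ℕ.≤ k ℕ.* k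
  length-cutPairs k n = ℕ.≤-trans (List.length-filter (λ p → ∣ p ∣ ℕ.≟ 2) (cartesianProductWith (λ x y → ⁅ x ⁆ ∪ ⁅ y ⁆) (firsts k n) ys))
    (ℕ.≤-trans (ℕ.≤-reflexive (length-cartesianProductWith (λ x y → ⁅ x ⁆ ∪ ⁅ y ⁆) (firsts k n) ys))
      (ℕ.*-mono-≤ (length-firsts k n)
        (ℕ.≤-trans (ℕ.≤-reflexive (List.length-map opposite (firsts k n))) (length-firsts k n))))
    where
    ys = map opposite (firsts k n)

  -- `opposite` exchanges the first `k` vertices with the last `k`.
  wrap⇒cutPair : ∀ {x y : Fin n} → x ≢ y → toℕ x ℕ.< k → n ℕ.≤ toℕ y ℕ.+ k → ⁅ x ⁆ ∪ ⁅ y ⁆ List.∈ cutPairs k n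
  wrap⇒cutPair {n} {k} {x} {y} x≢y x<k n≤ = List.∈-filter⁺ (λ p → ∣ p ∣ ℕ.≟ 2)
    (List.∈-cartesianProductWith⁺ (λ x y → ⁅ x ⁆ ∪ ⁅ y ⁆) (∈-firsts x x<k)
      (subst (List._∈ map opposite (firsts k n)) (Fin.opposite-involutive y) (List.∈-map⁺ opposite (∈-firsts (opposite y) op<k))))
    (trans (∣∪⁅⁆∣ ⁅ x ⁆ y (x≢y ∘ sym ∘ x∈⁅y⁆⇒x≡y x)) (cong suc (∣⁅x⁆∣≡1 x)))
    where
    op<k : toℕ (opposite y) ℕ.< k
    op<k = subst (ℕ._< k) (sym (Fin.opposite-prop y))
      (ℕ.+-cancelˡ-< (suc (toℕ y)) _ _ (subst (ℕ._< suc (toℕ y) ℕ.+ k) (sym (ℕ.m+[n∸m]≡n (Fin.toℕ<n y))) (s≤s n≤)))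

  injectiveOn⇒∣∣≤ : (K : Subset n) (A : Subset s) (f : Fin n → Fin s) → (∀ {x} → x ∈ K → f x ∈ A) →
    (∀ {x y} → x ∈ K → y ∈ K → x ≢ y → f x ≢ f y) → ∣ K ∣ ℕ.≤ ∣ A ∣
  injectiveOn⇒∣∣≤ {n} {s} K A f = go ∣ K ∣ K A ℕ.≤-refl
    where
    go : ∀ m (K : Subset n) (A : Subset s) → ∣ K ∣ ℕ.≤ m → (∀ {x} → x ∈ K → f x ∈ A) →
      (∀ {x y} → x ∈ K → y ∈ K → x ≢ y → f x ≢ f y) → ∣ K ∣ ℕ.≤ ∣ A ∣
    go zero    K A le f∈ inj = ℕ.≤-trans le z≤n
    go (suc m) K A le f∈ inj with nonempty? K
    ... | no empty = subst (ℕ._≤ ∣ A ∣) (sym (trans (cong ∣_∣ (Empty-unique empty)) (∣⊥∣≡0 n))) z≤n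
    ... | yes (x , x∈K) = ℕ.≤-trans (∣p∣≤1+∣p-x∣ K x) (ℕ.≤-trans (s≤s
          (go m (K - x) (A - f x) (ℕ.s≤s⁻¹ (ℕ.≤-trans (x∈p⇒∣p-x∣<∣p∣ x∈K) le))
            (λ y∈ → x∈p∧x≢y⇒x∈p-y (f∈ (p─q⊆p K ⁅ x ⁆ y∈)) (inj (p─q⊆p K ⁅ x ⁆ y∈) x∈K
              λ y≡x → x∉p-x K x (subst (_∈ K - x) y≡x y∈)))
            (λ y∈ z∈ → inj (p─q⊆p K ⁅ x ⁆ y∈) (p─q⊆p K ⁅ x ⁆ z∈))))
          (x∈p⇒∣p-x∣<∣p∣ (f∈ x∈K)))

  module _ (c k : ℕ) (0<c : 0 ℕ.< c) {n s : ℕ} (k<n : k ℕ.< n) (L : Fin n → Subset s) (∣L∣≡c : ∀ x → ∣ L x ∣ ≡ c) where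

    MonoList : Subset n → Set
    MonoList K = ∃ λ A → ∀ x → x ∈ K → L x ≡ A

    -- Pigeonhole: c + 1 mutually adjacent vertices need distinct colours from one list of size `c`.
    colourable⇒noMonoClique : LColourable (CyclePower n k) L → ∀ {K} → K List.∈ cliques c k n → ¬ MonoList K
    colourable⇒noMonoClique (f , f∈ , f≢) {K} K∈ (A , L≡A) = ℕ.<-irrefl refl (ℕ.<-≤-trans
      (subst (ℕ._< ∣ K ∣) (trans (sym (∣L∣≡c x)) (cong ∣_∣ (L≡A x x∈K))) (subst (c ℕ.<_) (sym (proj₁ linear)) ℕ.≤-refl))
      (injectiveOn⇒∣∣≤ K A f (λ {y} y∈ → subst (f y ∈_) (L≡A y y∈) (f∈ y))
        λ {y} {z} y∈ z∈ y≢z → f≢ y z (close⇒adjacent y≢z (proj₂ linear z z∈ y y∈) (proj₂ linear y y∈ z z∈))))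
      where
      linear : LinearClique c k K
      linear = proj₂ (List.∈-filter⁻ (linearClique? c k) {xs = SubsetCounting.subsets n} K∈)
      ne : Nonempty K
      ne = 0<∣p∣⇒Nonempty K (subst (0 ℕ.<_) (sym (proj₁ linear)) (s≤s z≤n))
      x = proj₁ ne
      x∈K = proj₂ ne

    module _ (noMonoClique : ∀ {K} → K List.∈ cliques c k n → ¬ MonoList K)
      (noMonoCut : ∀ {K} → K List.∈ cutPairs k n → ¬ MonoList K) where

      -- A clique of the cycle power that is not one of the path power has two members more than `k`
      -- apart. Their edge runs across the cut, so they form a cut pair with equal lists.
      noCyclicMonoClique : NoMonoClique c 0<c (CyclePower n k) (cyclePower? n k) cyclePower-sym proj₁ L ∣L∣≡c
      noCyclicMonoClique K ∣K∣ clique A L≡A = noMonoClique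
        (List.∈-filter⁺ (linearClique? c k) (SubsetCounting.∈-subsets K) (∣K∣ , close)) (A , λ x → L≡A)
        where
        close : ∀ x → x ∈ K → ∀ y → y ∈ K → toℕ y ℕ.≤ toℕ x ℕ.+ k
        close x x∈ y y∈ = ℕ.≮⇒≥ λ far →
          let x≢y = λ x≡y → ℕ.<⇒≱ far (subst (λ z → toℕ z ℕ.≤ toℕ x ℕ.+ k) x≡y (ℕ.m≤m+n (toℕ x) k))
              x<k , n≤ = far⇒wrap k<n (clique y∈ x∈ (x≢y ∘ sym)) far
          in noMonoCut (wrap⇒cutPair x≢y x<k n≤) (A , λ z z∈ → [ (λ z∈x → L≡A (subst (_∈ K) (sym (x∈⁅y⁆⇒x≡y x z∈x)) x∈))
               , (λ z∈y → L≡A (subst (_∈ K) (sym (x∈⁅y⁆⇒x≡y y z∈y)) y∈)) ]′ (x∈p∪q⁻ ⁅ x ⁆ ⁅ y ⁆ z∈))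

      sparse⇒colourable : (∀ v → c ℕ.* ∣ window k (suc (c ℕ.* c)) v ∣ ℕ.≤ ∣ ⋃[ window k (suc (c ℕ.* c)) v ] L ∣ ℕ.+ c ℕ.* c) →
        LColourable (CyclePower n k) L
      sparse⇒colourable sparse = conclude (ℕ.m≤n⇒m<n∨m≡n 0<c)
        where
        total : ColourableOn c 0<c (CyclePower n k) (cyclePower? n k) cyclePower-sym proj₁ L ∣L∣≡c ⊤ →
          LColourable (CyclePower n k) L
        total (f , f∈ , f≢) = f , f∈ , λ x y → f≢ ∈⊤ ∈⊤
        conclude : 1 ℕ.< c ⊎ 1 ≡ c → LColourable (CyclePower n k) L
        conclude (inj₁ 1<c) = total (colourOn c 0<c (CyclePower n k) (cyclePower? n k) cyclePower-sym proj₁ L ∣L∣≡c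
          (Near n k) (near-refl {k = k})
          (λ {j} {v} {x} → near-suc {k = k} {j} {v} {x}) (λ {j} {v} {x} {y} → near-step {k = k} {j} {v} {x} {y})
          (window k (suc (c ℕ.* c))) (λ {v} {x} → near⇒window {k = k} {suc (c ℕ.* c)} {v} {x}) sparse
          noCyclicMonoClique 1<c n ⊤ (∣p∣≤n ⊤))
        conclude (inj₂ 1≡c) = total (singletonLists⇒colourable c 0<c (CyclePower n k) (cyclePower? n k) cyclePower-sym proj₁ L ∣L∣≡c
          (sym 1≡c) noCyclicMonoClique)

-- The estimate of the probability for a given `n`.

module ColourabilityEstimate where

  open FiniteSets
  open Expectations
  open MonochromaticSets
  open SubsetCounting
  open PathCliques
  open CyclePowers
  open import Data.Nat.Base as ℕ using (ℕ; zero; suc; s≤s; z≤n)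
  open import Data.Integer.Base using () renaming (+_ to pos)
  open import Data.Rational.Base using (ℚ; 0ℚ; 1ℚ; _+_; _-_; _*_; -_; _≤_; _<_)
  open import Data.Rational.Solver using (module +-*-Solver)
  open import Data.Fin.Subset using (Subset; _∈_; ∣_∣; Nonempty)
  open import Data.Empty using (⊥-elim)

  /-≡ : ∀ a b → pos a ℚ./ suc b ≡ fromℕ a * recip (fromℕ (suc b))
  /-≡ a b = sym (trans (cong (fromℕ a *_) (recip-unique (0<fromℕ-suc b) (ExpLemmas.fromℕ-* b)))
    (trans (/-* a 1 1 (suc b)) (ℚ.≤-antisym
      (/-≤ (a ℕ.* 1) (1 ℕ.* suc b) a (suc b) (ℕ.≤-reflexive eq))
      (/-≤ a (suc b) (a ℕ.* 1) (1 ℕ.* suc b) (ℕ.≤-reflexive (sym eq))))))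
    where
    eq : a ℕ.* 1 ℕ.* suc b ≡ a ℕ.* (1 ℕ.* suc b)
    eq = ℕ.*-assoc a 1 (suc b)

  ℙ-≡ : {A : Set} {P : Pred A 0ℓ} (Ω : List A) (P? : Decidable₁ P) → 0ℚ < fromℕ (length Ω) →
    ℙ Ω P? ≡ Σ Ω (λ x → 𝟙 (P? x)) * recip (fromℕ (length Ω))
  ℙ-≡ Ω P? 0<∣Ω∣ = trans (unfold 0<∣Ω∣) (cong (_* recip (fromℕ (length Ω))) (sym (Σ-filter P? Ω)))
    where
    unfold : 0ℚ < fromℕ (length Ω) → ℙ Ω P? ≡ fromℕ (length (filter P? Ω)) * recip (fromℕ (length Ω))
    unfold h with length Ω
    ... | zero  = ⊥-elim (ℚ.<-irrefl refl h)
    ... | suc b = /-≡ (length (filter P? Ω)) b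

  module _ {A : Set} (X : List A) (0<N : 0ℚ < fromℕ (length X)) where
    open Expectation X 0<N

    -- The number of vectors is not computed: `E-vectors` applied to the constant 1 shows that
    -- `w ^ n` is its reciprocal, and that it is positive.
    ℙ-vectors : ∀ n {P : Pred (Vec A n) 0ℓ} (P? : Decidable₁ P) → ℙ (vectors X n) P? ≡ E (λ v → 𝟙 (P? v))
    ℙ-vectors n P? = trans (ℙ-≡ (vectors X n) P? 0<len)
      (trans (cong (Σ (vectors X n) (λ v → 𝟙 (P? v)) *_) (recip-unique 0<len len*wⁿ)) (sym (E-vectors (λ v → 𝟙 (P? v)))))
      where
      len = length (vectors X n)
      len*wⁿ : fromℕ len * w ^ℚ n ≡ 1ℚ
      len*wⁿ = trans (cong (_* w ^ℚ n) (sym (trans (Σ-const (vectors X n) 1ℚ) (ℚ.*-identityʳ (fromℕ len)))))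
        (trans (sym (E-vectors {n} (λ _ → 1ℚ))) (E-const {n} 1ℚ))
      0<len : 0ℚ < fromℕ len
      0<len = ℚ.≰⇒> λ len≤0 → ℚ.<-irrefl refl (ℚ.<-≤-trans 0<1 (ℚ.≤-trans (ℚ.≤-reflexive (sym len*wⁿ))
        (ℚ.≤-trans (*-monoʳ (^-nonNeg n 0≤w) len≤0) (ℚ.≤-reflexive (ℚ.*-zeroˡ (w ^ℚ n))))))

  denseConstant : (c k : ℕ) → ℚ → ℚ
  denseConstant c k B = fromℕ 2 ^ℚ (c ℕ.* D) * (fromℕ 2 ^ℚ (c ℕ.* D) * B) ^ℚ D
    where
    D = windowSize k (suc (c ℕ.* c))

  module FiniteEstimate (c k n s : ℕ) (0<c : 0 ℕ.< c) (k<n : k ℕ.< n) (1≤s : 1 ℕ.≤ s)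
    (0<∣X∣ : 0 ℕ.< length (subsetsOfSize c s)) where

    X : List (Subset s)
    X = subsetsOfSize c s

    open Poisson (Vec.≡-dec Bool._≟_) X (subsetsOfSize-unique c s) 0<∣X∣
    open Expectation X 0<N
    open Windows c s 0<N using (sparse?; E-dense)

    Ks : List (Subset n)
    Ks = cliques c k n

    W : Fin n → Subset n
    W = window k (suc (c ℕ.* c))

    colourable? : (v : Vec (Subset s) n) → Dec (LColourable (CyclePower n k) (lookup v))
    colourable? v = lColourable? (cyclePower? n k) (lookup v)

    p≡E : p n c k s ≡ E (λ v → 𝟙 (colourable? v))
    p≡E = ℙ-vectors X 0<N n colourable?

    module _ {v : Vec (Subset s) n} (v∈ : InX v) where

      sizes : ∀ x → ∣ lookup v x ∣ ≡ c
      sizes x = ∈-subsetsOfSize⁻ {c} {s} (VecAll.lookup⁺ v∈ x)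

      Mono⇒MonoList : ∀ {K} → Mono K v → MonoList c k 0<c k<n (lookup v) sizes K
      Mono⇒MonoList m = let a , _ , h = List.find m in a , h

      -- The common list is the list of some vertex of `K`, hence an element of `X`.
      MonoList⇒Mono : ∀ {K} → Nonempty K → MonoList c k 0<c k<n (lookup v) sizes K → Mono K v
      MonoList⇒Mono (x , x∈K) (a , h) = List.lose (subst (List._∈ X) (h x x∈K) (VecAll.lookup⁺ v∈ x)) h

      colourable⇒alive : LColourable (CyclePower n k) (lookup v) → Alive Ks v
      colourable⇒alive col = All.tabulate λ K∈ m →
        colourable⇒noMonoClique c k 0<c k<n (lookup v) sizes col K∈ (Mono⇒MonoList m)

      alive⇒colourable : Alive Ks v → ¬ Any (λ x → ¬ (c ℕ.* ∣ W x ∣ ℕ.≤ ∣ ⋃[ W x ] (lookup v) ∣ ℕ.+ c ℕ.* c)) (allFin n) →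
        ¬ Any (λ K → Mono K v) (cutPairs k n) → LColourable (CyclePower n k) (lookup v)
      alive⇒colourable alive noDense noCut = sparse⇒colourable c k 0<c k<n (lookup v) sizes
        (λ {K} K∈ m → All.lookup alive K∈ (MonoList⇒Mono (nonempty (All.lookup (cliques-size c k n) K∈)) m))
        (λ {K} K∈ m → noCut (List.lose K∈ (MonoList⇒Mono
          (nonempty (All.lookup (cutPairs-size k n) K∈)) m)))
        (λ x → decidable-stable (sparse? (W x) v) λ dense → noDense (List.lose (List.∈-allFin x) dense))
        where
        nonempty : ∀ {K : Subset n} {m} → ∣ K ∣ ≡ suc m → Nonempty K
        nonempty {K} e = 0<∣p∣⇒Nonempty K (subst (0 ℕ.<_) (sym e) (s≤s z≤n))

    denseSum cutSum : Vec (Subset s) n → ℚ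
    denseSum v = Σ (allFin n) (λ x → 𝟙 (¬? (sparse? (W x) v)))
    cutSum v = Σ (cutPairs k n) (λ K → 𝟙 (mono? K v))

    -- Without a bad clique, colourability can fail only through a dense window or a cut pair with
    -- equal lists.
    𝟙alive≤ : ∀ v → InX v → 𝟙 (alive? Ks v) ≤ 𝟙 (colourable? v) + (denseSum v + cutSum v)
    𝟙alive≤ v v∈ = ℚ.≤-trans
      (cases (Any.any? (λ x → ¬? (sparse? (W x) v)) (allFin n)) (Any.any? (λ K → mono? K v) (cutPairs k n)))
      (ℚ.+-monoʳ-≤ (𝟙 (colourable? v)) (ℚ.+-mono-≤
        (𝟙-any (λ x → ¬? (sparse? (W x) v)) (allFin n)) (𝟙-any (λ K → mono? K v) (cutPairs k n))))
      where
      cases : (d : Dec (Any (λ x → ¬ (c ℕ.* ∣ W x ∣ ℕ.≤ ∣ ⋃[ W x ] (lookup v) ∣ ℕ.+ c ℕ.* c)) (allFin n)))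
        (e : Dec (Any (λ K → Mono K v) (cutPairs k n))) → 𝟙 (alive? Ks v) ≤ 𝟙 (colourable? v) + (𝟙 d + 𝟙 e)
      cases d@(yes _) e = ℚ.≤-trans (𝟙≤1 (alive? Ks v)) (ℚ.≤-trans (≤-+ʳ (0≤𝟙 e))
        (subst (_≤ 𝟙 (colourable? v) + (𝟙 d + 𝟙 e)) (ℚ.+-identityˡ _) (ℚ.+-monoˡ-≤ _ (0≤𝟙 (colourable? v)))))
      cases (no _) (yes _) = ℚ.≤-trans (𝟙≤1 (alive? Ks v))
        (subst (_≤ 𝟙 (colourable? v) + (0ℚ + 1ℚ)) (ℚ.+-identityˡ 1ℚ) (ℚ.+-monoˡ-≤ 1ℚ (0≤𝟙 (colourable? v))))
      cases (no noDense) (no noCut) = ℚ.≤-trans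
        (𝟙-mono (alive? Ks v) (colourable? v) λ al → alive⇒colourable v∈ al noDense noCut)
        (≤-+ʳ {q = 0ℚ + 0ℚ} ℚ.≤-refl)

    -- The three terms bound the `n` dense windows, the cut pairs, and the dependence between
    -- meeting cliques. The first two enter on one side only, since colourability rules out bad
    -- cliques outright.
    estimate : (B σ : ℚ) → 1ℚ ≤ B → 0ℚ < σ → fromℕ s * σ ≡ 1ℚ → w ≤ B * σ ^ℚ c →
      ℚ.∣ p n c k s - (1ℚ - w ^ℚ c) ^ℚ length Ks ∣ ≤
      (fromℕ n * (denseConstant c k B * σ ^ℚ suc (c ℕ.* c)) + fromℕ (k ℕ.* k) * w) +
      fromℕ (length Ks) * (fromℕ (meetBound c k) * w ^ℚ suc c)
    estimate B σ 1≤B 0<σ sσ≡1 w≤ = subst (λ z → ℚ.∣ z ∣ ≤ bound + fromℕ (length Ks) * (fromℕ (meetBound c k) * w ^ℚ suc c))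
      (solve 3 (λ x y z → (x :- y) :+ (y :- z) := x :- z) refl (p n c k s) a ((1ℚ - w ^ℚ c) ^ℚ length Ks))
      (∣+∣-≤ first (poisson c (meetBound c k) 0<c Ks (cliques-size c k n) (cliques-fewMeet c k n)))
      where
      open +-*-Solver
      a = E (λ v → 𝟙 (alive? Ks v))
      e = denseConstant c k B * σ ^ℚ suc (c ℕ.* c)
      0≤e : 0ℚ ≤ e
      0≤e = *-nonNeg (*-nonNeg (^-nonNeg (c ℕ.* windowSize k (suc (c ℕ.* c))) (0≤fromℕ 2))
          (^-nonNeg (windowSize k (suc (c ℕ.* c))) (*-nonNeg (^-nonNeg (c ℕ.* windowSize k (suc (c ℕ.* c))) (0≤fromℕ 2))
            (ℚ.≤-trans 0≤1 1≤B))))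
        (^-nonNeg (suc (c ℕ.* c)) (ℚ.<⇒≤ 0<σ))
      bound = fromℕ n * e + fromℕ (k ℕ.* k) * w
      p≤a : p n c k s ≤ a
      p≤a = ℚ.≤-trans (ℚ.≤-reflexive p≡E) (E-mono λ v v∈ → 𝟙-mono (colourable? v) (alive? Ks v) (colourable⇒alive v∈))
      E-denseSum : E denseSum ≤ fromℕ n * e
      E-denseSum = ℚ.≤-trans (ℚ.≤-reflexive (E-Σ (allFin n) (λ x v → 𝟙 (¬? (sparse? (W x) v)))))
        (ℚ.≤-trans (Σ-bound (allFin n) e λ {x} _ →
            E-dense B σ (windowSize k (suc (c ℕ.* c))) 1≤B 0<σ sσ≡1 1≤s w≤ (W x) (∣window∣≤ k (suc (c ℕ.* c)) x))
          (ℚ.≤-reflexive (cong (λ m → fromℕ m * e) (List.length-tabulate {n = n} id))))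
      E-cutSum : E cutSum ≤ fromℕ (k ℕ.* k) * w
      E-cutSum = ℚ.≤-trans (ℚ.≤-reflexive (E-Σ (cutPairs k n) (λ K v → 𝟙 (mono? K v))))
        (ℚ.≤-trans (Σ-bound (cutPairs k n) w each) (*-monoʳ 0≤w (fromℕ-mono (length-cutPairs k n))))
        where
        each : ∀ {K} → K List.∈ cutPairs k n → E (λ v → 𝟙 (mono? K v)) ≤ w
        each {K} K∈ = ℚ.≤-trans (E-mono-≤ K (λ ≡0 → ℕ.0≢1+n (trans (sym ≡0) ∣K∣≡2)))
          (ℚ.≤-reflexive (trans (cong (λ m → w ^ℚ ℕ.pred m) ∣K∣≡2) (ℚ.*-identityʳ w)))
          where
          ∣K∣≡2 : ∣ K ∣ ≡ 2
          ∣K∣≡2 = All.lookup (cutPairs-size k n) K∈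
      a≤ : a ≤ p n c k s + bound
      a≤ = begin
        a ≤⟨ E-mono 𝟙alive≤ ⟩
        E (λ v → 𝟙 (colourable? v) + (denseSum v + cutSum v)) ≡⟨ E-+ (λ v → 𝟙 (colourable? v)) (λ v → denseSum v + cutSum v) ⟩
        E (λ v → 𝟙 (colourable? v)) + E (λ v → denseSum v + cutSum v) ≡⟨ cong₂ _+_ (sym p≡E) (E-+ denseSum cutSum) ⟩
        p n c k s + (E denseSum + E cutSum) ≤⟨ ℚ.+-monoʳ-≤ (p n c k s) (ℚ.+-mono-≤ E-denseSum E-cutSum) ⟩
        p n c k s + bound ∎
        where open ℚ.≤-Reasoning
      0≤bound : 0ℚ ≤ bound
      0≤bound = +-nonNeg (*-nonNeg (0≤fromℕ n) 0≤e) (*-nonNeg (0≤fromℕ (k ℕ.* k)) 0≤w)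
      first : ℚ.∣ p n c k s - a ∣ ≤ bound
      first = ∣∣-≤ (ℚ.≤-trans (difference≤0 p≤a) 0≤bound)
        (subst (_≤ bound) (solve 2 (λ x y → y :- x := :- (x :- y)) refl (p n c k s) a)
          (subst (a - p n c k s ≤_) (solve 2 (λ x y → x :+ y :- x := y) refl (p n c k s) bound)
            (ℚ.+-monoˡ-≤ (- p n c k s) a≤)))
        where
        difference≤0 : ∀ {x y} → x ≤ y → x - y ≤ 0ℚ
        difference≤0 {x} {y} h = subst (x - y ≤_) (ℚ.+-inverseʳ y) (ℚ.+-monoˡ-≤ (- y) h)

-- Limits of real sequences through their rational approximants.

module LimitCalculus where

  open Expectations
  open import Data.Nat.Base as ℕ using (ℕ; zero; suc; s≤s; z≤n)
  open import Data.Rational.Base using (ℚ; 0ℚ; 1ℚ; ½; _+_; _-_; _*_; -_; _≤_; _<_)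
  open import Data.Rational.Solver using (module +-*-Solver)

  open CauchyLemmas

  -- A real-valued sequence is handled through its approximants a n i.
  Double : Set
  Double = ℕ → ℕ → ℚ

  -- The threshold for `i` may depend on `n`, exactly as `<ℝ` inside `Tendsto` allows.
  Ev : (ℕ → ℕ → Set) → Set
  Ev P = ∃ λ N → ∀ n → N ℕ.≤ n → ∃ λ I → ∀ i → I ℕ.≤ i → P n i

  private
    variable
      P Q R : ℕ → ℕ → Set

  Ev-map : (∀ {n i} → P n i → Q n i) → Ev P → Ev Q
  Ev-map f (N , h) = N , λ n N≤n → proj₁ (h n N≤n) , λ i I≤i → f (proj₂ (h n N≤n) i I≤i)

  Ev-map₂ : (∀ {n i} → P n i → Q n i → R n i) → Ev P → Ev Q → Ev R
  Ev-map₂ f (N , h) (M , g) = N ℕ.⊔ M , λ n le →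
    let I , h′ = h n (ℕ.≤-trans (ℕ.m≤m⊔n N M) le)
        J , g′ = g n (ℕ.≤-trans (ℕ.m≤n⊔m N M) le)
    in I ℕ.⊔ J , λ i le′ → f (h′ i (ℕ.≤-trans (ℕ.m≤m⊔n I J) le′)) (g′ i (ℕ.≤-trans (ℕ.m≤n⊔m I J) le′))

  Ev-always : (∀ n i → P n i) → Ev P
  Ev-always h = 0 , λ n _ → 0 , λ i _ → h n i

  Ev-n : {P : ℕ → Set} → (∃ λ N → ∀ n → N ℕ.≤ n → P n) → Ev (λ n _ → P n)
  Ev-n (N , h) = N , λ n le → 0 , λ _ _ → h n le

  Ev-i : {P : ℕ → Set} → (∃ λ I → ∀ i → I ℕ.≤ i → P i) → Ev (λ _ i → P i)
  Ev-i h = 0 , λ _ _ → h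

  infix 4 _≈_

  -- One relation covers both a rational sequence, constant in `i`, and a real limit, constant in
  -- `n`.
  record _≈_ (a b : Double) : Set where
    constructor mk≈
    field
      within : ∀ δ → 0ℚ < δ → Ev λ n i → ℚ.∣ a n i - b n i ∣ ≤ δ

  open _≈_

  record Bounded (a : Double) : Set where
    constructor mkBounded
    field
      bound     : ℚ
      bound≥0   : 0ℚ ≤ bound
      ∣∣≤bound  : Ev λ n i → ℚ.∣ a n i ∣ ≤ bound

  private
    variable
      a b a′ b′ l : Double

  p≤∣p∣ : ∀ p → p ≤ ℚ.∣ p ∣
  p≤∣p∣ p with ℚ.≤-total 0ℚ p
  ... | inj₁ 0≤p = ℚ.≤-reflexive (sym (ℚ.0≤p⇒∣p∣≡p 0≤p))
  ... | inj₂ p≤0 = ℚ.≤-trans p≤0 (ℚ.0≤∣p∣ p)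

  ∣p-p∣≡0 : ∀ p → ℚ.∣ p - p ∣ ≡ 0ℚ
  ∣p-p∣≡0 p = cong ℚ.∣_∣ (ℚ.+-inverseʳ p)

  ≈-ev : Ev (λ n i → a n i ≡ b n i) → a ≈ b
  ≈-ev {a} h = mk≈ λ δ 0<δ → Ev-map (λ {n} {i} e → ℚ.≤-trans
    (ℚ.≤-reflexive (trans (cong (λ z → ℚ.∣ a n i - z ∣) (sym e)) (∣p-p∣≡0 (a n i)))) (ℚ.<⇒≤ 0<δ)) h

  ≈-≡ : (∀ n i → a n i ≡ b n i) → a ≈ b
  ≈-≡ {a} {b} h = ≈-ev (Ev-always h)

  ≈-refl : a ≈ a
  ≈-refl = ≈-≡ (λ _ _ → refl)

  ≈-sym : a ≈ b → b ≈ a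
  ≈-sym {a} {b} h = mk≈ λ δ 0<δ → Ev-map (λ {n} {i} → subst (_≤ δ) (∣-∣-swap (a n i) (b n i))) (within h δ 0<δ)

  half : ∀ {δ} → 0ℚ < δ → 0ℚ < ½ * δ
  half 0<δ = *-pos (ℚ.positive⁻¹ ½) 0<δ

  half+half : ∀ δ → ½ * δ + ½ * δ ≡ δ
  half+half δ = trans (sym (ℚ.*-distribʳ-+ δ ½ ½)) (ℚ.*-identityˡ δ)

  triangle : ∀ p q r {x y} → ℚ.∣ p - q ∣ ≤ x → ℚ.∣ q - r ∣ ≤ y → ℚ.∣ p - r ∣ ≤ x + y
  triangle p q r {x} {y} h k = subst (λ z → ℚ.∣ z ∣ ≤ x + y)
    (solve 3 (λ p q r → (p :- q) :+ (q :- r) := p :- r) refl p q r) (∣+∣-≤ h k)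
    where open +-*-Solver

  ≈-trans : a ≈ b → b ≈ l → a ≈ l
  ≈-trans {a} {b} {l} h k = mk≈ λ δ 0<δ → Ev-map₂
    (λ {n} {i} x y → subst (ℚ.∣ a n i - l n i ∣ ≤_) (half+half δ) (triangle (a n i) (b n i) (l n i) x y))
    (within h (½ * δ) (half 0<δ)) (within k (½ * δ) (half 0<δ))

  -- The hypothesis is used at δ / (K + 1), where the added 1 keeps the divisor positive.
  ≈-scale : ∀ K → 0ℚ ≤ K → (∀ δ → 0ℚ < δ → Ev λ n i → ℚ.∣ a n i - b n i ∣ ≤ K * δ) → a ≈ b
  ≈-scale {a} {b} K 0≤K h = mk≈ λ δ 0<δ → Ev-map (λ le → ℚ.≤-trans le (Kη≤δ δ 0<δ)) (h (η δ) (0<η δ 0<δ))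
    where
    L = K + 1ℚ
    0<L : 0ℚ < L
    0<L = ℚ.<-≤-trans 0<1 (subst (_≤ L) (ℚ.+-identityˡ 1ℚ) (ℚ.+-monoˡ-≤ 1ℚ 0≤K))
    η : ℚ → ℚ
    η δ = recip L * δ
    0<η : ∀ δ → 0ℚ < δ → 0ℚ < η δ
    0<η δ 0<δ = *-pos (0<recip 0<L) 0<δ
    Kη≤δ : ∀ δ → 0ℚ < δ → K * η δ ≤ δ
    Kη≤δ δ 0<δ = ℚ.≤-trans (*-monoʳ (ℚ.<⇒≤ (0<η δ 0<δ)) (≤-+ʳ {K} 0≤1))
      (ℚ.≤-reflexive (trans (sym (ℚ.*-assoc L (recip L) δ)) (trans (cong (_* δ) (*-recip 0<L)) (ℚ.*-identityˡ δ))))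

  ≈-+ : a ≈ a′ → b ≈ b′ → (λ n i → a n i + b n i) ≈ (λ n i → a′ n i + b′ n i)
  ≈-+ {a} {a′} {b} {b′} h k = mk≈ λ δ 0<δ → Ev-map₂
    (λ {n} {i} x y → subst₂ (λ u v → ℚ.∣ u ∣ ≤ v)
      (solve 4 (λ a a′ b b′ → (a :- a′) :+ (b :- b′) := (a :+ b) :- (a′ :+ b′)) refl (a n i) (a′ n i) (b n i) (b′ n i))
      (half+half δ) (∣+∣-≤ x y))
    (within h (½ * δ) (half 0<δ)) (within k (½ * δ) (half 0<δ))
    where open +-*-Solver

  -- By a b - a′ b′ = a (b - b′) + (a - a′) b′, it is enough to bound one factor on each side.
  ≈-* : Bounded a → Bounded b′ → a ≈ a′ → b ≈ b′ → (λ n i → a n i * b n i) ≈ (λ n i → a′ n i * b′ n i)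
  ≈-* {a} {b′} {a′} {b} (mkBounded A 0≤A hA) (mkBounded B 0≤B hB) h k = ≈-scale (A + B) (+-nonNeg 0≤A 0≤B) λ δ 0<δ →
    Ev-map₂ (λ {n} {i} (∣a∣ , ∣b∣) (x , y) → subst₂ (λ u v → ℚ.∣ u ∣ ≤ v)
        (solve 4 (λ a b a′ b′ → a :* (b :- b′) :+ (a :- a′) :* b′ := a :* b :- a′ :* b′) refl (a n i) (b n i) (a′ n i) (b′ n i))
        (solve 3 (λ A B d → A :* d :+ d :* B := (A :+ B) :* d) refl A B δ)
        (∣+∣-≤ (∣*∣-≤ ∣a∣ y) (∣*∣-≤ x ∣b∣)))
      (Ev-map₂ _,_ hA hB) (Ev-map₂ _,_ (within h δ 0<δ) (within k δ 0<δ))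
    where open +-*-Solver

  Bounded-≈ : a ≈ b → Bounded a → Bounded b
  Bounded-≈ {a} {b} h (mkBounded A 0≤A hA) = mkBounded (A + 1ℚ) (+-nonNeg 0≤A 0≤1) (Ev-map₂
    (λ {n} {i} ∣a∣ d → subst (λ z → ℚ.∣ z ∣ ≤ A + 1ℚ)
      (solve 2 (λ a b → a :+ (b :- a) := b) refl (a n i) (b n i))
      (∣+∣-≤ ∣a∣ (subst (_≤ 1ℚ) (∣-∣-swap (a n i) (b n i)) d)))
    hA (within h 1ℚ 0<1))
    where open +-*-Solver

  Bounded-const : ∀ q → Bounded (λ _ _ → q)
  Bounded-const q = mkBounded ℚ.∣ q ∣ (ℚ.0≤∣p∣ q) (Ev-always λ _ _ → ℚ.≤-refl)

  Bounded-* : Bounded a → Bounded b → Bounded (λ n i → a n i * b n i)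
  Bounded-* {a} {b} (mkBounded A 0≤A hA) (mkBounded B 0≤B hB) = mkBounded (A * B) (*-nonNeg 0≤A 0≤B)
    (Ev-map₂ (λ {n} {i} → ∣*∣-≤ {a n i} {b n i}) hA hB)

  Bounded-^ : ∀ m → Bounded a → Bounded (λ n i → a n i ^ℚ m)
  Bounded-^ zero    h = Bounded-const 1ℚ
  Bounded-^ (suc m) h = Bounded-* h (Bounded-^ m h)

  ≈-^ : ∀ m → Bounded a → a ≈ a′ → (λ n i → a n i ^ℚ m) ≈ (λ n i → a′ n i ^ℚ m)
  ≈-^ zero    hA h = ≈-refl
  ≈-^ (suc m) hA h = ≈-* hA (Bounded-≈ ih (Bounded-^ m hA)) h ih
    where ih = ≈-^ m hA h

  ≈-recip : ∀ ε → 0ℚ < ε → Ev (λ n i → ε ≤ a n i) → Ev (λ n i → ε ≤ b n i) → a ≈ b →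
    (λ n i → recip (a n i)) ≈ (λ n i → recip (b n i))
  ≈-recip {a} {b} ε 0<ε ha hb h = ≈-scale (r * r) (*-nonNeg 0≤r 0≤r) λ δ 0<δ →
    Ev-map₂ (λ {n} {i} (ε≤a , ε≤b) d → subst (λ z → ℚ.∣ z ∣ ≤ r * r * δ)
        (sym (recip-diff (ℚ.<-≤-trans 0<ε ε≤a) (ℚ.<-≤-trans 0<ε ε≤b)))
        (∣*∣-≤ (∣*∣-≤ (small ε≤a) (small ε≤b)) (subst (_≤ δ) (∣-∣-swap (a n i) (b n i)) d)))
      (Ev-map₂ _,_ ha hb) (within h δ 0<δ)
    where
    r = recip ε
    0≤r : 0ℚ ≤ r
    0≤r = 0≤recip 0<ε
    small : ∀ {x} → ε ≤ x → ℚ.∣ recip x ∣ ≤ r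
    small ε≤x = ℚ.≤-trans (∣∣≤-nonNeg (0≤recip (ℚ.<-≤-trans 0<ε ε≤x))) (recip-anti 0<ε ε≤x)

  ≈1⇒½≤ : a ≈ (λ _ _ → 1ℚ) → Ev (λ n i → ½ ≤ a n i)
  ≈1⇒½≤ {a} h = Ev-map (λ {n} {i} d → lower (a n i) d) (within h ½ (ℚ.positive⁻¹ ½))
    where
    open +-*-Solver
    lower : ∀ x → ℚ.∣ x - 1ℚ ∣ ≤ ½ → ½ ≤ x
    lower x d = subst (½ ≤_) (solve 1 (λ x → con 1ℚ :+ :- (:- (x :- con 1ℚ)) := x) refl x)
      (ℚ.+-monoʳ-≤ 1ℚ (ℚ.neg-antimono-≤ (ℚ.≤-trans (p≤∣p∣ (- (x - 1ℚ))) (ℚ.≤-trans (ℚ.≤-reflexive (ℚ.∣-p∣≡∣p∣ (x - 1ℚ))) d))))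

  ≈1-recip : a ≈ (λ _ _ → 1ℚ) → (λ n i → recip (a n i)) ≈ (λ _ _ → 1ℚ)
  ≈1-recip h = ≈-trans
    (≈-recip ½ (ℚ.positive⁻¹ ½) (≈1⇒½≤ h) (Ev-always λ _ _ → ½≤1) h)
    (≈-≡ λ _ _ → recip-unique 0<1 (ℚ.*-identityʳ 1ℚ))
    where
    ½≤1 : ½ ≤ 1ℚ
    ½≤1 = /-≤ 1 2 1 1 (s≤s z≤n)

  ≈-squeeze : ∀ {lo hi : Double} q → Ev (λ n i → lo n i ≤ a n i × a n i ≤ hi n i) →
    lo ≈ (λ _ _ → q) → hi ≈ (λ _ _ → q) → a ≈ (λ _ _ → q)
  ≈-squeeze {a} {lo} {hi} q between hl hh = mk≈ λ δ 0<δ → Ev-map₂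
    (λ {n} {i} (l≤ , ≤h) (dl , dh) → ∣∣-≤
      (ℚ.≤-trans (ℚ.+-monoˡ-≤ (- q) ≤h) (ℚ.≤-trans (p≤∣p∣ (hi n i - q)) dh))
      (ℚ.≤-trans (ℚ.neg-antimono-≤ (ℚ.+-monoˡ-≤ (- q) l≤))
        (ℚ.≤-trans (p≤∣p∣ (- (lo n i - q))) (ℚ.≤-trans (ℚ.≤-reflexive (ℚ.∣-p∣≡∣p∣ (lo n i - q))) dl))))
    between (Ev-map₂ _,_ (within hl δ 0<δ) (within hh δ 0<δ))

  approx-^ : ∀ x m i → approx (x ^ℝ m) i ≡ approx x i ^ℚ m
  approx-^ x zero    i = refl
  approx-^ x (suc m) i = cong (approx x i *_) (approx-^ x m i)

  Bounded-real : (x : ℝ) → Bounded (λ _ i → approx x i)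
  Bounded-real x = let B , 0≤B , N , h = eventuallyBounded x in mkBounded B 0≤B (Ev-i (N , h))

  0<ℝfromℚ : ∀ {δ} → 0ℚ < δ → 0ℝ <ℝ fromℚ δ
  0<ℝfromℚ {δ} 0<δ = δ , 0<δ , 0 , λ _ _ → ℚ.≤-reflexive (ℚ.+-identityˡ δ)

  Tendsto⇒≈ : (a : (n : ℕ) .{{_ : ℕ.NonZero n}} → ℝ) (ℓ : ℝ) (b : Double) →
    (∀ n .{{_ : ℕ.NonZero n}} i → approx (a n) i ≡ b n i) → Tendsto a ℓ → b ≈ (λ _ i → approx ℓ i)
  Tendsto⇒≈ a ℓ b a≡b h = mk≈ λ δ 0<δ →
    let N , lim = h (fromℚ δ) (0<ℝfromℚ 0<δ) in
    -- The threshold is raised by one so that `n` is nonzero and the sequence is defined there.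
    suc N , λ { (suc n) (s≤s N≤n) →
      let ε , 0<ε , I , close = lim (suc n) (ℕ.m≤n⇒m≤1+n N≤n)
      in I , λ i I≤i → ℚ.≤-trans (≤-+ʳ (ℚ.<⇒≤ 0<ε))
           (subst (λ z → ℚ.∣ z - approx ℓ i ∣ + ε ≤ δ) (a≡b (suc n) i) (close i I≤i)) }

  -- Half of the gap below `ε` bounds the difference; the other half is the fixed gap that `<ℝ`
  -- demands.
  ≈⇒Tendsto : (q : ℕ → ℚ) (ℓ : ℝ) → (λ n _ → q n) ≈ (λ _ i → approx ℓ i) → Tendsto (λ n → fromℚ (q n)) ℓ
  ≈⇒Tendsto q ℓ h ε (ε₀ , 0<ε₀ , M , ε₀≤ε) =
    let N , close = within h (½ * ε₀) (half 0<ε₀)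
    in N , λ n N≤n → let I , close′ = close n N≤n in
      ½ * ε₀ , half 0<ε₀ , I ℕ.⊔ M , λ i le → ℚ.≤-trans
        (ℚ.+-monoˡ-≤ (½ * ε₀) (close′ i (ℕ.≤-trans (ℕ.m≤m⊔n I M) le)))
        (ℚ.≤-trans (ℚ.≤-reflexive (trans (half+half ε₀) (sym (ℚ.+-identityˡ ε₀))))
          (ε₀≤ε i (ℕ.≤-trans (ℕ.m≤n⊔m I M) le)))

-- Convergence of (1 - q)^r to the exponential.

module ExponentialLimit where

  open Expectations
  open SubsetCounting using (absorption; falling-≤)
  open LimitCalculus
  open import Data.Nat.Base as ℕ using (ℕ; zero; suc; z≤n; _!)
  open import Data.Nat.Combinatorics using (_C_; nCk+nC[k+1]≡[n+1]C[k+1]; k>n⇒nCk≡0)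
  open import Data.Integer.Base using () renaming (+_ to pos)
  open import Data.Rational.Base using (ℚ; 0ℚ; 1ℚ; _+_; _-_; _*_; -_; _≤_; _<_)
  open import Data.Rational.Solver using (module +-*-Solver)

  open CauchyLemmas
  open ExpLemmas

  binomialSum : ℕ → ℕ → ℚ → ℚ
  binomialSum r zero    x = 0ℚ
  binomialSum r (suc m) x = binomialSum r m x + fromℕ (r C m) * x ^ℚ m

  pascal : ∀ r m x → binomialSum (suc r) (suc m) x ≡ binomialSum r (suc m) x + x * binomialSum r m x
  pascal r zero x = sym (trans (cong (0ℚ + fromℕ (r C 0) * 1ℚ +_) (ℚ.*-zeroʳ x)) (ℚ.+-identityʳ _))
  pascal r (suc m) x = trans (cong₂ (λ u v → u + fromℕ v * x ^ℚ suc m) (pascal r m x) (sym (nCk+nC[k+1]≡[n+1]C[k+1] r m)))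
    (trans (cong (λ v → binomialSum r (suc m) x + x * binomialSum r m x + v * x ^ℚ suc m) (fromℕ-+-homo (r C m) (r C suc m)))
      (solve 6 (λ S x T a b z → (S :+ x :* T) :+ (a :+ b) :* (x :* z) := (S :+ b :* (x :* z)) :+ x :* (T :+ a :* z)) refl
        (binomialSum r (suc m) x) x (binomialSum r m x) (fromℕ (r C m)) (fromℕ (r C suc m)) (x ^ℚ m)))
    where open +-*-Solver

  binomialSum-full : ∀ r x → binomialSum r (suc r) x ≡ (1ℚ + x) ^ℚ r
  binomialSum-full zero x = trans (ℚ.+-identityˡ _) (ℚ.*-identityʳ 1ℚ)
  binomialSum-full (suc r) x = trans (pascal r (suc r) x)
    (trans (cong (λ z → S + z * x ^ℚ suc r + x * S) (cong fromℕ (k>n⇒nCk≡0 (ℕ.n<1+n r))))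
      (trans (solve 3 (λ S x z → S :+ con 0ℚ :* z :+ x :* S := (con 1ℚ :+ x) :* S) refl S x (x ^ℚ suc r))
        (cong ((1ℚ + x) *_) (binomialSum-full r x))))
    where
    open +-*-Solver
    S = binomialSum r (suc r) x

  -- Obtained from `absorption` by subtracting (j + 1)(r C j). Over ℚ it also covers j > r, where r
  -- - j is negative and both binomials vanish.
  C-step : ∀ r j → fromℕ (suc j) * fromℕ (r C suc j) ≡ (fromℕ r - fromℕ j) * fromℕ (r C j)
  C-step r j = trans (cong (_* b) (fromℕ-suc j))
    (trans (solve 3 (λ j a b → (con 1ℚ :+ j) :* b := (con 1ℚ :+ j) :* (a :+ b) :- (con 1ℚ :+ j) :* a) refl ĵ a b)
    (trans (cong (_- (1ℚ + ĵ) * a) absorbed)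
      (solve 3 (λ r j a → (con 1ℚ :+ r) :* a :- (con 1ℚ :+ j) :* a := (r :- j) :* a) refl r̂ ĵ a)))
    where
    open +-*-Solver
    ĵ = fromℕ j
    r̂ = fromℕ r
    a = fromℕ (r C j)
    b = fromℕ (r C suc j)
    absorbed : (1ℚ + ĵ) * (a + b) ≡ (1ℚ + r̂) * a
    absorbed = trans (cong₂ _*_ (sym (fromℕ-suc j)) (trans (sym (fromℕ-+-homo (r C j) (r C suc j))) (cong fromℕ (nCk+nC[k+1]≡[n+1]C[k+1] r j))))
      (trans (sym (fromℕ-*-homo (suc j) (suc r C suc j))) (trans (cong fromℕ (absorption r j))
        (trans (fromℕ-*-homo (suc r) (r C j)) (cong (_* a) (fromℕ-suc r)))))

  !-inv! : ∀ j → fromℕ (j !) * inv! j ≡ 1ℚ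
  !-inv! zero = ℚ.*-identityʳ 1ℚ
  !-inv! (suc j) = trans (cong₂ _*_ (fromℕ-*-homo (suc j) (j !)) (inv!-suc j))
    (trans (solve 4 (λ a b c d → (a :* b) :* (c :* d) := (a :* c) :* (b :* d)) refl (fromℕ (suc j)) (fromℕ (j !)) (pos 1 ℚ./ suc j) (inv! j))
      (trans (cong₂ _*_ (fromℕ-* j) (!-inv! j)) (ℚ.*-identityʳ 1ℚ)))
    where open +-*-Solver

  term-suc : ∀ z j → term z (suc j) ≡ (pos 1 ℚ./ suc j) * (z * term z j)
  term-suc z j = trans (cong (z * z ^ℚ j *_) (inv!-suc j))
    (solve 4 (λ z p h i → (z :* p) :* (h :* i) := h :* (z :* (p :* i))) refl z (z ^ℚ j) (pos 1 ℚ./ suc j) (inv! j))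
    where open +-*-Solver

  suc*term : ∀ z j → fromℕ (suc j) * term z (suc j) ≡ z * term z j
  suc*term z j = trans (cong (fromℕ (suc j) *_) (term-suc z j))
    (trans (sym (ℚ.*-assoc (fromℕ (suc j)) (pos 1 ℚ./ suc j) (z * term z j)))
      (trans (cong (_* (z * term z j)) (fromℕ-* j)) (ℚ.*-identityˡ _)))

  -- The terms T j of exp(r x) and b j of (1 + x)ʳ satisfy
  -- T (j+1) - b (j+1) = ((T j - b j) r x + j x b j) / (j + 1).
  module BinomialVsExp (r : ℕ) (x q : ℚ) (∣x∣≤q : ℚ.∣ x ∣ ≤ q) where

    open +-*-Solver

    0≤q : 0ℚ ≤ q
    0≤q = ℚ.≤-trans (ℚ.0≤∣p∣ x) ∣x∣≤q

    r̂ y : ℚ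
    r̂ = fromℕ r
    y = r̂ * q

    0≤y : 0ℚ ≤ y
    0≤y = *-nonNeg (0≤fromℕ r) 0≤q

    T b τ D : ℕ → ℚ
    T j = term (r̂ * x) j
    b j = fromℕ (r C j) * x ^ℚ j
    τ j = term y j
    D j = ℚ.∣ T j - b j ∣

    0≤τ : ∀ j → 0ℚ ≤ τ j
    0≤τ = 0≤term 0≤y

    b-suc : ∀ j → b (suc j) ≡ (pos 1 ℚ./ suc j) * ((r̂ - fromℕ j) * x * b j)
    b-suc j = begin
      C′ * (x * x ^ℚ j) ≡⟨ ℚ.*-identityˡ _ ⟨
      1ℚ * (C′ * (x * x ^ℚ j)) ≡⟨ cong (_* (C′ * (x * x ^ℚ j))) (fromℕ-* j) ⟨
      fromℕ (suc j) * h * (C′ * (x * x ^ℚ j)) ≡⟨ solve 5 (λ s h c x p → s :* h :* (c :* (x :* p)) := h :* ((s :* c) :* x :* p)) refl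
          (fromℕ (suc j)) h C′ x (x ^ℚ j) ⟩
      h * (fromℕ (suc j) * C′ * x * x ^ℚ j) ≡⟨ cong (λ z → h * (z * x * x ^ℚ j)) (C-step r j) ⟩
      h * ((r̂ - fromℕ j) * fromℕ (r C j) * x * x ^ℚ j) ≡⟨ solve 5 (λ h d c x p → h :* (d :* c :* x :* p) := h :* (d :* x :* (c :* p))) refl
          h (r̂ - fromℕ j) (fromℕ (r C j)) x (x ^ℚ j) ⟩
      h * ((r̂ - fromℕ j) * x * b j) ∎
      where
      open ≡-Reasoning
      h = pos 1 ℚ./ suc j
      C′ = fromℕ (r C suc j)

    -- This is j! (r C j) ≤ r^j, the bound on falling factorials.
    ∣b∣≤τ : ∀ j → ℚ.∣ b j ∣ ≤ τ j
    ∣b∣≤τ j = begin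
      ℚ.∣ b j ∣ ≤⟨ ∣*∣-≤ {fromℕ (r C j)} {x ^ℚ j} (∣∣≤-nonNeg (0≤fromℕ (r C j))) (∣^∣ 0≤q ∣x∣≤q j) ⟩
      fromℕ (r C j) * q ^ℚ j ≡⟨ ℚ.*-identityˡ _ ⟨
      1ℚ * (fromℕ (r C j) * q ^ℚ j) ≡⟨ cong (_* (fromℕ (r C j) * q ^ℚ j)) (!-inv! j) ⟨
      fromℕ (j !) * inv! j * (fromℕ (r C j) * q ^ℚ j) ≡⟨ solve 4 (λ f i c p → f :* i :* (c :* p) := (f :* c) :* (p :* i)) refl (fromℕ (j !)) (inv! j) (fromℕ (r C j)) (q ^ℚ j) ⟩
      fromℕ (j !) * fromℕ (r C j) * (q ^ℚ j * inv! j) ≤⟨ *-monoʳ (0≤term 0≤q j) (ℚ.≤-trans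
          (ℚ.≤-reflexive (sym (fromℕ-*-homo (j !) (r C j)))) (fromℕ-mono (falling-≤ r j))) ⟩
      fromℕ (r ℕ.^ j) * (q ^ℚ j * inv! j) ≡⟨ cong (_* (q ^ℚ j * inv! j)) (fromℕ-^ r j) ⟩
      r̂ ^ℚ j * (q ^ℚ j * inv! j) ≡⟨ ℚ.*-assoc (r̂ ^ℚ j) (q ^ℚ j) (inv! j) ⟨
      r̂ ^ℚ j * q ^ℚ j * inv! j ≡⟨ cong (_* inv! j) (*-^ r̂ q j) ⟨
      τ j ∎
      where open ℚ.≤-Reasoning

    0≤1/ : ∀ j → 0ℚ ≤ pos 1 ℚ./ suc j
    0≤1/ j = /-≤ 0 1 1 (suc j) z≤n

    D-step : ∀ j → D (suc j) ≤ (pos 1 ℚ./ suc j) * (D j * y + fromℕ j * (q * τ j))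
    D-step j = begin
      D (suc j) ≡⟨ cong ℚ.∣_∣ (trans (cong₂ _-_ (term-suc (r̂ * x) j) (b-suc j))
          (solve 6 (λ h r x t b j → h :* (r :* x :* t) :- h :* ((r :- j) :* x :* b) := h :* ((t :- b) :* (r :* x) :+ j :* (x :* b))) refl
            h r̂ x (T j) (b j) (fromℕ j))) ⟩
      ℚ.∣ h * ((T j - b j) * (r̂ * x) + fromℕ j * (x * b j)) ∣ ≤⟨ ∣*∣-≤ {h} (∣∣≤-nonNeg (0≤1/ j))
          (∣+∣-≤ (∣*∣-≤ {T j - b j} ℚ.≤-refl (∣*∣-≤ {r̂} {x} (∣fromℕ∣ r) ∣x∣≤q))
            (∣*∣-≤ {fromℕ j} (∣fromℕ∣ j) (∣*∣-≤ {x} {b j} ∣x∣≤q (∣b∣≤τ j)))) ⟩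
      h * (D j * y + fromℕ j * (q * τ j)) ∎
      where
      open ℚ.≤-Reasoning
      h = pos 1 ℚ./ suc j
      ∣fromℕ∣ : ∀ m → ℚ.∣ fromℕ m ∣ ≤ fromℕ m
      ∣fromℕ∣ m = ∣∣≤-nonNeg (0≤fromℕ m)

    D-suc≤ : ∀ j → D j * y ≤ q * (fromℕ j * fromℕ j * τ j) → D (suc j) ≤ q * (fromℕ j * τ j)
    D-suc≤ j ih = ℚ.≤-trans (D-step j) (begin
      h * (D j * y + ĵ * (q * τ j)) ≤⟨ *-monoˡ (0≤1/ j) (ℚ.+-monoˡ-≤ _ ih) ⟩
      h * (q * (ĵ * ĵ * τ j) + ĵ * (q * τ j)) ≡⟨ solve 4 (λ h q j t → h :* (q :* (j :* j :* t) :+ j :* (q :* t)) := ((con 1ℚ :+ j) :* h) :* (q :* (j :* t))) refl h q ĵ (τ j) ⟩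
      (1ℚ + ĵ) * h * (q * (ĵ * τ j)) ≡⟨ cong (_* (q * (ĵ * τ j))) (trans (cong (_* h) (sym (fromℕ-suc j))) (fromℕ-* j)) ⟩
      1ℚ * (q * (ĵ * τ j)) ≡⟨ ℚ.*-identityˡ _ ⟩
      q * (ĵ * τ j) ∎)
      where
      open ℚ.≤-Reasoning
      h = pos 1 ℚ./ suc j
      ĵ = fromℕ j

    -- The recursion uses `D j` only through `D j * y`, so the product is what the induction
    -- carries; `y τ j = (j + 1) τ (j + 1)` then restores its form without dividing by `y`.
    D*y≤ : ∀ j → D j * y ≤ q * (fromℕ j * fromℕ j * τ j)
    D*y≤ zero = ℚ.≤-reflexive (trans (ℚ.*-zeroˡ y) (sym (solve 2 (λ q t → q :* (con 0ℚ :* con 0ℚ :* t) := con 0ℚ) refl q (τ 0))))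
    D*y≤ (suc j) = begin
      D (suc j) * y ≤⟨ *-monoʳ 0≤y (D-suc≤ j (D*y≤ j)) ⟩
      q * (ĵ * τ j) * y ≡⟨ solve 4 (λ q j t y → q :* (j :* t) :* y := q :* (j :* (y :* t))) refl q ĵ (τ j) y ⟩
      q * (ĵ * (y * τ j)) ≡⟨ cong (λ z → q * (ĵ * z)) (suc*term y j) ⟨
      q * (ĵ * (fromℕ (suc j) * τ (suc j))) ≤⟨ *-monoˡ 0≤q (*-monoʳ (*-nonNeg (0≤fromℕ (suc j)) (0≤τ (suc j))) (fromℕ-mono (ℕ.n≤1+n j))) ⟩
      q * (fromℕ (suc j) * (fromℕ (suc j) * τ (suc j))) ≡⟨ cong (q *_) (ℚ.*-assoc (fromℕ (suc j)) (fromℕ (suc j)) (τ (suc j))) ⟨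
      q * (fromℕ (suc j) * fromℕ (suc j) * τ (suc j)) ∎
      where
      open ℚ.≤-Reasoning
      ĵ = fromℕ j

    -- The termwise bounds q j τ j are summed with `j τ j = y τ (j - 1)`, which gives back the
    -- exponential series two terms shorter.
    partial : ∀ m → ℚ.∣ expSum (r̂ * x) (suc m) - binomialSum r (suc m) x ∣ ≤ q * (y * expSum y (ℕ.pred m))
    partial-suc : ∀ m E → ℚ.∣ expSum (r̂ * x) (suc m) - binomialSum r (suc m) x ∣ ≤ E →
      ℚ.∣ expSum (r̂ * x) (suc (suc m)) - binomialSum r (suc (suc m)) x ∣ ≤ E + q * (fromℕ m * τ m)
    partial-suc m E ih = subst (λ z → ℚ.∣ z ∣ ≤ E + q * (fromℕ m * τ m))
      (solve 4 (λ s u t b → (s :- u) :+ (t :- b) := (s :+ t) :- (u :+ b)) refl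
        (expSum (r̂ * x) (suc m)) (binomialSum r (suc m) x) (T (suc m)) (b (suc m)))
      (∣+∣-≤ ih (D-suc≤ m (D*y≤ m)))
    partial zero = ℚ.≤-reflexive (sym (trans (cong (q *_) (ℚ.*-zeroʳ y)) (ℚ.*-zeroʳ q)))
    partial (suc zero) = ℚ.≤-trans (partial-suc 0 0ℚ ℚ.≤-refl)
      (ℚ.≤-reflexive (solve 3 (λ q t y → con 0ℚ :+ q :* (con 0ℚ :* t) := q :* (y :* con 0ℚ)) refl q (τ 0) y))
    partial (suc (suc m)) = ℚ.≤-trans (partial-suc (suc m) _ (partial (suc m)))
      (ℚ.≤-reflexive (trans (cong (λ z → q * (y * expSum y m) + q * z) (suc*term y m))
        (solve 4 (λ q y e t → q :* (y :* e) :+ q :* (y :* t) := q :* (y :* (e :+ t))) refl q y (expSum y m) (τ m))))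

    power-vs-expSum : ℚ.∣ (1ℚ + x) ^ℚ r - expSum (r̂ * x) (suc r) ∣ ≤ q * (y * expSum y (ℕ.pred r))
    power-vs-expSum = subst (_≤ q * (y * expSum y (ℕ.pred r)))
      (trans (∣-∣-swap (expSum (r̂ * x) (suc r)) (binomialSum r (suc r) x))
        (cong (λ z → ℚ.∣ z - expSum (r̂ * x) (suc r) ∣) (binomialSum-full r x)))
      (partial r)

  expSum-mono : ∀ {y B} → 0ℚ ≤ y → y ≤ B → ∀ m → expSum y m ≤ expSum B m
  expSum-mono 0≤y y≤B zero    = ℚ.≤-refl
  expSum-mono 0≤y y≤B (suc m) = ℚ.+-mono-≤ (expSum-mono 0≤y y≤B m) (*-monoʳ (0≤inv! m) (^-mono m 0≤y y≤B))

  module _ {B : ℚ} (0≤B : 0ℚ ≤ B) where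

    -- Beyond `M` the terms at least halve, so the partial sum there plus twice the next term
    -- dominates all partial sums.
    expBound : ℚ
    expBound = U 0≤B (M 0≤B)

    expSum≤expBound : ∀ m → expSum B m ≤ expBound
    expSum≤expBound m = ℚ.≤-trans (grow (M 0≤B))
      (subst (λ i → expSum B i ≤ expBound) (ℕ.+-comm m (M 0≤B)) (expSum≤U 0≤B (M 0≤B) m ℕ.≤-refl))
      where
      grow : ∀ i → expSum B m ≤ expSum B (i ℕ.+ m)
      grow zero    = ℚ.≤-refl
      grow (suc i) = ℚ.≤-trans (grow i) (≤-+ʳ (0≤term 0≤B (i ℕ.+ m)))

    0≤expBound : 0ℚ ≤ expBound
    0≤expBound = ℚ.≤-trans (0≤expSum 0≤B 0) (expSum≤expBound 0)

    -- The Lipschitz bound moves the argument at a fixed length, and the tail bound then changes the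
    -- length.
    expSum-close : ∀ δ → 0ℚ < δ → ∃ λ N → ∀ {x z m i} → ℚ.∣ x ∣ ≤ B → ℚ.∣ z ∣ ≤ B → N ℕ.≤ m → m ℕ.≤ i →
      ℚ.∣ x - z ∣ ≤ δ → ℚ.∣ expSum x m - expSum z i ∣ ≤ (expBound + 1ℚ) * δ
    expSum-close δ 0<δ = N , λ {x} {z} {m} {i} ∣x∣ ∣z∣ N≤m m≤i close → subst (ℚ.∣ expSum x m - expSum z i ∣ ≤_)
      (solve 2 (λ d v → d :* v :+ d := (v :+ con 1ℚ) :* d) refl δ expBound)
      (triangle (expSum x m) (expSum z m) (expSum z i)
        (ℚ.≤-trans (expSum-diff 0≤B ∣x∣ ∣z∣ m) (*-mono (ℚ.0≤∣p∣ (x - z)) 0≤expBound close (expSum≤expBound m)))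
        (truncation ∣z∣ N≤m m≤i))
      where
      open +-*-Solver
      small = tail-small 0≤B δ 0<δ
      N = proj₁ small
      truncation : ∀ {z m i} → ℚ.∣ z ∣ ≤ B → N ℕ.≤ m → m ℕ.≤ i → ℚ.∣ expSum z m - expSum z i ∣ ≤ δ
      truncation {z} {m} {i} ∣z∣ N≤m m≤i = subst (_≤ δ) (∣-∣-swap (expSum z i) (expSum z m))
        (subst (λ j → ℚ.∣ expSum z j - expSum z m ∣ ≤ δ) (ℕ.m∸n+n≡m m≤i)
          (ℚ.≤-trans (tail 0≤B ∣z∣ m (i ℕ.∸ m))
            (ℚ.≤-trans (ℚ.+-monoˡ-≤ (- expSum B m) (expSum≤U 0≤B m (i ℕ.∸ m) (ℕ.≤-trans (proj₁ (proj₂ small)) N≤m)))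
              (ℚ.≤-trans (ℚ.≤-reflexive (solve 2 (λ e t → e :+ t :- e := t) refl (expSum B m) (fromℕ 2 * term B m)))
                (proj₂ (proj₂ small) m N≤m)))))

  power→exp : (r : ℕ → ℕ) (q : ℕ → ℚ) (ℓ : ℝ) → Ev (λ n _ → 0ℚ ≤ q n) → (λ n _ → q n) ≈ (λ _ _ → 0ℚ) →
    (λ n _ → fromℕ (r n) * q n) ≈ (λ _ i → approx ℓ i) → (∀ m → ∃ λ N → ∀ n → N ℕ.≤ n → m ℕ.≤ r n) →
    (λ n _ → (1ℚ - q n) ^ℚ r n) ≈ (λ _ i → approx (exp (-ℝ ℓ)) i)
  power→exp r q ℓ q≥0 q≈0 rq≈ℓ r→∞ = ≈-trans power≈expSum expSum≈exp
    where
    open +-*-Solver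
    y-bounded = Bounded-≈ (≈-sym rq≈ℓ) (Bounded-real ℓ)
    open Bounded y-bounded renaming (bound to B₁; bound≥0 to 0≤B₁; ∣∣≤bound to ∣y∣≤B₁)
    open Bounded (Bounded-real ℓ) renaming (bound to B₂; bound≥0 to 0≤B₂; ∣∣≤bound to ∣ℓ∣≤B₂)
    B V : ℚ
    B = B₁ + B₂
    0≤B : 0ℚ ≤ B
    0≤B = +-nonNeg 0≤B₁ 0≤B₂
    V = expBound 0≤B
    y : ℕ → ℚ
    y n = fromℕ (r n) * q n
    ∣y∣≤B : Ev (λ n i → ℚ.∣ y n ∣ ≤ B)
    ∣y∣≤B = Ev-map (λ le → ℚ.≤-trans le (≤-+ʳ 0≤B₂)) ∣y∣≤B₁
    ∣ℓ∣≤B : Ev (λ n i → ℚ.∣ approx ℓ i ∣ ≤ B)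
    ∣ℓ∣≤B = Ev-map (λ le → ℚ.≤-trans le (subst (_≤ B) (ℚ.+-identityˡ B₂) (ℚ.+-monoˡ-≤ B₂ 0≤B₁))) ∣ℓ∣≤B₂

    -- The binomial expansion has r + 1 terms, and the exponential series is cut at the same length.
    middle : Double
    middle n _ = expSum (- y n) (suc (r n))

    power≈expSum : (λ n _ → (1ℚ - q n) ^ℚ r n) ≈ middle
    power≈expSum = ≈-scale (B * V) (*-nonNeg 0≤B (0≤expBound 0≤B)) λ δ 0<δ →
      Ev-map₂ (λ {n} {i} (0≤q , q≤) ∣y∣ → estimate δ n 0≤q q≤ ∣y∣)
        (Ev-map₂ _,_ q≥0 (_≈_.within q≈0 δ 0<δ)) ∣y∣≤B
      where
      estimate : ∀ δ n → 0ℚ ≤ q n → ℚ.∣ q n - 0ℚ ∣ ≤ δ → ℚ.∣ y n ∣ ≤ B → ℚ.∣ (1ℚ - q n) ^ℚ r n - middle n 0 ∣ ≤ B * V * δ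
      estimate δ n 0≤q q≤ ∣y∣ = begin
        ℚ.∣ (1ℚ - q n) ^ℚ r n - middle n 0 ∣ ≡⟨ cong (λ z → ℚ.∣ (1ℚ - q n) ^ℚ r n - expSum z (suc (r n)) ∣)
            (ℚ.neg-distribʳ-* (fromℕ (r n)) (q n)) ⟩
        ℚ.∣ (1ℚ - q n) ^ℚ r n - expSum (fromℕ (r n) * (- q n)) (suc (r n)) ∣ ≤⟨ BinomialVsExp.power-vs-expSum (r n) (- q n) (q n) ∣-q∣≤q ⟩
        q n * (y n * expSum (y n) (ℕ.pred (r n))) ≤⟨ *-mono 0≤q 0≤BV q≤δ (*-mono 0≤y (0≤expBound 0≤B) y≤B
            (ℚ.≤-trans (expSum-mono 0≤y y≤B (ℕ.pred (r n))) (expSum≤expBound 0≤B (ℕ.pred (r n))))) ⟩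
        δ * (B * V) ≡⟨ ℚ.*-comm δ (B * V) ⟩
        B * V * δ ∎
        where
        open ℚ.≤-Reasoning
        0≤y = *-nonNeg (0≤fromℕ (r n)) 0≤q
        0≤BV = *-nonNeg 0≤B (0≤expBound 0≤B)
        y≤B : y n ≤ B
        y≤B = ℚ.≤-trans (p≤∣p∣ (y n)) ∣y∣
        q≤δ : q n ≤ δ
        q≤δ = ℚ.≤-trans (ℚ.≤-reflexive (sym (ℚ.+-identityʳ (q n)))) (ℚ.≤-trans (p≤∣p∣ (q n - 0ℚ)) q≤)
        ∣-q∣≤q : ℚ.∣ - q n ∣ ≤ q n
        ∣-q∣≤q = ℚ.≤-reflexive (trans (ℚ.∣-p∣≡∣p∣ (q n)) (ℚ.0≤p⇒∣p∣≡p 0≤q))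

    expSum≈exp : middle ≈ (λ _ i → approx (exp (-ℝ ℓ)) i)
    expSum≈exp = ≈-scale (V + 1ℚ) (+-nonNeg (0≤expBound 0≤B) 0≤1) λ δ 0<δ →
      let N , close = expSum-close 0≤B δ 0<δ
          -- The `i`-th approximant of `exp` has `i` terms; `i` may be taken beyond r + 1 because
          -- its threshold depends on `n`.
          large : Ev (λ n i → N ℕ.≤ suc (r n) × suc (r n) ℕ.≤ i)
          large = proj₁ (r→∞ N) , λ n le → suc (r n) , λ i le′ → ℕ.m≤n⇒m≤1+n (proj₂ (r→∞ N) n le) , le′
      in Ev-map₂ (λ {n} {i} (∣y∣ , ∣ℓ∣) ((N≤r , r≤i) , d) → close
             (ℚ.≤-trans (ℚ.≤-reflexive (ℚ.∣-p∣≡∣p∣ (y n))) ∣y∣)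
             (ℚ.≤-trans (ℚ.≤-reflexive (ℚ.∣-p∣≡∣p∣ (approx ℓ i))) ∣ℓ∣)
             N≤r r≤i (ℚ.≤-trans (ℚ.≤-reflexive (trans
               (cong ℚ.∣_∣ (solve 2 (λ a b → :- a :- (:- b) := :- (a :- b)) refl (y n) (approx ℓ i)))
               (ℚ.∣-p∣≡∣p∣ (y n - approx ℓ i)))) d))
           (Ev-map₂ _,_ ∣y∣≤B ∣ℓ∣≤B) (Ev-map₂ _,_ large (_≈_.within rq≈ℓ δ 0<δ))

-- Asymptotics of the parameters when s is of order n^(1/c²).

module ParameterLimits where

  open Expectations
  open SubsetCounting using (falling-≤; falling-≥; ∣subsetsOfSize∣)
  open PathCliques using (cliques; count-cliques; fromℕ-cancel-≤; meetBound)
  open ColourabilityEstimate using (/-≡; denseConstant; module FiniteEstimate)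
  open LimitCalculus
  open ExponentialLimit using (power→exp)
  open import Data.Nat.Base as ℕ using (ℕ; zero; suc; s≤s; z≤n; _!; _∸_)
  open import Data.Nat.Combinatorics using (_C_; nCk+nC[k+1]≡[n+1]C[k+1])
  open import Data.Rational.Base using (ℚ; 0ℚ; 1ℚ; ½; _+_; _-_; _*_; -_; _≤_; _<_)
  open import Data.Rational.Solver using (module +-*-Solver)
  open import Data.Empty using (⊥-elim)

  open RootLemmas

  private
    variable
      a b l : Double

  ≈-*ˡ : ∀ q → a ≈ b → (λ n i → q * a n i) ≈ (λ n i → q * b n i)
  ≈-*ˡ {a} {b} q h = ≈-scale ℚ.∣ q ∣ (ℚ.0≤∣p∣ q) λ δ 0<δ → Ev-map
    (λ {n} {i} d → subst (λ z → ℚ.∣ z ∣ ≤ ℚ.∣ q ∣ * δ)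
      (solve 3 (λ q a b → q :* (a :- b) := q :* a :- q :* b) refl q (a n i) (b n i)) (∣*∣-≤ {q} ℚ.≤-refl d))
    (_≈_.within h δ 0<δ)
    where open +-*-Solver

  ≈0-* : a ≈ (λ _ _ → 0ℚ) → Bounded b → (λ n i → a n i * b n i) ≈ (λ _ _ → 0ℚ)
  ≈0-* {a} {b} h (mkBounded B 0≤B hB) = ≈-scale B 0≤B λ δ 0<δ → Ev-map₂
    (λ {n} {i} d ∣b∣ → subst₂ (λ u v → ℚ.∣ u ∣ ≤ v)
      (solve 2 (λ a b → (a :- con 0ℚ) :* b := a :* b :- con 0ℚ) refl (a n i) (b n i))
      (ℚ.*-comm δ B) (∣*∣-≤ d ∣b∣))
    (_≈_.within h δ 0<δ) hB
    where open +-*-Solver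

  ≈0-*ˡ : ∀ q → a ≈ (λ _ _ → 0ℚ) → (λ n i → q * a n i) ≈ (λ _ _ → 0ℚ)
  ≈0-*ˡ q h = ≈-trans (≈-*ˡ q h) (≈-≡ λ _ _ → ℚ.*-zeroʳ q)

  ≈0-+ : a ≈ (λ _ _ → 0ℚ) → b ≈ (λ _ _ → 0ℚ) → (λ n i → a n i + b n i) ≈ (λ _ _ → 0ℚ)
  ≈0-+ h k = ≈-trans (≈-+ h k) (≈-≡ λ _ _ → ℚ.+-identityʳ 0ℚ)

  ≈-dominated : Ev (λ n i → ℚ.∣ a n i - b n i ∣ ≤ l n i) → l ≈ (λ _ _ → 0ℚ) → a ≈ b
  ≈-dominated {a} {b} {l} h l≈0 = mk≈ λ δ 0<δ → Ev-map₂
    (λ {n} {i} le d → ℚ.≤-trans le (ℚ.≤-trans (ℚ.≤-reflexive (sym (ℚ.+-identityʳ (l n i)))) (ℚ.≤-trans (p≤∣p∣ (l n i - 0ℚ)) d)))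
    h (_≈_.within l≈0 δ 0<δ)

  recip-≤ : ∀ {δ x} → 0ℚ < δ → recip δ ≤ x → recip x ≤ δ
  recip-≤ {δ} 0<δ le = ℚ.≤-trans (recip-anti (0<recip 0<δ) le)
    (ℚ.≤-reflexive (recip-unique (0<recip 0<δ) (trans (ℚ.*-comm (recip δ) δ) (*-recip 0<δ))))

  ≈1-^ : ∀ m → a ≈ (λ _ _ → 1ℚ) → (λ n i → a n i ^ℚ m) ≈ (λ _ _ → 1ℚ)
  ≈1-^ m h = ≈-trans (≈-^ m (Bounded-≈ (≈-sym h) (Bounded-const 1ℚ)) h) (≈-≡ λ _ _ → 1^ m)

  module RootPower (d : ℕ) .{{_ : ℕ.NonZero d}} where

    ρ : Double
    ρ n i = approx (root d n) i

    1≤ρ : ∀ n .{{_ : ℕ.NonZero n}} i → 1ℚ ≤ ρ n i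
    1≤ρ n i = ℚ.≤-trans (ℚ.≤-reflexive (sym (ℚ.+-identityˡ 1ℚ))) (proj₂ (proj₂ (proj₂ (root-pos d n))) i z≤n)

    module _ (n : ℕ) .{{_ : ℕ.NonZero n}} (i : ℕ) where

      open +-*-Solver

      r : ℕ
      r = floorRoot d (n ℕ.* suc i ℕ.^ d)

      m R : ℚ
      m = fromℕ (suc i)
      R = fromℕ r

      0<m : 0ℚ < m
      0<m = 0<fromℕ-suc i

      0<ρ : 0ℚ < ρ n i
      0<ρ = ℚ.<-≤-trans 0<1 (1≤ρ n i)

      ρm≡R : ρ n i * m ≡ R
      ρm≡R = trans (cong (_* m) (/-≡ r i)) (trans (solve 3 (λ R u m → R :* u :* m := R :* (m :* u)) refl R (recip m) m)
        (trans (cong (R *_) (*-recip 0<m)) (ℚ.*-identityʳ R)))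

      ρᵈ≤n : ρ n i ^ℚ d ≤ fromℕ n
      ρᵈ≤n = ℚ.*-cancelʳ-≤-pos (m ^ℚ d) {{ℚ.positive (^-pos d 0<m)}} (begin
        ρ n i ^ℚ d * m ^ℚ d ≡⟨ *-^ (ρ n i) m d ⟨
        (ρ n i * m) ^ℚ d ≡⟨ cong (_^ℚ d) ρm≡R ⟩
        R ^ℚ d ≡⟨ fromℕ-^ r d ⟨
        fromℕ (r ℕ.^ d) ≤⟨ fromℕ-mono (floorRoot-^ d (n ℕ.* suc i ℕ.^ d)) ⟩
        fromℕ (n ℕ.* suc i ℕ.^ d) ≡⟨ fromℕ-*-homo n (suc i ℕ.^ d) ⟩
        fromℕ n * fromℕ (suc i ℕ.^ d) ≡⟨ cong (fromℕ n *_) (fromℕ-^ (suc i) d) ⟩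
        fromℕ n * m ^ℚ d ∎)
        where open ℚ.≤-Reasoning

      -- Maximality of the floor gives n m^d < (r + 1)^d. Since 1 ≤ ρ, the rounding error 1 is at
      -- most ρ, and r + 1 ≤ ρ (1 + m) makes the error multiplicative.
      nmᵈ≤ : fromℕ n * m ^ℚ d ≤ ρ n i ^ℚ d * (1ℚ + m) ^ℚ d
      nmᵈ≤ = begin
        fromℕ n * m ^ℚ d ≡⟨ cong (fromℕ n *_) (fromℕ-^ (suc i) d) ⟨
        fromℕ n * fromℕ (suc i ℕ.^ d) ≡⟨ fromℕ-*-homo n (suc i ℕ.^ d) ⟨
        fromℕ (n ℕ.* suc i ℕ.^ d) ≤⟨ fromℕ-mono (ℕ.<⇒≤ (ℕ.≰⇒> λ le → ℕ.<-irrefl refl (floorRoot-max d (n ℕ.* suc i ℕ.^ d) (suc r) le))) ⟩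
        fromℕ (suc r ℕ.^ d) ≡⟨ fromℕ-^ (suc r) d ⟩
        fromℕ (suc r) ^ℚ d ≤⟨ ^-mono d (0≤fromℕ (suc r)) (begin
          fromℕ (suc r) ≡⟨ fromℕ-suc r ⟩
          1ℚ + R ≤⟨ ℚ.+-monoˡ-≤ R (1≤ρ n i) ⟩
          ρ n i + R ≡⟨ cong (ρ n i +_) ρm≡R ⟨
          ρ n i + ρ n i * m ≡⟨ solve 2 (λ a m → a :+ a :* m := a :* (con 1ℚ :+ m)) refl (ρ n i) m ⟩
          ρ n i * (1ℚ + m) ∎) ⟩
        (ρ n i * (1ℚ + m)) ^ℚ d ≡⟨ *-^ (ρ n i) (1ℚ + m) d ⟩
        ρ n i ^ℚ d * (1ℚ + m) ^ℚ d ∎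
        where open ℚ.≤-Reasoning

      lower : 1ℚ ≤ fromℕ n * recip (ρ n i ^ℚ d)
      lower = ℚ.≤-trans (ℚ.≤-reflexive (sym (*-recip (^-pos d 0<ρ)))) (*-monoʳ (0≤recip (^-pos d 0<ρ)) ρᵈ≤n)

      upper : fromℕ n * recip (ρ n i ^ℚ d) ≤ (1ℚ + recip m) ^ℚ d
      upper = begin
        fromℕ n * recip P ≡⟨ ℚ.*-identityʳ _ ⟨
        fromℕ n * recip P * 1ℚ ≡⟨ cong (fromℕ n * recip P *_) mv ⟨
        fromℕ n * recip P * (m ^ℚ d * recip m ^ℚ d) ≡⟨ solve 4 (λ n p x y → n :* p :* (x :* y) := (n :* x) :* (p :* y)) refl
            (fromℕ n) (recip P) (m ^ℚ d) (recip m ^ℚ d) ⟩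
        fromℕ n * m ^ℚ d * (recip P * recip m ^ℚ d) ≤⟨ *-monoʳ (*-nonNeg (0≤recip (^-pos d 0<ρ)) (^-nonNeg d (0≤recip 0<m))) nmᵈ≤ ⟩
        P * (1ℚ + m) ^ℚ d * (recip P * recip m ^ℚ d) ≡⟨ solve 4 (λ p x y z → p :* x :* (y :* z) := (p :* y) :* (x :* z)) refl
            P ((1ℚ + m) ^ℚ d) (recip P) (recip m ^ℚ d) ⟩
        P * recip P * ((1ℚ + m) ^ℚ d * recip m ^ℚ d) ≡⟨ cong₂ _*_ (*-recip (^-pos d 0<ρ)) (sym (*-^ (1ℚ + m) (recip m) d)) ⟩
        1ℚ * ((1ℚ + m) * recip m) ^ℚ d ≡⟨ ℚ.*-identityˡ _ ⟩
        ((1ℚ + m) * recip m) ^ℚ d ≡⟨ cong (_^ℚ d) (trans (solve 2 (λ m v → (con 1ℚ :+ m) :* v := m :* v :+ v) refl m (recip m))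
            (cong (_+ recip m) (*-recip 0<m))) ⟩
        (1ℚ + recip m) ^ℚ d ∎
        where
        open ℚ.≤-Reasoning
        P = ρ n i ^ℚ d
        mv : m ^ℚ d * recip m ^ℚ d ≡ 1ℚ
        mv = trans (sym (*-^ m (recip m) d)) (trans (cong (_^ℚ d) (*-recip 0<m)) (1^ d))

    1/i≈0 : (λ _ i → recip (fromℕ (suc i))) ≈ (λ _ _ → 0ℚ)
    1/i≈0 = mk≈ λ δ 0<δ → Ev-i (proj₁ (archimedean (recip δ)) , λ i le →
      ℚ.≤-trans (ℚ.≤-reflexive (trans (cong ℚ.∣_∣ (ℚ.+-identityʳ (recip (fromℕ (suc i))))) (ℚ.0≤p⇒∣p∣≡p (0≤recip (0<fromℕ-suc i)))))
        (recip-≤ 0<δ (ℚ.≤-trans (proj₂ (archimedean (recip δ))) (fromℕ-mono (ℕ.m≤n⇒m≤1+n le)))))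

    -- The enclosing bounds 1 and (1 + 1/(i + 1))^d do not involve `n`.
    n/ρᵈ≈1 : (λ n i → fromℕ n * recip (ρ n i ^ℚ d)) ≈ (λ _ _ → 1ℚ)
    n/ρᵈ≈1 = ≈-squeeze {lo = λ _ _ → 1ℚ} {hi = λ _ i → (1ℚ + recip (fromℕ (suc i))) ^ℚ d} 1ℚ
      (1 , λ { (suc n) _ → 0 , λ i _ → lower (suc n) i , upper (suc n) i })
      ≈-refl
      (≈1-^ d (≈-trans (≈-+ (≈-refl {λ _ _ → 1ℚ}) 1/i≈0) (≈-≡ λ _ _ → ℚ.+-identityʳ 1ℚ)))

  C-pos : ∀ {c k} → c ℕ.≤ k → 0 ℕ.< (k C c)
  C-pos {zero}  z≤n = s≤s z≤n
  C-pos {suc c} {suc k} (s≤s le) = ℕ.≤-trans (C-pos le)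
    (ℕ.≤-trans (ℕ.m≤m+n (k C c) (k C suc c)) (ℕ.≤-reflexive (nCk+nC[k+1]≡[n+1]C[k+1] k c)))

  module Asymptotics (c k d : ℕ) .{{d≢0 : ℕ.NonZero d}} (0<c : 0 ℕ.< c) (c≤k : c ℕ.≤ k) (d≡c*c : d ≡ c ℕ.* c)
    (t : ℝ) (t>0 : 0ℝ <ℝ t) (s : ℕ → ℕ) (c≤s : (n : ℕ) .{{_ : ℕ.NonZero n}} → c ℕ.≤ s n)
    (s∼ : (λ n i → fromℕ (s n) * recip (approx t i * approx (root d n) i)) ≈ (λ _ _ → 1ℚ))
    where

    open RootPower d using (ρ; 1≤ρ; n/ρᵈ≈1)
    open +-*-Solver

    σ : ℕ → ℚ
    σ n = recip (fromℕ (s n))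

    u : ℕ → ℚ
    u i = approx (inv t t>0) i

    τ : ℚ
    τ = proj₁ t>0

    0<τ : 0ℚ < τ
    0<τ = proj₁ (proj₂ t>0)

    -- The positivity facts that make every reciprocal below genuine, since `recip` is 0 at 0.
    Regular : ℕ → ℕ → Set
    Regular n i = 0ℚ < approx t i × 0ℚ < ρ n i × 0ℚ < fromℕ (s n) × c ℕ.≤ s n

    regular : Ev Regular
    regular = 1 , λ { (suc n) _ → proj₁ (proj₂ (proj₂ t>0)) , λ i le →
      ℚ.<-≤-trans 0<τ (ℚ.≤-trans (ℚ.≤-reflexive (sym (ℚ.+-identityˡ τ))) (proj₂ (proj₂ (proj₂ t>0)) i le)) ,
      ℚ.<-≤-trans 0<1 (1≤ρ (suc n) i) ,
      ℚ.<-≤-trans 0<1 (fromℕ-mono (ℕ.≤-trans 0<c (c≤s (suc n)))) ,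
      c≤s (suc n) }

    Ev-regular : ∀ {P : ℕ → ℕ → Set} → (∀ {n i} → Regular n i → P n i) → Ev P
    Ev-regular f = Ev-map f regular

    tρσ≈1 : (λ n i → approx t i * ρ n i * σ n) ≈ (λ _ _ → 1ℚ)
    tρσ≈1 = ≈-trans (≈-ev (Ev-regular λ {n} {i} (0<t , 0<ρ , 0<s , _) → sym (recip-unique (*-pos 0<s (0<recip (*-pos 0<t 0<ρ)))
        (trans (solve 4 (λ s v g σ → s :* v :* (g :* σ) := (s :* σ) :* (g :* v)) refl (fromℕ (s n)) (recip (approx t i * ρ n i)) (approx t i * ρ n i) (σ n))
          (trans (cong₂ _*_ (*-recip 0<s) (*-recip (*-pos 0<t 0<ρ))) (ℚ.*-identityʳ 1ℚ))))))
      (≈1-recip s∼)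

    u-bounded : Bounded (λ _ i → u i)
    u-bounded = Bounded-real (inv t t>0)

    -- n σᵈ = t⁻ᵈ · n ρ⁻ᵈ · (t ρ σ)ᵈ
    nσᵈ≈uᵈ : (λ n _ → fromℕ n * σ n ^ℚ d) ≈ (λ _ i → u i ^ℚ d)
    nσᵈ≈uᵈ = ≈-trans (≈-ev (Ev-regular rearrange)) (≈-trans
      (≈-* (Bounded-^ d u-bounded) (Bounded-const 1ℚ) ≈-refl
        (≈-trans (≈-* (Bounded-≈ (≈-sym n/ρᵈ≈1) (Bounded-const 1ℚ)) (Bounded-const 1ℚ) n/ρᵈ≈1 (≈1-^ d tρσ≈1))
          (≈-≡ λ _ _ → ℚ.*-identityʳ 1ℚ)))
      (≈-≡ λ _ i → ℚ.*-identityʳ (u i ^ℚ d)))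
      where
      rearrange : ∀ {n i} → Regular n i → fromℕ n * σ n ^ℚ d ≡
        u i ^ℚ d * (fromℕ n * recip (ρ n i ^ℚ d) * (approx t i * ρ n i * σ n) ^ℚ d)
      rearrange {n} {i} (0<t , 0<ρ , _) = sym (trans
        (cong (λ z → u i ^ℚ d * (fromℕ n * recip (ρ n i ^ℚ d) * z))
          (trans (*-^ (approx t i * ρ n i) (σ n) d) (cong (_* σ n ^ℚ d) (*-^ (approx t i) (ρ n i) d))))
        (trans (solve 6 (λ u n v t r σ → u :* (n :* v :* (t :* r :* σ)) := (t :* u) :* (r :* v) :* (n :* σ)) refl
            (u i ^ℚ d) (fromℕ n) (recip (ρ n i ^ℚ d)) (approx t i ^ℚ d) (ρ n i ^ℚ d) (σ n ^ℚ d))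
          (trans (cong₂ (λ x y → x * y * (fromℕ n * σ n ^ℚ d)) tu (*-recip (^-pos d 0<ρ)))
            (trans (cong (_* (fromℕ n * σ n ^ℚ d)) (ℚ.*-identityʳ 1ℚ)) (ℚ.*-identityˡ _)))))
        where
        tu : approx t i ^ℚ d * u i ^ℚ d ≡ 1ℚ
        tu = trans (sym (*-^ (approx t i) (u i) d)) (trans (cong (_^ℚ d) (*-recip 0<t)) (1^ d))

    nσᵈ-bounded : Bounded (λ n _ → fromℕ n * σ n ^ℚ d)
    nσᵈ-bounded = Bounded-≈ (≈-sym nσᵈ≈uᵈ) (Bounded-^ d u-bounded)

    -- As n = (n σᵈ) sᵈ with n σᵈ bounded, s tends to infinity with n.
    σ≈0 : (λ n _ → σ n) ≈ (λ _ _ → 0ℚ)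
    σ≈0 = mk≈ λ δ 0<δ →
      let m , recip≤m = archimedean (recip δ)
          n₀ , le₀ = archimedean (Z * fromℕ m ^ℚ d)
      in Ev-map₂ (λ {n} {i} (n₀<n , reg) nσᵈ≤Z → small δ 0<δ m recip≤m n₀ le₀ n i n₀<n reg nσᵈ≤Z)
           (Ev-map₂ _,_ (Ev-n {λ n → n₀ ℕ.< n} (suc n₀ , λ _ le → le)) regular) ∣nσᵈ∣≤Z
      where
      open Bounded nσᵈ-bounded renaming (bound to Z; bound≥0 to 0≤Z; ∣∣≤bound to ∣nσᵈ∣≤Z)
      small : ∀ δ → 0ℚ < δ → ∀ m → recip δ ≤ fromℕ m → ∀ n₀ → Z * fromℕ m ^ℚ d ≤ fromℕ n₀ → ∀ n i → n₀ ℕ.< n → Regular n i →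
        ℚ.∣ fromℕ n * σ n ^ℚ d ∣ ≤ Z → ℚ.∣ σ n - 0ℚ ∣ ≤ δ
      small δ 0<δ m recip≤m n₀ le₀ n i n₀<n (_ , _ , 0<s , _) nσᵈ≤Z = ℚ.≤-trans
        (ℚ.≤-reflexive (trans (cong ℚ.∣_∣ (ℚ.+-identityʳ (σ n))) (ℚ.0≤p⇒∣p∣≡p (0≤recip 0<s))))
        (recip-≤ 0<δ (ℚ.≤-trans recip≤m (fromℕ-mono (ℕ.≮⇒≥ λ s<m → ℕ.<⇒≱ n₀<n (fromℕ-cancel-≤ (n≤n₀ s<m))))))
        where
        ŝ = fromℕ (s n)
        n≤n₀ : s n ℕ.< m → fromℕ n ≤ fromℕ n₀
        n≤n₀ s<m = begin
          fromℕ n ≡⟨ ℚ.*-identityʳ _ ⟨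
          fromℕ n * 1ℚ ≡⟨ cong (fromℕ n *_) (trans (cong (_^ℚ d) (*-recip 0<s)) (1^ d)) ⟨
          fromℕ n * (ŝ * σ n) ^ℚ d ≡⟨ trans (cong (fromℕ n *_) (*-^ ŝ (σ n) d))
              (solve 3 (λ n s v → n :* (s :* v) := n :* v :* s) refl (fromℕ n) (ŝ ^ℚ d) (σ n ^ℚ d)) ⟩
          fromℕ n * σ n ^ℚ d * ŝ ^ℚ d ≤⟨ *-mono (*-nonNeg (0≤fromℕ n) (^-nonNeg d (0≤recip 0<s))) (^-nonNeg d (0≤fromℕ m))
              (ℚ.≤-trans (p≤∣p∣ _) nσᵈ≤Z) (^-mono d (0≤fromℕ (s n)) (fromℕ-mono (ℕ.<⇒≤ s<m))) ⟩
          Z * fromℕ m ^ℚ d ≤⟨ le₀ ⟩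
          fromℕ n₀ ∎
          where open ℚ.≤-Reasoning

    σ-bounded : Bounded (λ n _ → σ n)
    σ-bounded = Bounded-≈ (≈-sym σ≈0) (Bounded-const 0ℚ)

    f : ℚ
    f = fromℕ (c !)

    -- `w n` is the probability of a given list, and `F n` is the ratio of the falling factorial s(s
    -- - 1)...(s - c + 1) to s^c.
    N w F : ℕ → ℚ
    N n = fromℕ (length (subsetsOfSize c (s n)))
    w n = recip (N n)
    F n = f * N n * σ n ^ℚ c

    0≤f : 0ℚ ≤ f
    0≤f = 0≤fromℕ (c !)

    -- Every factor of the falling factorial lies between s - c and s, so `F` lies between (1 -
    -- c/s)^c and 1.
    F≈1 : (λ n _ → F n) ≈ (λ _ _ → 1ℚ)
    F≈1 = ≈-squeeze {lo = λ n _ → (1ℚ + - fromℕ c * σ n) ^ℚ c} {hi = λ _ _ → 1ℚ} 1ℚ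
      (Ev-regular λ {n} (_ , _ , 0<s , c≤s) → lower n 0<s c≤s , upper n 0<s)
      (≈1-^ c (≈-trans (≈-+ (≈-refl {λ _ _ → 1ℚ}) (≈0-*ˡ (- fromℕ c) σ≈0)) (≈-≡ λ _ _ → ℚ.+-identityʳ 1ℚ)))
      ≈-refl
      where
      fN : ∀ n → f * N n ≡ fromℕ (c ! ℕ.* (s n C c))
      fN n = trans (cong (f *_) (∣subsetsOfSize∣ c (s n))) (sym (fromℕ-*-homo (c !) (s n C c)))
      σᶜ : ∀ n → 0ℚ < fromℕ (s n) → 0ℚ ≤ σ n ^ℚ c
      σᶜ n 0<s = ^-nonNeg c (0≤recip 0<s)
      upper : ∀ n → 0ℚ < fromℕ (s n) → F n ≤ 1ℚ
      upper n 0<s = ℚ.≤-trans (*-monoʳ (σᶜ n 0<s) (ℚ.≤-trans (ℚ.≤-reflexive (fN n)) (fromℕ-mono (falling-≤ (s n) c))))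
        (ℚ.≤-reflexive (trans (cong (_* σ n ^ℚ c) (fromℕ-^ (s n) c)) (trans (sym (*-^ (fromℕ (s n)) (σ n) c))
          (trans (cong (_^ℚ c) (*-recip 0<s)) (1^ c)))))
      lower : ∀ n → 0ℚ < fromℕ (s n) → c ℕ.≤ s n → (1ℚ + - fromℕ c * σ n) ^ℚ c ≤ F n
      lower n 0<s c≤s = ℚ.≤-trans (ℚ.≤-reflexive (trans (cong (_^ℚ c) base)
          (trans (*-^ (fromℕ (s n ∸ c)) (σ n) c) (cong (_* σ n ^ℚ c) (sym (fromℕ-^ (s n ∸ c) c))))))
        (*-monoʳ (σᶜ n 0<s) (ℚ.≤-trans (fromℕ-mono (falling-≥ (s n) c)) (ℚ.≤-reflexive (sym (fN n)))))
        where
        base : 1ℚ + - fromℕ c * σ n ≡ fromℕ (s n ∸ c) * σ n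
        base = begin
          1ℚ + - fromℕ c * σ n ≡⟨ cong (_+ - fromℕ c * σ n) (trans (sym (*-recip 0<s)) (cong (_* σ n)
              (trans (cong fromℕ (sym (ℕ.m∸n+n≡m c≤s))) (fromℕ-+-homo (s n ∸ c) c)))) ⟩
          (fromℕ (s n ∸ c) + fromℕ c) * σ n + - fromℕ c * σ n ≡⟨ solve 3 (λ a b v → (a :+ b) :* v :+ :- b :* v := a :* v) refl (fromℕ (s n ∸ c)) (fromℕ c) (σ n) ⟩
          fromℕ (s n ∸ c) * σ n ∎
          where open ≡-Reasoning

    ½≤F : Ev (λ n _ → ½ ≤ F n)
    ½≤F = ≈1⇒½≤ F≈1

    0<½ : 0ℚ < ½
    0<½ = ℚ.positive⁻¹ ½

    N-pos : ∀ {n i} → Regular n i → ½ ≤ F n → 0ℚ < N n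
    N-pos {n} (_ , _ , 0<s , _) ½≤F = ℚ.≰⇒> λ N≤0 → ℚ.<-irrefl refl (ℚ.<-≤-trans 0<½ (ℚ.≤-trans ½≤F
      (ℚ.≤-trans (*-monoʳ (^-nonNeg c (0≤recip 0<s)) (*-monoˡ 0≤f N≤0))
        (ℚ.≤-reflexive (solve 2 (λ f v → f :* con 0ℚ :* v := con 0ℚ) refl f (σ n ^ℚ c))))))

    w-formula : ∀ {n i} → Regular n i → ½ ≤ F n → w n ≡ f * σ n ^ℚ c * recip (F n)
    w-formula {n} reg ½≤F = recip-unique (N-pos reg ½≤F)
      (trans (solve 4 (λ N f v r → N :* (f :* v :* r) := f :* N :* v :* r) refl (N n) f (σ n ^ℚ c) (recip (F n)))
        (*-recip (ℚ.<-≤-trans 0<½ ½≤F)))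

    Ev-regular-F : ∀ {P : ℕ → ℕ → Set} → (∀ {n i} → Regular n i → ½ ≤ F n → P n i) → Ev P
    Ev-regular-F g = Ev-map₂ g regular ½≤F

    1/F≈1 : (λ n _ → recip (F n)) ≈ (λ _ _ → 1ℚ)
    1/F≈1 = ≈1-recip F≈1

    0^c : 0ℚ ^ℚ c ≡ 0ℚ
    0^c = zero-power 0<c
      where
      zero-power : ∀ {m} → 0 ℕ.< m → 0ℚ ^ℚ m ≡ 0ℚ
      zero-power {suc m} _ = ℚ.*-zeroˡ (0ℚ ^ℚ m)

    w≈0 : (λ n _ → w n) ≈ (λ _ _ → 0ℚ)
    w≈0 = ≈-trans (≈-ev (Ev-regular-F λ {n} reg ½≤F → trans (w-formula reg ½≤F)
        (solve 3 (λ f v r → f :* v :* r := v :* (f :* r)) refl f (σ n ^ℚ c) (recip (F n)))))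
      (≈0-* (≈-trans (≈-^ c σ-bounded σ≈0) (≈-≡ λ _ _ → 0^c))
        (Bounded-* (Bounded-const f) (Bounded-≈ (≈-sym 1/F≈1) (Bounded-const 1ℚ))))

    q : ℕ → ℚ
    q n = w n ^ℚ c

    q≈0 : (λ n _ → q n) ≈ (λ _ _ → 0ℚ)
    q≈0 = ≈-trans (≈-^ c (Bounded-≈ (≈-sym w≈0) (Bounded-const 0ℚ)) w≈0) (≈-≡ λ _ _ → 0^c)

    -- As w = c! σ^c / F, the product n w^c equals (c!)^c · n σ^(c²) · F^(-c), with the last factor
    -- tending to 1.
    nq≈ : (λ n _ → fromℕ n * q n) ≈ (λ _ i → f ^ℚ c * u i ^ℚ d)
    nq≈ = ≈-trans (≈-ev (Ev-regular-F λ {n} reg ½≤F → formula n (w-formula reg ½≤F)))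
      (≈-*ˡ (f ^ℚ c) (≈-trans (≈-* nσᵈ-bounded (Bounded-const 1ℚ) nσᵈ≈uᵈ (≈1-^ c 1/F≈1)) (≈-≡ λ _ i → ℚ.*-identityʳ (u i ^ℚ d))))
      where
      formula : ∀ n → w n ≡ f * σ n ^ℚ c * recip (F n) → fromℕ n * q n ≡ f ^ℚ c * (fromℕ n * σ n ^ℚ d * recip (F n) ^ℚ c)
      formula n e = begin
        fromℕ n * w n ^ℚ c ≡⟨ cong (λ z → fromℕ n * z ^ℚ c) e ⟩
        fromℕ n * (f * σ n ^ℚ c * recip (F n)) ^ℚ c ≡⟨ cong (fromℕ n *_) (trans (*-^ (f * σ n ^ℚ c) (recip (F n)) c)
            (cong (_* recip (F n) ^ℚ c) (trans (*-^ f (σ n ^ℚ c) c)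
            (cong (f ^ℚ c *_) (trans (^-^ (σ n) c c) (cong (σ n ^ℚ_) (sym d≡c*c))))))) ⟩
        fromℕ n * (f ^ℚ c * σ n ^ℚ d * recip (F n) ^ℚ c) ≡⟨ solve 4 (λ n f v r → n :* (f :* v :* r) := f :* (n :* v :* r)) refl
            (fromℕ n) (f ^ℚ c) (σ n ^ℚ d) (recip (F n) ^ℚ c) ⟩
        f ^ℚ c * (fromℕ n * σ n ^ℚ d * recip (F n) ^ℚ c) ∎
        where open ≡-Reasoning

    r : ℕ → ℕ
    r n = length (cliques c k n)

    K L₀ : ℚ
    K = fromℕ (k C c)
    L₀ = fromℕ (length (cliques c k k))

    r-formula : ∀ n → k ℕ.≤ n → fromℕ (r n) ≡ fromℕ (n ∸ k) * K + L₀
    r-formula n k≤n = trans (cong (fromℕ ∘ r) (sym (ℕ.m+[n∸m]≡n k≤n))) (count-cliques c k (n ∸ k))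

    k≤n-ev : Ev (λ n _ → k ℕ.≤ n)
    k≤n-ev = Ev-n {λ n → k ℕ.≤ n} (k , λ _ le → le)

    -- For n ≥ k the number of cliques differs from n K by the constant L₀ - k K, and a constant
    -- times `q` vanishes.
    rq≈ : (λ n _ → fromℕ (r n) * q n) ≈ (λ _ i → K * (f ^ℚ c * u i ^ℚ d))
    rq≈ = ≈-trans (≈-ev (Ev-map (λ {n} k≤n → split n k≤n) k≤n-ev))
      (≈-trans (≈-+ (≈-*ˡ K nq≈) (≈0-*ˡ (L₀ - fromℕ k * K) q≈0)) (≈-≡ λ _ i → ℚ.+-identityʳ (K * (f ^ℚ c * u i ^ℚ d))))
      where
      split : ∀ n → k ℕ.≤ n → fromℕ (r n) * q n ≡ K * (fromℕ n * q n) + (L₀ - fromℕ k * K) * q n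
      split n k≤n = trans (cong (_* q n) (r-formula n k≤n)) (trans
        (solve 5 (λ m k K L q → (m :* K :+ L) :* q := K :* ((m :+ k) :* q) :+ (L :- k :* K) :* q) refl (fromℕ (n ∸ k)) (fromℕ k) K L₀ (q n))
        (cong (λ z → K * (z * q n) + (L₀ - fromℕ k * K) * q n)
          (trans (sym (fromℕ-+-homo (n ∸ k) k)) (cong fromℕ (ℕ.m∸n+n≡m k≤n)))))

    -- Here `c ≤ k` enters: it makes (k choose c) at least 1.
    r→∞ : ∀ m → ∃ λ n₀ → ∀ n → n₀ ℕ.≤ n → m ℕ.≤ r n
    r→∞ m = k ℕ.+ m , λ n le → fromℕ-cancel-≤ (begin
      fromℕ m ≤⟨ fromℕ-mono (ℕ.m+n≤o⇒m≤o∸n m (ℕ.≤-trans (ℕ.≤-reflexive (ℕ.+-comm m k)) le)) ⟩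
      fromℕ (n ∸ k) ≡⟨ ℚ.*-identityʳ _ ⟨
      fromℕ (n ∸ k) * 1ℚ ≤⟨ *-monoˡ (0≤fromℕ (n ∸ k)) (fromℕ-mono {1} (C-pos c≤k)) ⟩
      fromℕ (n ∸ k) * K ≤⟨ ≤-+ʳ (0≤fromℕ (length (cliques c k k))) ⟩
      fromℕ (n ∸ k) * K + L₀ ≡⟨ r-formula n (ℕ.≤-trans (ℕ.m≤m+n k m) le) ⟨
      fromℕ (r n) ∎)
      where open ℚ.≤-Reasoning

    -- The constant in w ≤ B s^(-c): it is c! / F with F ≥ 1/2.
    B : ℚ
    B = f * fromℕ 2

    1≤B : 1ℚ ≤ B
    1≤B = ℚ.≤-trans (fromℕ-mono {1} (ℕ.*-mono-≤ (ℕ.1≤n! c) (s≤s {n = 1} z≤n))) (ℚ.≤-reflexive (fromℕ-*-homo (c !) 2))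

    w≤Bσᶜ : ∀ {n i} → Regular n i → ½ ≤ F n → w n ≤ B * σ n ^ℚ c
    w≤Bσᶜ {n} reg@(_ , _ , 0<s , _) ½≤F = begin
      w n ≡⟨ w-formula reg ½≤F ⟩
      f * σ n ^ℚ c * recip (F n) ≤⟨ *-monoˡ (*-nonNeg 0≤f (^-nonNeg c (0≤recip 0<s))) (ℚ.≤-trans (recip-anti 0<½ ½≤F)
          (ℚ.≤-reflexive (recip-unique {½} {fromℕ 2} 0<½ refl))) ⟩
      f * σ n ^ℚ c * fromℕ 2 ≡⟨ solve 3 (λ f v t → f :* v :* t := f :* t :* v) refl f (σ n ^ℚ c) (fromℕ 2) ⟩
      B * σ n ^ℚ c ∎
      where open ℚ.≤-Reasoning

    dc M : ℚ
    dc = denseConstant c k B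
    M = fromℕ (meetBound c k)

    error : ℕ → ℚ
    error n = fromℕ n * (dc * σ n ^ℚ suc (c ℕ.* c)) + fromℕ (k ℕ.* k) * w n + fromℕ (r n) * (M * w n ^ℚ suc c)

    -- Each term is bounded times null: n σ^(c²+1) = (n σ^(c²)) σ, a constant times w, and r w^(c+1)
    -- = (r q) w.
    error≈0 : (λ n _ → error n) ≈ (λ _ _ → 0ℚ)
    error≈0 = ≈0-+ (≈0-+
        (≈-trans (≈-≡ λ n _ → trans (cong (λ e → fromℕ n * (dc * (σ n * σ n ^ℚ e))) (sym d≡c*c))
            (solve 4 (λ n d σ v → n :* (d :* (σ :* v)) := d :* (σ :* (n :* v))) refl (fromℕ n) dc (σ n) (σ n ^ℚ d)))
          (≈0-*ˡ dc (≈0-* σ≈0 nσᵈ-bounded)))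
        (≈0-*ˡ (fromℕ (k ℕ.* k)) w≈0))
      (≈-trans (≈-≡ λ n _ → solve 4 (λ r m w q → r :* (m :* (w :* q)) := m :* (w :* (r :* q))) refl (fromℕ (r n)) M (w n) (q n))
        (≈0-*ˡ M (≈0-* w≈0 (Bounded-≈ (≈-sym rq≈)
          (Bounded-* (Bounded-const K) (Bounded-* (Bounded-const (f ^ℚ c)) (Bounded-^ d u-bounded)))))))

    p≈power : (λ n _ → p n c k (s n)) ≈ (λ n _ → (1ℚ - q n) ^ℚ r n)
    p≈power = ≈-dominated (Ev-map₂ (λ {n} {i} k<n (reg , ½≤F) → estimate n i k<n reg ½≤F)
        (Ev-n {λ n → k ℕ.< n} (suc k , λ _ le → le)) (Ev-map₂ _,_ regular ½≤F)) error≈0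
      where
      estimate : ∀ n i → k ℕ.< n → Regular n i → ½ ≤ F n → ℚ.∣ p n c k (s n) - (1ℚ - q n) ^ℚ r n ∣ ≤ error n
      estimate n i k<n reg@(_ , _ , 0<s , c≤s) ½≤F = FiniteEstimate.estimate c k n (s n) 0<c k<n (ℕ.≤-trans 0<c c≤s)
        (nonZero (N-pos reg ½≤F)) B (σ n) 1≤B (0<recip 0<s) (*-recip 0<s) (w≤Bσᶜ reg ½≤F)
        where
        nonZero : ∀ {m} → 0ℚ < fromℕ m → 0 ℕ.< m
        nonZero {zero}  h = ⊥-elim (ℚ.<-irrefl refl h)
        nonZero {suc m} h = s≤s z≤n

    -- Only the approximants of `ℓ` matter, so the exponent of the theorem needs to be evaluated
    -- index by index only.
    limit : (ℓ : ℝ) → (∀ i → approx ℓ i ≡ K * u i ^ℚ d * fromℕ ((c !) ℕ.^ c)) → Tendsto (λ n → fromℚ (p n c k (s n))) (exp (-ℝ ℓ))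
    limit ℓ ℓ≡ = ≈⇒Tendsto (λ n → p n c k (s n)) (exp (-ℝ ℓ)) (≈-trans p≈power
      (power→exp r q ℓ (Ev-regular-F λ reg ½≤F → ^-nonNeg c (0≤recip (N-pos reg ½≤F))) q≈0
        (≈-trans rq≈ (≈-≡ λ _ i → sym (trans (ℓ≡ i) (trans (cong (K * u i ^ℚ d *_) (fromℕ-^ (c !) c))
          (solve 3 (λ K v f → K :* v :* f := K :* (f :* v)) refl K (u i ^ℚ d) (f ^ℚ c))))))
        r→∞))

-- The limit theorem for real sequences.

open LimitCalculus using (Tendsto⇒≈; approx-^)
open import Data.Nat.Base using (ℕ; NonZero; _≤_; _^_; _!)
open import Data.Nat.Combinatorics using (_C_)
open import Data.Nat.Properties using (m^n≢0)

theorem2p3 : (c k : ℕ) .{{c≢0 : NonZero c}} .{{k≢0 : NonZero k}} → c ≤ k →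
    (t : ℝ) (t>0 : 0ℝ <ℝ t) (s : ℕ → ℕ) →
    ((n : ℕ) .{{n≢0 : NonZero n}} → c ≤ s n) →
    Asymptotic (λ n → fromℕℝ (s n))
    (λ n → t *ℝ root (c ^ 2) {{m^n≢0 c 2}} n)
    (λ n → *ℝ-pos {t} {root (c ^ 2) {{m^n≢0 c 2}} n} t>0 (root-pos (c ^ 2) {{m^n≢0 c 2}} n)) →
    Tendsto (λ n → fromℚ (p n c k (s n)))
    (exp (-ℝ (fromℕℝ (k C c) *ℝ inv t t>0 ^ℝ (c ^ 2) *ℝ fromℕℝ ((c !) ^ c))))
theorem2p3 c k c≤k t t>0 s c≤s s∼ = limit
  (fromℕℝ (k C c) *ℝ inv t t>0 ^ℝ (c ^ 2) *ℝ fromℕℝ ((c !) ^ c))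
  (λ i → cong (λ v → fromℕ (k C c) ℚ.* v ℚ.* fromℕ ((c !) ^ c)) (approx-^ (inv t t>0) (c ^ 2) i))
  where
  open ParameterLimits.Asymptotics c k (c ^ 2) {{m^n≢0 c 2}} (ℕ.>-nonZero⁻¹ c) c≤k (cong (c ℕ.*_) (ℕ.*-identityʳ c)) t t>0 s c≤s
    -- The approximants of this quotient of reals are by computation the quotients of the
    -- approximants.
    (Tendsto⇒≈ (λ n → fromℕℝ (s n) *ℝ inv (t *ℝ root (c ^ 2) {{m^n≢0 c 2}} n)
        (*ℝ-pos {t} {root (c ^ 2) {{m^n≢0 c 2}} n} t>0 (root-pos (c ^ 2) {{m^n≢0 c 2}} n)))
      1ℝ _ (λ n i → refl) s∼)
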